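{- For every $z\in U$ and every $n\ge1$, if $T^n(z)\ne0$, then $|q_n(z)|<|q_{n+1}(z)|$.
   Context: Let $\zeta=\frac{1+\sqrt{ -3}}2$, $\eta=\frac{3+\sqrt{ -3}}2$, $\mathfrak o(\sqrt{ -3})=\mathbb Z+\mathbb Z\zeta$, $\mathcal J=\eta\cdot\mathfrak o(\sqrt{ -3})$. $U$ is the fundamental domain of $\mathbb C/\mathcal J$ consisting of the open regular hexagon with vertices $\zeta^k$ ($0\le k\le 5$), together with the three open sides $\{t\zeta+(1-t)(-\overline\zeta):0<t<1\}$, $\{t(-\zeta)+(1-t)(-1):0<t<1\}$, $\{t+(1-t)\overline\zeta:0<t<1\}$ and the two vertices $-\zeta,\overline\zeta$. For $z\in\mathbb C$, $[z]$ is the unique $a\in\mathcal J$ with $z\in a+U$. The map $T:U\to U$ is $T(z)=\frac1z-[\frac1z]$ for $z\ne0$, $T(0)=0$ (so $T(-\zeta)=-\zeta$ and $T(\overline\zeta)=\overline\zeta$). The partial quotients $b_n(z)$ are defined as follows. If $T^m(z)\notin\{ -\zeta,\overline\zeta\}$ for all $0\le m\le n-1$ and $T^{n-1}(z)\ne0$, then $b_n(z)=[1/T^{n-1}(z)]$. For the two exceptional points, for $j\ge0$, $b_{4j+1}(-\zeta)=b_{4j+2}(-\zeta)=\sqrt{ -3}$, $b_{4j+3}(-\zeta)=-\overline\eta$, $b_{4j+4}(-\zeta)=\eta$, and $b_{4j+1}(\overline\zeta)=b_{4j+2}(\overline\zeta)=\sqrt{ -3}$, $b_{4j+3}(\overline\zeta)=\eta$,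 $b_{4j+4}(\overline\zeta)=-\overline\eta$. If $m\ge0$ is the smallest integer with $T^m(z)=\xi\in\{ -\zeta,\overline\zeta\}$, then $b_{m+k}(z)=b_k(\xi)$ for all $k\ge1$. The denominators are $q_{ -1}(z)=0$, $q_0(z)=1$, $q_{n+1}(z)=b_{n+1}(z)q_n(z)+q_{n-1}(z)$, defined as long as $T^n(z)\neq0$. -}

module Defs where

open import Algebra.Bundles.Raw using (RawRing)
import Algebra.Definitions.RawMonoid as RawMonoidDefinitions
import Algebra.Definitions.RawSemiring as RawSemiringDefinitions
open import Data.Empty using (⊥; ⊥-elim)
open import Data.Fin.Base using (Fin; toℕ)
open import Data.Integer.Base as ℤ using (ℤ; +_; -[1+_])
import Data.Integer.DivMod as ℤ
import Data.Integer.Properties as ℤ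
open import Data.Nat.Base as ℕ using (ℕ; zero; suc)
open import Data.Nat.Coprimality as Coprime using (1-coprimeTo)
import Data.Nat.Properties as ℕ
open import Data.Product.Base using (_×_; _,_; ∃-syntax)
open import Data.Rational.Base as ℚ using (ℚ; mkℚ; 0ℚ; 1ℚ; ½; floor; *≤*; *<*)
import Data.Rational.Properties as ℚ
open import Data.Rational.Solver using (module +-*-Solver)
open import Data.Sum.Base as Sum using (_⊎_; inj₁; inj₂)
open import Level using (0ℓ)
open import Relation.Binary.PropositionalEquality
open import Relation.Nullary using (¬_; yes; no)
open import Relation.Unary using (Pred; _∈_)

module Auxiliary where

  open +-*-Solver

  ½-pos : ∀ {ε} → 0ℚ ℚ.< ε → 0ℚ ℚ.< ½ ℚ.* ε
  ½-pos {ε} 0<ε = subst (ℚ._< ½ ℚ.* ε) (ℚ.*-zeroʳ ½) (ℚ.*-monoʳ-<-pos ½ 0<ε)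

  sq-pos : ∀ {p} → 0ℚ ℚ.< p → 0ℚ ℚ.< p ℚ.* p
  sq-pos {p} 0<p = subst (ℚ._< p ℚ.* p) (ℚ.*-zeroʳ p) (ℚ.*-monoʳ-<-pos p {{ℚ.positive 0<p}} 0<p)

  ½+½ : ∀ ε → ½ ℚ.* ε ℚ.+ ½ ℚ.* ε ≡ ε
  ½+½ ε = trans (sym (ℚ.*-distribʳ-+ ε ½ ½)) (ℚ.*-identityˡ ε)

  ∣+∣<ε : ∀ {ε} p q → ℚ.∣ p ∣ ℚ.< ½ ℚ.* ε → ℚ.∣ q ∣ ℚ.< ½ ℚ.* ε → ℚ.∣ p ℚ.+ q ∣ ℚ.< ε
  ∣+∣<ε {ε} p q p< q< =
    ℚ.≤-<-trans (ℚ.∣p+q∣≤∣p∣+∣q∣ p q) (subst (_ ℚ.<_) (½+½ ε) (ℚ.+-mono-< p< q<))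

  ∣-∣<ε : ∀ {ε p q} → p ℚ.< q ℚ.+ ε → q ℚ.< p ℚ.+ ε → ℚ.∣ p ℚ.- q ∣ ℚ.< ε
  ∣-∣<ε {ε} {p} {q} p< q< with ℚ.∣p∣≡p∨∣p∣≡-p (p ℚ.- q)
  ... | inj₁ eq = subst₂ ℚ._<_ (sym eq)
    (solve 2 (λ q ε → q :+ ε :- q := ε) refl q ε) (ℚ.+-monoˡ-< (ℚ.- q) p<)
  ... | inj₂ eq = subst₂ ℚ._<_
    (trans (solve 2 (λ p q → q :- p := :- (p :- q)) refl p q) (sym eq))
    (solve 2 (λ p ε → p :+ ε :- p := ε) refl p ε) (ℚ.+-monoˡ-< (ℚ.- p) q<)

  ∣p-p∣<ε : ∀ {ε} p → 0ℚ ℚ.< ε → ℚ.∣ p ℚ.- p ∣ ℚ.< ε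
  ∣p-p∣<ε p 0<ε = subst (ℚ._< _) (sym (cong ℚ.∣_∣ (ℚ.+-inverseʳ p))) 0<ε

  p≤∣p∣ : ∀ p → p ℚ.≤ ℚ.∣ p ∣
  p≤∣p∣ p with ℚ.≤-total 0ℚ p
  ... | inj₁ 0≤p = ℚ.≤-reflexive (sym (ℚ.0≤p⇒∣p∣≡p 0≤p))
  ... | inj₂ p≤0 = ℚ.≤-trans p≤0 (ℚ.0≤∣p∣ p)

  *-mono-≤ : ∀ {p q r s} → 0ℚ ℚ.≤ p → 0ℚ ℚ.≤ s → p ℚ.≤ q → r ℚ.≤ s → p ℚ.* r ℚ.≤ q ℚ.* s
  *-mono-≤ {p} {q} {r} {s} 0≤p 0≤s p≤q r≤s = ℚ.≤-trans
    (ℚ.*-monoˡ-≤-nonNeg p {{ℚ.nonNegative 0≤p}} r≤s)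
    (ℚ.*-monoʳ-≤-nonNeg s {{ℚ.nonNegative 0≤s}} p≤q)

  ∣*∣<ε : ∀ {K δ} p q → 0ℚ ℚ.< K → ℚ.∣ p ∣ ℚ.≤ K → ℚ.∣ q ∣ ℚ.< δ → ℚ.∣ p ℚ.* q ∣ ℚ.< K ℚ.* δ
  ∣*∣<ε {K} {δ} p q 0<K p≤K q<δ = ℚ.≤-<-trans
    (ℚ.≤-trans (ℚ.≤-reflexive (ℚ.∣p*q∣≡∣p∣*∣q∣ p q))
      (ℚ.*-monoʳ-≤-nonNeg ℚ.∣ q ∣ {{ℚ.∣-∣-nonNeg q}} p≤K))
    (ℚ.*-monoʳ-<-pos K {{ℚ.positive 0<K}} q<δ)

  fromℤ : ℤ → ℚ
  fromℤ i = mkℚ i 0 (Coprime.sym (1-coprimeTo _))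

  /1≡fromℤ : ∀ i → i ℚ./ 1 ≡ fromℤ i
  /1≡fromℤ i = ℚ.↥p/↧p≡p (fromℤ i)

  fromℤ-* : ∀ i j → fromℤ (i ℤ.* j) ≡ fromℤ i ℚ.* fromℤ j
  fromℤ-* i j = sym (/1≡fromℤ (i ℤ.* j))

  fromℤ-suc : ∀ k → fromℤ (+ suc k) ≡ fromℤ (+ k) ℚ.+ 1ℚ
  fromℤ-suc k = sym (trans (/1≡fromℤ _) (cong fromℤ
    (trans (cong (ℤ._+ + 1) (ℤ.*-identityʳ (+ k))) (cong +_ (ℕ.+-comm k 1)))))

  fromℤ-mono-≤ : ∀ {i j} → i ℤ.≤ j → fromℤ i ℚ.≤ fromℤ j
  fromℤ-mono-≤ i≤j = *≤* (ℤ.*-monoʳ-≤-nonNeg (+ 1) i≤j)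

  fromℤ-floor-≤ : ∀ r → fromℤ (floor r) ℚ.≤ r
  fromℤ-floor-≤ r@(mkℚ p d _) =
    *≤* (subst (floor r ℤ.* + suc d ℤ.≤_) (sym (ℤ.*-identityʳ p)) (ℤ.[n/d]*d≤n p (+ suc d)))

  <-fromℤ-suc-floor : ∀ r → r ℚ.< fromℤ (ℤ.suc (floor r))
  <-fromℤ-suc-floor r@(mkℚ p d _) =
    *<* (subst₂ (λ i j → i ℤ.< ℤ.suc j ℤ.* + suc d) (sym (ℤ.*-identityʳ p))
      (sym (ℤ.div-pos-is-/ℕ p (suc d))) (ℤ.n<s[n/ℕd]*d p (suc d)))

  1/suc : ℕ → ℚ
  1/suc n = mkℚ (+ 1) n (1-coprimeTo _)

  /suc : ∀ i n → i ℚ./ suc n ≡ fromℤ i ℚ.* 1/suc n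
  /suc i n = ℚ./-cong (sym (ℤ.*-identityʳ i)) (sym (ℕ.*-identityˡ (suc n)))

  1/suc-inverse : ∀ n → fromℤ (+ suc n) ℚ.* 1/suc n ≡ 1ℚ
  1/suc-inverse n = ℚ.*-inverseʳ (fromℤ (+ suc n))

  0<1/suc : ∀ n → 0ℚ ℚ.< 1/suc n
  0<1/suc n = ℚ.positive⁻¹ (1/suc n)

  archimedean : ∀ ε → 0ℚ ℚ.< ε → ∃[ N ] ∀ n → N ℕ.≤ n → 1/suc n ℚ.< ε
  archimedean (mkℚ (+ suc p) d _) _ = suc d , λ n d<n →
    *<* (ℤ.+<+ (ℕ.<-≤-trans
      (ℕ.s≤s (ℕ.≤-trans (ℕ.≤-reflexive (ℕ.+-identityʳ (suc d))) d<n))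
      (ℕ.m≤m+n (suc n) (p ℕ.* suc n))))
  archimedean (mkℚ (+ 0) d _) (*<* 0<0) = ⊥-elim (ℤ.<-irrefl refl 0<0)
  archimedean (mkℚ -[1+ p ] d _) (*<* ())

  isqrt : ℕ → ℕ
  isqrt zero    = zero
  isqrt (suc m) with suc (isqrt m) ℕ.* suc (isqrt m) ℕ.≤? suc m
  ... | yes _ = suc (isqrt m)
  ... | no  _ = isqrt m

  isqrt-≤ : ∀ m → isqrt m ℕ.* isqrt m ℕ.≤ m
  isqrt-≤ zero    = ℕ.z≤n
  isqrt-≤ (suc m) with suc (isqrt m) ℕ.* suc (isqrt m) ℕ.≤? suc m
  ... | yes p = p
  ... | no  _ = ℕ.m≤n⇒m≤1+n (isqrt-≤ m)

  <-isqrt : ∀ m → m ℕ.< suc (isqrt m) ℕ.* suc (isqrt m)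
  <-isqrt zero    = ℕ.s≤s ℕ.z≤n
  <-isqrt (suc m) with suc (isqrt m) ℕ.* suc (isqrt m) ℕ.≤? suc m
  ... | yes _ = ℕ.≤-<-trans (<-isqrt m) (ℕ.*-mono-< (ℕ.n<1+n (suc (isqrt m))) (ℕ.n<1+n (suc (isqrt m))))
  ... | no ¬p = ℕ.≰⇒> ¬p

  isqrtℤ : ℤ → ℕ
  isqrtℤ (+ m)    = isqrt m
  isqrtℤ -[1+ _ ] = zero

  isqrtℤ-≤ : ∀ i → isqrtℤ i ≡ 0 ⊎ + (isqrtℤ i ℕ.* isqrtℤ i) ℤ.≤ i
  isqrtℤ-≤ (+ m)    = inj₂ (ℤ.+≤+ (isqrt-≤ m))
  isqrtℤ-≤ -[1+ _ ] = inj₁ refl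

  suc-≤-isqrtℤ : ∀ i → ℤ.suc i ℤ.≤ + (suc (isqrtℤ i) ℕ.* suc (isqrtℤ i))
  suc-≤-isqrtℤ (+ m)          = ℤ.+≤+ (<-isqrt m)
  suc-≤-isqrtℤ -[1+ zero ]    = ℤ.+≤+ ℕ.z≤n
  suc-≤-isqrtℤ -[1+ suc _ ]   = ℤ.-≤+

  scale : ℚ → ℕ → ℚ
  scale r n = r ℚ.* (fromℤ (+ suc n) ℚ.* fromℤ (+ suc n))

  √-numerator : ℚ → ℕ → ℕ
  √-numerator r n = isqrtℤ (floor (scale r n))

  module _ {r R D V : ℚ} (k : ℕ) (R≡ : R ≡ r ℚ.* (D ℚ.* D)) (DV≡1 : D ℚ.* V ≡ 1ℚ) (0<V : 0ℚ ℚ.< V) where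

    private
      K : ℚ
      K = fromℤ (+ k)

    R*V² : R ℚ.* (V ℚ.* V) ≡ r
    R*V² = begin
      R ℚ.* (V ℚ.* V)
        ≡⟨ cong (ℚ._* (V ℚ.* V)) R≡ ⟩
      r ℚ.* (D ℚ.* D) ℚ.* (V ℚ.* V)
        ≡⟨ solve 3 (λ r D V → r :* (D :* D) :* (V :* V) := r :* ((D :* V) :* (D :* V))) refl r D V ⟩
      r ℚ.* ((D ℚ.* V) ℚ.* (D ℚ.* V))
        ≡⟨ cong (λ x → r ℚ.* (x ℚ.* x)) DV≡1 ⟩
      r ℚ.* (1ℚ ℚ.* 1ℚ)
        ≡⟨ ℚ.*-identityʳ r ⟩
      r ∎
      where open ≡-Reasoning

    0<V² : 0ℚ ℚ.< V ℚ.* V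
    0<V² = sq-pos 0<V

    scaled-≤ : + (k ℕ.* k) ℤ.≤ floor R → (K ℚ.* V) ℚ.* (K ℚ.* V) ℚ.≤ r
    scaled-≤ k²≤ = begin
      (K ℚ.* V) ℚ.* (K ℚ.* V)
        ≡⟨ solve 2 (λ K V → (K :* V) :* (K :* V) := (K :* K) :* (V :* V)) refl K V ⟩
      (K ℚ.* K) ℚ.* (V ℚ.* V)
        ≤⟨ ℚ.*-monoʳ-≤-nonNeg (V ℚ.* V) {{ℚ.nonNegative (ℚ.<⇒≤ 0<V²)}} K²≤R ⟩
      R ℚ.* (V ℚ.* V)
        ≡⟨ R*V² ⟩
      r ∎
      where
      open ℚ.≤-Reasoning
      K²≤R : K ℚ.* K ℚ.≤ R
      K²≤R = ℚ.≤-trans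
        (ℚ.≤-reflexive (sym (trans (cong fromℤ (ℤ.pos-* k k)) (fromℤ-* (+ k) (+ k)))))
        (ℚ.≤-trans (fromℤ-mono-≤ k²≤) (fromℤ-floor-≤ R))

    <-scaled : ℤ.suc (floor R) ℤ.≤ + (suc k ℕ.* suc k) → r ℚ.< (K ℚ.* V ℚ.+ V) ℚ.* (K ℚ.* V ℚ.+ V)
    <-scaled ≤k² = begin-strict
      r
        ≡⟨ sym R*V² ⟩
      R ℚ.* (V ℚ.* V)
        <⟨ ℚ.*-monoˡ-<-pos (V ℚ.* V) {{ℚ.positive 0<V²}} R< ⟩
      (K ℚ.+ 1ℚ) ℚ.* (K ℚ.+ 1ℚ) ℚ.* (V ℚ.* V)
        ≡⟨ solve 3 (λ K V I → (K :+ I) :* (K :+ I) :* (V :* V)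
             := (K :* V :+ I :* V) :* (K :* V :+ I :* V)) refl K V 1ℚ ⟩
      (K ℚ.* V ℚ.+ 1ℚ ℚ.* V) ℚ.* (K ℚ.* V ℚ.+ 1ℚ ℚ.* V)
        ≡⟨ cong (λ x → (K ℚ.* V ℚ.+ x) ℚ.* (K ℚ.* V ℚ.+ x)) (ℚ.*-identityˡ V) ⟩
      (K ℚ.* V ℚ.+ V) ℚ.* (K ℚ.* V ℚ.+ V)
        ∎
      where
      open ℚ.≤-Reasoning
      R< : R ℚ.< (K ℚ.+ 1ℚ) ℚ.* (K ℚ.+ 1ℚ)
      R< = ℚ.<-≤-trans (<-fromℤ-suc-floor R) (ℚ.≤-trans (fromℤ-mono-≤ ≤k²)
        (ℚ.≤-reflexive (trans (cong fromℤ (ℤ.pos-* (suc k) (suc k)))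
          (trans (fromℤ-* (+ suc k) (+ suc k)) (cong (λ x → x ℚ.* x) (fromℤ-suc k))))))

  opaque

    -- ⌊ (n+1) √r ⌋ / (n+1) for r ≥ 0, and 0 for r < 0
    √≈ : ℚ → ℕ → ℚ
    √≈ r n = + √-numerator r n ℚ./ suc n

    0≤√≈ : ∀ r n → 0ℚ ℚ.≤ √≈ r n
    0≤√≈ r n = ℚ.nonNegative⁻¹ (√≈ r n) {{ℚ.normalize-nonNeg (√-numerator r n) (suc n)}}

    √≈²≤ : ∀ r n → √≈ r n ≡ 0ℚ ⊎ √≈ r n ℚ.* √≈ r n ℚ.≤ r
    √≈²≤ r n = Sum.map
      (λ k≡0 → trans (cong (λ k → + k ℚ./ suc n) k≡0) (ℚ.0/n≡0 (suc n)))
      (λ k²≤ → subst (λ x → x ℚ.* x ℚ.≤ r) (sym (/suc (+ √-numerator r n) n))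
                 (scaled-≤ {r} {scale r n} {fromℤ (+ suc n)} {1/suc n} (√-numerator r n) refl (1/suc-inverse n) (0<1/suc n) k²≤))
      (isqrtℤ-≤ (floor (scale r n)))

    <√≈² : ∀ r n → r ℚ.< (√≈ r n ℚ.+ 1/suc n) ℚ.* (√≈ r n ℚ.+ 1/suc n)
    <√≈² r n = subst (λ x → r ℚ.< (x ℚ.+ 1/suc n) ℚ.* (x ℚ.+ 1/suc n)) (sym (/suc (+ √-numerator r n) n))
      (<-scaled {r} {scale r n} {fromℤ (+ suc n)} {1/suc n} (√-numerator r n) refl (1/suc-inverse n) (0<1/suc n)
        (suc-≤-isqrtℤ (floor (scale r n))))

  root-< : ∀ {ε r s a b V} → 0ℚ ℚ.< ε → V ℚ.< ½ ℚ.* ε → 0ℚ ℚ.≤ b → 0ℚ ℚ.≤ V →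
           a ≡ 0ℚ ⊎ a ℚ.* a ℚ.≤ r → s ℚ.< (b ℚ.+ V) ℚ.* (b ℚ.+ V) →
           ℚ.∣ r ℚ.- s ∣ ℚ.< (½ ℚ.* ε) ℚ.* (½ ℚ.* ε) → a ℚ.< b ℚ.+ ε
  root-< {ε} {r} {s} {a} {b} {V} 0<ε V<h 0≤b 0≤V a²≤ s< r-s< with a ℚ.<? b ℚ.+ ε
  ... | yes lt = lt
  ... | no ¬lt = ⊥-elim (refute a²≤)
    where
    open ℚ.≤-Reasoning
    h t : ℚ
    h = ½ ℚ.* ε
    t = b ℚ.+ V
    0≤h : 0ℚ ℚ.≤ h
    0≤h = ℚ.<⇒≤ (½-pos 0<ε)
    0≤t : 0ℚ ℚ.≤ t
    0≤t = ℚ.+-mono-≤ 0≤b 0≤V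
    0≤th : 0ℚ ℚ.≤ t ℚ.* h
    0≤th = *-mono-≤ ℚ.≤-refl 0≤h 0≤t 0≤h
    0≤t+h : 0ℚ ℚ.≤ t ℚ.+ h
    0≤t+h = ℚ.+-mono-≤ 0≤t 0≤h
    t+h≤a : t ℚ.+ h ℚ.≤ a
    t+h≤a = begin
      b ℚ.+ V ℚ.+ h      ≤⟨ ℚ.+-monoˡ-≤ h (ℚ.+-monoʳ-≤ b (ℚ.<⇒≤ V<h)) ⟩
      b ℚ.+ h ℚ.+ h      ≡⟨ ℚ.+-assoc b h h ⟩
      b ℚ.+ (h ℚ.+ h)    ≡⟨ cong (b ℚ.+_) (½+½ ε) ⟩
      b ℚ.+ ε            ≤⟨ ℚ.≮⇒≥ ¬lt ⟩
      a                  ∎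
    refute : a ≡ 0ℚ ⊎ a ℚ.* a ℚ.≤ r → ⊥
    refute (inj₁ a≡0) = ℚ.<-irrefl refl (begin-strict
      0ℚ          <⟨ 0<ε ⟩
      ε           ≡⟨ sym (ℚ.+-identityˡ ε) ⟩
      0ℚ ℚ.+ ε    ≤⟨ ℚ.+-monoˡ-≤ ε 0≤b ⟩
      b ℚ.+ ε     ≤⟨ ℚ.≮⇒≥ ¬lt ⟩
      a           ≡⟨ a≡0 ⟩
      0ℚ          ∎)
    refute (inj₂ a²≤r) = ℚ.<-irrefl refl (begin-strict
      s ℚ.+ h ℚ.* h                                    <⟨ ℚ.+-monoˡ-< (h ℚ.* h) s< ⟩
      t ℚ.* t ℚ.+ h ℚ.* h                              ≡⟨ sym (ℚ.+-identityʳ _) ⟩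
      t ℚ.* t ℚ.+ h ℚ.* h ℚ.+ 0ℚ                       ≤⟨ ℚ.+-monoʳ-≤ (t ℚ.* t ℚ.+ h ℚ.* h) (ℚ.+-mono-≤ 0≤th 0≤th) ⟩
      t ℚ.* t ℚ.+ h ℚ.* h ℚ.+ (t ℚ.* h ℚ.+ t ℚ.* h)    ≡⟨ solve 2 (λ t h → t :* t :+ h :* h :+ (t :* h :+ t :* h)
                                                            := (t :+ h) :* (t :+ h)) refl t h ⟩
      (t ℚ.+ h) ℚ.* (t ℚ.+ h)                          ≤⟨ *-mono-≤ 0≤t+h (ℚ.≤-trans 0≤t+h t+h≤a) t+h≤a t+h≤a ⟩
      a ℚ.* a                                          ≤⟨ a²≤r ⟩
      r                                                ≡⟨ solve 2 (λ r s → r := s :+ (r :- s)) refl r s ⟩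
      s ℚ.+ (r ℚ.- s)                                  ≤⟨ ℚ.+-monoʳ-≤ s (p≤∣p∣ (r ℚ.- s)) ⟩
      s ℚ.+ ℚ.∣ r ℚ.- s ∣                              <⟨ ℚ.+-monoʳ-< s r-s< ⟩
      s ℚ.+ h ℚ.* h                                    ∎)

  √≈-< : ∀ {ε} r s m n → 0ℚ ℚ.< ε → 1/suc n ℚ.< ½ ℚ.* ε →
         ℚ.∣ r ℚ.- s ∣ ℚ.< (½ ℚ.* ε) ℚ.* (½ ℚ.* ε) → √≈ r m ℚ.< √≈ s n ℚ.+ ε
  √≈-< r s m n 0<ε V<h = root-< {r = r} {s} {√≈ r m} {√≈ s n} {1/suc n} 0<ε V<h
    (0≤√≈ s n) (ℚ.<⇒≤ (0<1/suc n)) (√≈²≤ r m) (<√≈² s n)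

record ℝ : Set where
  constructor mkℝ
  field
    seq    : ℕ → ℚ
    cauchy : ∀ ε → 0ℚ ℚ.< ε → ∃[ N ] ∀ m n → N ℕ.≤ m → N ℕ.≤ n → ℚ.∣ seq m ℚ.- seq n ∣ ℚ.< ε

open ℝ public

module Real where

  open Auxiliary
  open +-*-Solver

  infix  4 _≈_ _<_
  infixl 6 _+_
  infixl 7 _*_
  infix  8 -_

  _≈_ : ℝ → ℝ → Set
  x ≈ y = ∀ ε → 0ℚ ℚ.< ε → ∃[ N ] ∀ n → N ℕ.≤ n → ℚ.∣ seq x n ℚ.- seq y n ∣ ℚ.< ε

  _<_ : ℝ → ℝ → Set
  x < y = ∃[ ε ] 0ℚ ℚ.< ε × ∃[ N ] ∀ n → N ℕ.≤ n → seq x n ℚ.+ ε ℚ.≤ seq y n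

  fromℚ : ℚ → ℝ
  fromℚ p = mkℝ (λ _ → p) λ ε 0<ε → 0 , λ _ _ _ _ → ∣p-p∣<ε p 0<ε

  0# 1# : ℝ
  0# = fromℚ 0ℚ
  1# = fromℚ 1ℚ

  _+_ : ℝ → ℝ → ℝ
  seq (x + y) n = seq x n ℚ.+ seq y n
  cauchy (x + y) ε 0<ε =
    let M , x-cauchy = cauchy x (½ ℚ.* ε) (½-pos 0<ε)
        N , y-cauchy = cauchy y (½ ℚ.* ε) (½-pos 0<ε)
    in M ℕ.⊔ N , λ m n ≤m ≤n → subst (λ p → ℚ.∣ p ∣ ℚ.< ε)
      (solve 4 (λ a b c d → (a :- b) :+ (c :- d) := (a :+ c) :- (b :+ d)) refl
        (seq x m) (seq x n) (seq y m) (seq y n))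
      (∣+∣<ε (seq x m ℚ.- seq x n) (seq y m ℚ.- seq y n)
        (x-cauchy m n (ℕ.m⊔n≤o⇒m≤o M N ≤m) (ℕ.m⊔n≤o⇒m≤o M N ≤n))
        (y-cauchy m n (ℕ.m⊔n≤o⇒n≤o M N ≤m) (ℕ.m⊔n≤o⇒n≤o M N ≤n)))

  -_ : ℝ → ℝ
  seq (- x) n = ℚ.- seq x n
  cauchy (- x) ε 0<ε =
    let N , x-cauchy = cauchy x ε 0<ε
    in N , λ m n ≤m ≤n → subst (ℚ._< ε)
      (trans (sym (ℚ.∣-p∣≡∣p∣ (seq x m ℚ.- seq x n)))
        (cong ℚ.∣_∣ (solve 2 (λ a b → :- (a :- b) := :- a :- :- b) refl (seq x m) (seq x n))))
      (x-cauchy m n ≤m ≤n)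

  bounded : ∀ x → ∃[ K ] 0ℚ ℚ.< K × ∃[ N ] ∀ n → N ℕ.≤ n → ℚ.∣ seq x n ∣ ℚ.≤ K
  bounded x =
    let N , x-cauchy = cauchy x 1ℚ (ℚ.positive⁻¹ 1ℚ)
        a = seq x N
    in 1ℚ ℚ.+ ℚ.∣ a ∣
     , ℚ.+-mono-<-≤ (ℚ.positive⁻¹ 1ℚ) (ℚ.0≤∣p∣ a)
     , N , λ n ≤n → ℚ.≤-trans
         (ℚ.≤-reflexive (cong ℚ.∣_∣ (solve 2 (λ a b → b := (b :- a) :+ a) refl a (seq x n))))
         (ℚ.≤-trans (ℚ.∣p+q∣≤∣p∣+∣q∣ (seq x n ℚ.- a) a)
           (ℚ.+-monoˡ-≤ ℚ.∣ a ∣ (ℚ.<⇒≤ (x-cauchy n N ≤n ℕ.≤-refl))))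

  divide : ∀ {ε} K → 0ℚ ℚ.< K → 0ℚ ℚ.< ε → ∃[ δ ] 0ℚ ℚ.< δ × K ℚ.* δ ≡ ε
  divide {ε} K 0<K 0<ε = K⁻¹ ℚ.* ε
    , subst (ℚ._< K⁻¹ ℚ.* ε) (ℚ.*-zeroʳ K⁻¹) (ℚ.*-monoʳ-<-pos K⁻¹ {{ℚ.1/pos⇒pos K}} 0<ε)
    , trans (sym (ℚ.*-assoc K K⁻¹ ε)) (trans (cong (ℚ._* ε) (ℚ.*-inverseʳ K)) (ℚ.*-identityˡ ε))
    where
    instance
      _ = ℚ.positive 0<K
      _ = ℚ.pos⇒nonZero K
    K⁻¹ : ℚ
    K⁻¹ = ℚ.1/ K

  _*_ : ℝ → ℝ → ℝ
  seq (x * y) n = seq x n ℚ.* seq y n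
  cauchy (x * y) ε 0<ε =
    let K , 0<K , M₁ , x≤K = bounded x
        L , 0<L , N₁ , y≤L = bounded y
        δ , 0<δ , Kδ≡ = divide K 0<K (½-pos 0<ε)
        γ , 0<γ , Lγ≡ = divide L 0<L (½-pos 0<ε)
        M₂ , x-cauchy = cauchy x γ 0<γ
        N₂ , y-cauchy = cauchy y δ 0<δ
        M = M₁ ℕ.⊔ M₂
        N = N₁ ℕ.⊔ N₂
    in M ℕ.⊔ N , λ m n ≤m ≤n →
      let M≤m = ℕ.m⊔n≤o⇒m≤o M N ≤m
          M≤n = ℕ.m⊔n≤o⇒m≤o M N ≤n
          N≤m = ℕ.m⊔n≤o⇒n≤o M N ≤m
          N≤n = ℕ.m⊔n≤o⇒n≤o M N ≤n
          Δx = seq x m ℚ.- seq x n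
          Δy = seq y m ℚ.- seq y n
      in subst (λ p → ℚ.∣ p ∣ ℚ.< ε)
        (solve 4 (λ a b c d → a :* (c :- d) :+ d :* (a :- b) := a :* c :- b :* d) refl
          (seq x m) (seq x n) (seq y m) (seq y n))
        (∣+∣<ε (seq x m ℚ.* Δy) (seq y n ℚ.* Δx)
          (subst (_ ℚ.<_) Kδ≡ (∣*∣<ε (seq x m) Δy 0<K
            (x≤K m (ℕ.m⊔n≤o⇒m≤o M₁ M₂ M≤m))
            (y-cauchy m n (ℕ.m⊔n≤o⇒n≤o N₁ N₂ N≤m) (ℕ.m⊔n≤o⇒n≤o N₁ N₂ N≤n))))
          (subst (_ ℚ.<_) Lγ≡ (∣*∣<ε (seq y n) Δx 0<L
            (y≤L n (ℕ.m⊔n≤o⇒m≤o N₁ N₂ N≤n))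
            (x-cauchy m n (ℕ.m⊔n≤o⇒n≤o M₁ M₂ M≤m) (ℕ.m⊔n≤o⇒n≤o M₁ M₂ M≤n)))))

  -- The square root of the positive part: √ x ≈ 0# for x ≤ 0.
  √ : ℝ → ℝ
  seq (√ x) n = √≈ (seq x n) n
  cauchy (√ x) ε 0<ε =
    let M , x-cauchy = cauchy x ((½ ℚ.* ε) ℚ.* (½ ℚ.* ε)) (sq-pos (½-pos 0<ε))
        N , 1/suc< = archimedean (½ ℚ.* ε) (½-pos 0<ε)
    in M ℕ.⊔ N , λ m n ≤m ≤n →
      let M≤m = ℕ.m⊔n≤o⇒m≤o M N ≤m
          M≤n = ℕ.m⊔n≤o⇒m≤o M N ≤n
          N≤m = ℕ.m⊔n≤o⇒n≤o M N ≤m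
          N≤n = ℕ.m⊔n≤o⇒n≤o M N ≤n
      in ∣-∣<ε
        (√≈-< (seq x m) (seq x n) m n 0<ε (1/suc< n N≤n) (x-cauchy m n M≤m M≤n))
        (√≈-< (seq x n) (seq x m) n m 0<ε (1/suc< m N≤m) (x-cauchy n m M≤n M≤m))

  rawRing : RawRing 0ℓ 0ℓ
  rawRing = record { _≈_ = _≈_ ; _+_ = _+_ ; _*_ = _*_ ; -_ = -_ ; 0# = 0# ; 1# = 1# }

record ℂ : Set where
  constructor _+i_
  field
    re im : ℝ

open ℂ public

module Complex where

  infix  4 _≈_
  infixl 6 _+_ _-_
  infixl 7 _*_ _·_
  infix  8 -_

  _≈_ : ℂ → ℂ → Set
  z ≈ w = re z Real.≈ re w × im z Real.≈ im w

  fromℝ : ℝ → ℂ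
  fromℝ x = x +i Real.0#

  fromℤ : ℤ → ℂ
  fromℤ m = fromℝ (Real.fromℚ (m ℚ./ 1))

  0# 1# : ℂ
  0# = fromℝ Real.0#
  1# = fromℝ Real.1#

  _+_ _*_ : ℂ → ℂ → ℂ
  z + w = (re z Real.+ re w) +i (im z Real.+ im w)
  z * w = (re z Real.* re w Real.+ Real.- (im z Real.* im w)) +i
          (re z Real.* im w Real.+ im z Real.* re w)

  -_ conj : ℂ → ℂ
  - z    = (Real.- re z) +i (Real.- im z)
  conj z = re z +i (Real.- im z)

  _-_ : ℂ → ℂ → ℂ
  z - w = z + (- w)

  _·_ : ℝ → ℂ → ℂ
  t · z = fromℝ t * z

  ∣_∣ : ℂ → ℝ
  ∣ z ∣ = Real.√ (re z Real.* re z Real.+ im z Real.* im z)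

  rawRing : RawRing 0ℓ 0ℓ
  rawRing = record { _≈_ = _≈_ ; _+_ = _+_ ; _*_ = _*_ ; -_ = -_ ; 0# = 0# ; 1# = 1# }

  open RawRing rawRing public using (+-rawMonoid; rawSemiring)
  open RawMonoidDefinitions +-rawMonoid public using (sum)
  open RawSemiringDefinitions rawSemiring public using (_^_)

open Complex

√-3 ζ η : ℂ
√-3 = Real.0# +i Real.√ (Real.fromℚ (+ 3 ℚ./ 1))
ζ   = Real.fromℚ ½ · (1# + √-3)
η   = Real.fromℚ ½ · (fromℤ (+ 3) + √-3)

𝔬 : Pred ℂ 0ℓ
𝔬 z = ∃[ m ] ∃[ n ] z ≈ fromℤ m + fromℤ n * ζ

𝒥 : Pred ℂ 0ℓ
𝒥 z = ∃[ c ] c ∈ 𝔬 × z ≈ η * c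

-- The interior of the convex hull of the vertices: the convex combinations in
-- which every vertex has a positive weight.
OpenHexagon : Pred ℂ 0ℓ
OpenHexagon z = ∃[ t ] (∀ (k : Fin 6) → Real.0# Real.< t k)
              × RawMonoidDefinitions.sum (RawRing.+-rawMonoid Real.rawRing) t Real.≈ Real.1#
              × z ≈ sum (λ k → t k · (ζ ^ toℕ k))

OpenSegment : ℂ → ℂ → Pred ℂ 0ℓ
OpenSegment a b z = ∃[ t ] Real.0# Real.< t × t Real.< Real.1#
                  × z ≈ t · a + (Real.1# Real.+ Real.- t) · b

data U : Pred ℂ 0ℓ where
  interior : ∀ {z} → z ∈ OpenHexagon → z ∈ U
  side₁    : ∀ {z} → z ∈ OpenSegment ζ (- conj ζ) → z ∈ U
  side₂    : ∀ {z} → z ∈ OpenSegment (- ζ) (- 1#) → z ∈ U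
  side₃    : ∀ {z} → z ∈ OpenSegment 1# (conj ζ) → z ∈ U
  vertex₁  : ∀ {z} → z ≈ - ζ → z ∈ U
  vertex₂  : ∀ {z} → z ≈ conj ζ → z ∈ U

-- Deciding z ≈ 0# or locating z in a translate of U is not computable, so
-- [_], T, the partial quotients and the denominators are given by their graphs.

-- a = [z]; z - a ∈ U says that z ∈ a + U.
[_]≈_ : ℂ → ℂ → Set
[ z ]≈ a = a ∈ 𝒥 × (z - a) ∈ U

-- u = 1/z; the existence of u entails z ≠ 0.
_Reciprocal_ : ℂ → ℂ → Set
z Reciprocal u = z * u ≈ 1#

data T : ℂ → ℂ → Set where
  T-zero    : ∀ {z w} → z ≈ 0# → w ≈ 0# → T z w
  T-nonzero : ∀ {z u a w} → z Reciprocal u → [ u ]≈ a → w ≈ u - a → T z w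

-- T^ n z w : Tⁿ(z) = w
data T^ : ℕ → ℂ → ℂ → Set where
  T^-zero : ∀ {z w} → w ≈ z → T^ 0 z w
  T^-suc  : ∀ {n z v w} → T^ n z v → T v w → T^ (suc n) z w

data ExceptionalPoint : Set where
  ⟨-ζ⟩ ⟨ζ̄⟩ : ExceptionalPoint

point : ExceptionalPoint → ℂ
point ⟨-ζ⟩ = - ζ
point ⟨ζ̄⟩  = conj ζ

Exceptional : Pred ℂ 0ℓ
Exceptional z = ∃[ ξ ] z ≈ point ξ

-- exceptionalQuotient ξ k is b_{k+1}(ξ); it has period 4 in k.
exceptionalQuotient : ExceptionalPoint → ℕ → ℂ
exceptionalQuotient _    0 = √-3
exceptionalQuotient _    1 = √-3
exceptionalQuotient ⟨-ζ⟩ 2 = - conj η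
exceptionalQuotient ⟨-ζ⟩ 3 = η
exceptionalQuotient ⟨ζ̄⟩  2 = η
exceptionalQuotient ⟨ζ̄⟩  3 = - conj η
exceptionalQuotient ξ (suc (suc (suc (suc k)))) = exceptionalQuotient ξ k

-- NoExceptionalBefore n z : Tᵐ(z) is not exceptional for any m < n.
NoExceptionalBefore : ℕ → ℂ → Set
NoExceptionalBefore n z = ∀ m w → m ℕ.< n → T^ m z w → ¬ Exceptional w

-- PartialQuotient z n b : b_n(z) = b
data PartialQuotient (z : ℂ) : ℕ → ℂ → Set where
  regular     : ∀ {n w u b} → NoExceptionalBefore (suc n) z → T^ n z w →
                w Reciprocal u → [ u ]≈ b → PartialQuotient z (suc n) b
  exceptional : ∀ {m w b} ξ k → NoExceptionalBefore m z → T^ m z w → w ≈ point ξ →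
                b ≈ exceptionalQuotient ξ k → PartialQuotient z (m ℕ.+ suc k) b

-- Denominators z n p q : q_{n-1}(z) = p and q_n(z) = q
data Denominators (z : ℂ) : ℕ → ℂ → ℂ → Set where
  start : Denominators z 0 0# 1#
  step  : ∀ {n p q b} → Denominators z n p q → PartialQuotient z (suc n) b →
          Denominators z (suc n) q (b * q + p)

{-# OPTIONS --safe #-}

{-
With x = q_{n-1} / q_n the claim |q_n| < |q_{n+1}| says that x lies outside the unit disc about
-b, where b = b_{n+1}. As |x| < 1 by induction, only the six b with |b|² = 3 matter. Inverting
discs shows that such an x forces b_n = - conj b and, with y = q_{n-2} / q_{n-1}, that 1 / y lies
in the unit disc about b, which in turn forces b_{n-1} = b or y to lie in the unit disc about
b - b_{n-1}, again with |b - b_{n-1}|² = 3. So the "dangerous" discs for q_{n-1} / q_n propagate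
along specific digits, and they start from a digit of square modulus 3.

The same digits constrain z_n = Tⁿ(z): the hexagon condition on z_n, transported by inversion and
translation, keeps z_n out of a disc attached to each dangerous disc. In the end z_n satisfies
Re(b' conj b) ≤ 3/2 for b' = 1 / z_n, and if b_{n+1} = b then b' lies in the closed hexagon about
0, so |z_n| ≥ 1, which happens in U at the two exceptional points only. From an exceptional point
on, the digits are explicit and the dangerous discs can be followed directly.

All b_n, q_n are Eisenstein integers, so that the case distinctions on them are constructive. Over
the reals, only implications between inequalities are used, certified by polynomial identities.
-}

module Submission where

open import Defs
open import Algebra.Bundles using (CommutativeRing)
open import Algebra.Bundles.Raw using (RawRing; RawSemiring)
open import Algebra.Definitions using (Congruent₁; Congruent₂)
import Algebra.Definitions.RawMonoid as RawMonoidDefinitions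
import Algebra.Solver.Ring as RingSolver
open import Algebra.Solver.Ring.AlmostCommutativeRing using (fromCommutativeRing; _-Raw-AlmostCommutative⟶_)
open import Algebra.Structures using (IsAbelianGroup; IsRing; IsCommutativeRing)
open import Data.Empty using (⊥-elim)
open import Data.Fin.Base using (Fin; toℕ; zero; suc)
open import Data.Integer.Base as ℤ using (ℤ; +_; -[1+_])
import Data.Integer.Properties as ℤ
import Data.Integer.Solver as ℤ
open import Data.List.Base as List using (List; []; _∷_)
import Data.List.Membership.DecPropositional as DecMembership
open import Data.List.Membership.Propositional using () renaming (_∈_ to _∈ˡ_)
open import Data.List.Relation.Unary.All as All using (All; []; _∷_)
import Data.List.Relation.Unary.All.Properties as All
open import Data.List.Relation.Unary.Any as Any using (Any; here; there)
import Data.List.Relation.Unary.Any.Properties as Any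
open import Data.Maybe.Base using (Maybe; just; nothing)
open import Data.Nat.Base as ℕ using (ℕ; zero; suc)
import Data.Nat.Properties as ℕ
open import Data.Product.Base using (_×_; _,_; proj₁; proj₂; ∃-syntax)
open import Data.Product.Properties using (≡-dec)
open import Data.Rational.Base as ℚ using (ℚ; 0ℚ; 1ℚ; ½)
import Data.Rational.Properties as ℚ
import Data.Rational.Solver as ℚ
open import Data.Sum.Base as Sum using (_⊎_; inj₁; inj₂)
open import Data.Vec.Functional as Vector using (Vector)
open import Level using (0ℓ)
open import Relation.Binary.Definitions using (DecidableEquality)
open import Relation.Binary.PropositionalEquality as ≡ using (_≡_; _≢_)
open import Relation.Nullary using (¬_; Dec; yes; no)
open import Relation.Nullary.Decidable using (True; toWitness; from-yes; _⊎-dec_; _×-dec_; _→-dec_; ¬?)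
open import Relation.Unary using (_∈_)

-- The bookkeeping closes up because fractions and points move dually: q_{n+1} / q_n = b_{n+1} +
-- q_{n-1} / q_n, while z_{n+1} = 1 / z_n - b_{n+1}. For each of the six dangerous digits only three
-- regions for z matter: a half plane bounded by a side of the hexagon, its image under inversion,
-- and the translate of that image by the digit, which is orthogonal to the unit circle and
-- therefore reproduced by inversion.
--
-- Since η is √-3 times a unit, every digit is √-3 c with c an Eisenstein integer, and no such c has
-- norm 2. Crude parallelogram bounds thus leave only c = 0 and the six units, and what remains to
-- be known about digits is a finite table.
--
-- The obstacle is the exceptional points. There |z| = 1, so the strict inequality |1 / z| > 1,
-- which excludes c = 0 and contradicts a failure of growth, is lost, and the prescribed digits are
-- not always [1 / z]. From there on an invariant of period four on the denominators alone replaces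
-- the one that involves z.

-- Eisenstein pairs over an arbitrary ring

-- The pair (a , b) stands for a + b ζ, where ζ² = ζ - 1.
module Eisenstein (R : RawRing 0ℓ 0ℓ) where

  open RawRing R

  infixl 6 _⊕_ _⊖_
  infixl 7 _⊗_

  E : Set
  E = Carrier × Carrier

  _⊕_ _⊖_ _⊗_ : E → E → E
  (a , b) ⊕ (c , d) = a + c , b + d
  (a , b) ⊖ (c , d) = a + - c , b + - d
  (a , b) ⊗ (c , d) = a * c + - (b * d) , a * d + b * c + b * d

  neg conj : E → E
  neg (a , b)  = - a , - b
  conj (a , b) = a + b , - b

  𝟘 𝟙 : E
  𝟘 = 0# , 0#
  𝟙 = 1# , 0#

  N : E → Carrier
  N (a , b) = a * a + a * b + b * b

  -- The trace of z · conj w.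
  ⟨_,_⟩ : E → E → Carrier
  ⟨ (a , b) , (c , d) ⟩ = (a * c + a * c) + (a * d + b * c) + (b * d + b * d)

module Z = Eisenstein ℤ.+-*-rawRing

-- Ordered commutative rings and polynomial identities

-- Equality and order of Cauchy reals are undecidable, so no case distinction on signs is available:
-- `NonNegative` and `Positive` are two predicates with closure rules, and division is by positive
-- integers only.
record OrderedRing : Set₁ where
  field
    commutativeRing : CommutativeRing 0ℓ 0ℓ
  open CommutativeRing commutativeRing public
  field
    ι     : ℤ → Carrier
    ι-+   : ∀ i j → ι (i ℤ.+ j) ≈ ι i + ι j
    ι-*   : ∀ i j → ι (i ℤ.* j) ≈ ι i * ι j
    ι-neg : ∀ i → ι (ℤ.- i) ≈ - ι i
    ι-0   : ι (+ 0) ≈ 0#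
    ι-1   : ι (+ 1) ≈ 1#
    NonNegative Positive : Carrier → Set
    nonNeg-resp  : ∀ {x y} → x ≈ y → NonNegative x → NonNegative y
    nonNeg-+     : ∀ {x y} → NonNegative x → NonNegative y → NonNegative (x + y)
    nonNeg-*     : ∀ {x y} → NonNegative x → NonNegative y → NonNegative (x * y)
    nonNeg-sq    : ∀ x → NonNegative (x * x)
    nonNeg-ι     : ∀ {i} → + 0 ℤ.≤ i → NonNegative (ι i)
    nonNeg-scale : ∀ k {x} → NonNegative (ι (+ suc k) * x) → NonNegative x
    pos-resp     : ∀ {x y} → x ≈ y → Positive x → Positive y
    pos-+        : ∀ {x y} → Positive x → NonNegative y → Positive (x + y)
    pos-*        : ∀ {x y} → Positive x → Positive y → Positive (x * y)
    pos-ι        : ∀ {i} → + 0 ℤ.< i → Positive (ι i)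
    pos-scale    : ∀ k {x} → Positive (ι (+ suc k) * x) → Positive x
    pos⇒nonNeg   : ∀ {x} → Positive x → NonNegative x
    pos-irrefl   : ¬ Positive 0#

module OrderedRingSolver (O : OrderedRing) where

  open OrderedRing O

  ι-morphism : ℤ.+-*-rawRing -Raw-AlmostCommutative⟶ fromCommutativeRing commutativeRing
  ι-morphism = record
    { ⟦_⟧ = ι ; +-homo = ι-+ ; *-homo = ι-* ; -‿homo = ι-neg ; 0-homo = ι-0 ; 1-homo = ι-1 }

  ι-≟ : ∀ i j → Maybe (ι i ≈ ι j)
  ι-≟ i j with i ℤ.≟ j
  ... | yes ≡.refl = just refl
  ... | no  _      = nothing

  open RingSolver ℤ.+-*-rawRing (fromCommutativeRing commutativeRing) ι-morphism ι-≟ public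

  -- `Eisenstein` instantiated at solver polynomials yields the expressions to which the operations
  -- on pairs unfold, so identities can be stated in complex notation instead of coordinatewise.
  polynomialRing : ℕ → RawRing 0ℓ 0ℓ
  polynomialRing n = record
    { Carrier = Polynomial n ; _≈_ = _≡_ ; _+_ = _:+_ ; _*_ = _:*_ ; -_ = :-_
    ; 0# = con (+ 0) ; 1# = con (+ 1) }

  module P {n} = Eisenstein (polynomialRing n)

-- Half planes and discs attached to digits of square modulus 3

module Geometry (O : OrderedRing) where

  open OrderedRing O
  open OrderedRingSolver O
  open Eisenstein rawRing public

  infix 4 _≋_

  _≋_ : E → E → Set
  (a , b) ≋ (c , d) = a ≈ c × b ≈ d

  ≋-refl : ∀ {z} → z ≋ z
  ≋-refl = refl , refl

  ≋-sym : ∀ {z w} → z ≋ w → w ≋ z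
  ≋-sym (p , q) = sym p , sym q

  ≋-trans : ∀ {x y z} → x ≋ y → y ≋ z → x ≋ z
  ≋-trans (p , q) (p′ , q′) = trans p p′ , trans q q′

  ⊕-cong : ∀ {x x′ y y′} → x ≋ x′ → y ≋ y′ → x ⊕ y ≋ x′ ⊕ y′
  ⊕-cong (p , q) (p′ , q′) = +-cong p p′ , +-cong q q′

  ⊖-cong : ∀ {x x′ y y′} → x ≋ x′ → y ≋ y′ → x ⊖ y ≋ x′ ⊖ y′
  ⊖-cong (p , q) (p′ , q′) = +-cong p (-‿cong p′) , +-cong q (-‿cong q′)

  ⊗-cong : ∀ {x x′ y y′} → x ≋ x′ → y ≋ y′ → x ⊗ y ≋ x′ ⊗ y′
  ⊗-cong (p , q) (p′ , q′) =
    +-cong (*-cong p p′) (-‿cong (*-cong q q′)) ,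
    +-cong (+-cong (*-cong p q′) (*-cong q p′)) (*-cong q q′)

  neg-cong : ∀ {x x′} → x ≋ x′ → neg x ≋ neg x′
  neg-cong (p , q) = -‿cong p , -‿cong q

  conj-cong : ∀ {x x′} → x ≋ x′ → conj x ≋ conj x′
  conj-cong (p , q) = +-cong p q , -‿cong q

  N-cong : ∀ {x x′} → x ≋ x′ → N x ≈ N x′
  N-cong (p , q) = +-cong (+-cong (*-cong p p) (*-cong p q)) (*-cong q q)

  ⟨⟩-cong : ∀ {x x′ y y′} → x ≋ x′ → y ≋ y′ → ⟨ x , y ⟩ ≈ ⟨ x′ , y′ ⟩
  ⟨⟩-cong (p , q) (p′ , q′) =
    +-cong (+-cong (+-cong (*-cong p p′) (*-cong p p′)) (+-cong (*-cong p q′) (*-cong q p′)))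
      (+-cong (*-cong q q′) (*-cong q q′))

  ιE : Z.E → E
  ιE (a , b) = ι a , ι b

  ι-sub : ∀ i j → ι (i ℤ.+ ℤ.- j) ≈ ι i + - ι j
  ι-sub i j = trans (ι-+ i (ℤ.- j)) (+-cong refl (ι-neg j))

  ι-⊕ : ∀ x y → ιE (x Z.⊕ y) ≋ ιE x ⊕ ιE y
  ι-⊕ (a , b) (c , d) = ι-+ a c , ι-+ b d

  ι-⊖ : ∀ x y → ιE (x Z.⊖ y) ≋ ιE x ⊖ ιE y
  ι-⊖ (a , b) (c , d) = ι-sub a c , ι-sub b d

  ι-⊗ : ∀ x y → ιE (x Z.⊗ y) ≋ ιE x ⊗ ιE y
  ι-⊗ (a , b) (c , d) =
    trans (ι-sub (a ℤ.* c) (b ℤ.* d)) (+-cong (ι-* a c) (-‿cong (ι-* b d))) ,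
    trans (ι-+ (a ℤ.* d ℤ.+ b ℤ.* c) (b ℤ.* d))
      (+-cong (trans (ι-+ (a ℤ.* d) (b ℤ.* c)) (+-cong (ι-* a d) (ι-* b c))) (ι-* b d))

  ι-negE : ∀ x → ιE (Z.neg x) ≋ neg (ιE x)
  ι-negE (a , b) = ι-neg a , ι-neg b

  ι-conj : ∀ x → ιE (Z.conj x) ≋ conj (ιE x)
  ι-conj (a , b) = ι-+ a b , ι-neg b

  ι-N : ∀ x → ι (Z.N x) ≈ N (ιE x)
  ι-N (a , b) = trans (ι-+ (a ℤ.* a ℤ.+ a ℤ.* b) (b ℤ.* b))
    (+-cong (trans (ι-+ (a ℤ.* a) (a ℤ.* b)) (+-cong (ι-* a a) (ι-* a b))) (ι-* b b))

  ι-⟨⟩ : ∀ x y → ι Z.⟨ x , y ⟩ ≈ ⟨ ιE x , ιE y ⟩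
  ι-⟨⟩ (a , b) (c , d) = trans (ι-+ _ (b ℤ.* d ℤ.+ b ℤ.* d))
    (+-cong (trans (ι-+ (a ℤ.* c ℤ.+ a ℤ.* c) (a ℤ.* d ℤ.+ b ℤ.* c))
      (+-cong (trans (ι-+ (a ℤ.* c) (a ℤ.* c)) (+-cong (ι-* a c) (ι-* a c)))
              (trans (ι-+ (a ℤ.* d) (b ℤ.* c)) (+-cong (ι-* a d) (ι-* b c)))))
      (trans (ι-+ (b ℤ.* d) (b ℤ.* d)) (+-cong (ι-* b d) (ι-* b d))))

  -- An identity that holds only under a relation, mostly N β = 3, becomes a polynomial identity
  -- once the multiple c of u - v is supplied.
  modulo : ∀ {x y u v} c → u ≈ v → x ≈ y + c * (u + - v) → x ≈ y
  modulo {x} {y} {u} {v} c u≈v x≈ = trans x≈ (trans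
    (+-cong refl (*-cong refl (+-cong u≈v refl)))
    (solve 3 (λ y c v → y :+ c :* (v :+ :- v) := y) refl y c v))

  difference-of-squares : ∀ {x y a b} → a * a ≈ x → b * b ≈ y → Positive (y + - x) → Positive ((b + - a) * (b + a))
  difference-of-squares {a = a} {b} a²≈x b²≈y = pos-resp (trans (+-cong (sym b²≈y) (-‿cong (sym a²≈x)))
    (solve 2 (λ a b → b :* b :+ :- (a :* a) := (b :+ :- a) :* (b :+ a)) refl a b))

  pos-neg : ∀ {x} → Positive x → ¬ NonNegative (- x)
  pos-neg {x} p n = pos-irrefl (pos-resp (-‿inverseʳ x) (pos-+ p n))

  nonNeg-ι⁻¹ : ∀ {i} → NonNegative (ι i) → + 0 ℤ.≤ i
  nonNeg-ι⁻¹ {i} p with + 0 ℤ.≤? i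
  ... | yes 0≤i = 0≤i
  ... | no  0≰i = ⊥-elim (pos-neg (pos-ι (ℤ.neg-mono-< (ℤ.≰⇒> 0≰i)))
    (nonNeg-resp (trans (solve 1 (λ x → x := :- :- x) refl (ι i)) (-‿cong (sym (ι-neg i)))) p))

  ι-injective : ∀ {i j} → ι i ≈ ι j → i ≡ j
  ι-injective {i} {j} eq = ℤ.≤-antisym (le eq) (le (sym eq))
    where
    le : ∀ {i j} → ι i ≈ ι j → i ℤ.≤ j
    le {i} {j} eq = ℤ.0≤i-j⇒j≤i (nonNeg-ι⁻¹ {j ℤ.- i} (nonNeg-resp
      (trans (trans ι-0 (trans (sym (-‿inverseʳ (ι i))) (+-cong eq refl))) (sym (ι-sub j i)))
      (nonNeg-ι ℤ.≤-refl)))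

  ιE-injective : ∀ {x y} → ιE x ≋ ιE y → x ≡ y
  ιE-injective (p , q) = ≡.cong₂ _,_ (ι-injective p) (ι-injective q)

  nonNeg-N : ∀ z → NonNegative (N z)
  nonNeg-N (a , b) = nonNeg-scale 3 (nonNeg-resp
    (solve 2 (λ a b → (a :+ a :+ b) :* (a :+ a :+ b) :+ con (+ 3) :* (b :* b)
                      := con (+ 4) :* P.N (a , b)) refl a b)
    (nonNeg-+ (nonNeg-sq (a + a + b)) (nonNeg-* (nonNeg-ι {+ 3} (ℤ.+≤+ ℕ.z≤n)) (nonNeg-sq b))))

  #_ : ℕ → Carrier
  # n = ι (+ n)

  -- Multiplying z w = 1 by conj w gives N w · z = conj w, and ⟨ conj w , β ⟩ = ⟨ w , conj β ⟩. The
  -- three inversions below multiply an inequality on z by N w ≥ 0 and rewrite with this.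
  inv-⟨⟩ : ∀ {z w} β → z ⊗ w ≋ 𝟙 → N w * ⟨ z , β ⟩ ≈ ⟨ w , conj β ⟩
  inv-⟨⟩ {a , b} {c , d} (e , f) zw≋1 = trans
    (solve 6 (λ a b c d e f → P.N (c , d) :* P.⟨ (a , b) , (e , f) ⟩
       := P.⟨ (a , b) P.⊗ (c , d) , (c , d) P.⊗ (e , f) ⟩) refl a b c d e f)
    (trans (⟨⟩-cong zw≋1 ≋-refl)
    (trans (⟨⟩-cong {𝟙} {ιE (+ 1 , + 0)} {(c , d) ⊗ (e , f)} (sym ι-1 , sym ι-0) ≋-refl)
    (solve 4 (λ c d e f → P.⟨ (con (+ 1) , con (+ 0)) , (c , d) P.⊗ (e , f) ⟩
       := P.⟨ (c , d) , P.conj (e , f) ⟩) refl c d e f)))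

  inv-N : ∀ {z w} → z ⊗ w ≋ 𝟙 → N w * N z ≈ # 1
  inv-N {a , b} {c , d} zw≋1 = trans
    (solve 4 (λ a b c d → P.N (c , d) :* P.N (a , b) := P.N ((a , b) P.⊗ (c , d))) refl a b c d)
    (trans (N-cong (≋-trans zw≋1 (sym ι-1 , sym ι-0)))
    (solve 0 (P.N (con (+ 1) , con (+ 0)) := con (+ 1)) refl))

  conj-conj : ∀ z → conj (conj z) ≋ z
  conj-conj (a , b) =
    solve 2 (λ a b → (a :+ b) :+ :- b := a) refl a b , solve 1 (λ b → :- :- b := b) refl b

  -- For |β|² = 3, these exclude an open half plane and the open discs of radius 1/√3 about β/3,
  -- conj β/3 and -2β/3.
  HalfPlane Outside AvoidsX AvoidsY : E → E → Set
  HalfPlane β z = NonNegative (# 3 + - ⟨ z , β ⟩)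
  Outside β z   = NonNegative (# 3 * N z + - ⟨ z , β ⟩)
  AvoidsX β     = Outside (conj β)
  AvoidsY β z   = NonNegative (# 3 * N z + # 2 * ⟨ z , β ⟩ + # 3)

  HalfPlane-resp : ∀ {β β′ z z′} → β ≋ β′ → z ≋ z′ → HalfPlane β z → HalfPlane β′ z′
  HalfPlane-resp p q = nonNeg-resp (+-cong refl (-‿cong (⟨⟩-cong q p)))

  Outside-resp : ∀ {β β′ z z′} → β ≋ β′ → z ≋ z′ → Outside β z → Outside β′ z′
  Outside-resp p q = nonNeg-resp (+-cong (*-cong refl (N-cong q)) (-‿cong (⟨⟩-cong q p)))

  AvoidsY-resp : ∀ {β β′ z z′} → β ≋ β′ → z ≋ z′ → AvoidsY β z → AvoidsY β′ z′
  AvoidsY-resp p q = nonNeg-resp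
    (+-cong (+-cong (*-cong refl (N-cong q)) (*-cong refl (⟨⟩-cong q p))) refl)

  halfPlane⇒outside : ∀ {z w β} → z ⊗ w ≋ 𝟙 → HalfPlane β z → Outside (conj β) w
  halfPlane⇒outside {z} {w} {β} zw≋1 h = nonNeg-resp
    (trans (solve 2 (λ n t → n :* (con (+ 3) :+ :- t) := con (+ 3) :* n :+ :- (n :* t)) refl (N w) ⟨ z , β ⟩)
      (+-cong refl (-‿cong (inv-⟨⟩ β zw≋1))))
    (nonNeg-* (nonNeg-N w) h)

  outside⇒halfPlane : ∀ {z w β} → z ⊗ w ≋ 𝟙 → Outside (conj β) z → HalfPlane β w
  outside⇒halfPlane {z} {w} {β} zw≋1 h = nonNeg-resp
    (trans (solve 3 (λ n m t → n :* (con (+ 3) :* m :+ :- t) := con (+ 3) :* (n :* m) :+ :- (n :* t)) refl (N w)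
        (N z) ⟨ z , conj β ⟩)
      (+-cong (trans (*-cong refl (inv-N zw≋1)) (solve 0 (con (+ 3) :* con (+ 1) := con (+ 3)) refl))
        (-‿cong (trans (inv-⟨⟩ (conj β) zw≋1) (⟨⟩-cong ≋-refl (conj-conj β))))))
    (nonNeg-* (nonNeg-N w) h)

  -- Centre -2β/3 and radius 1/√3 satisfy |centre|² - radius² = 4/3 - 1/3 = 1: the circle is
  -- orthogonal to the unit circle, so inversion merely conjugates the disc.
  avoidsY-inverse : ∀ {z w β} → z ⊗ w ≋ 𝟙 → AvoidsY β z → AvoidsY (conj β) w
  avoidsY-inverse {z} {w} {β} zw≋1 h = nonNeg-resp
    (trans (solve 3 (λ n m t → n :* (con (+ 3) :* m :+ con (+ 2) :* t :+ con (+ 3))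
                      := con (+ 3) :* n :+ con (+ 2) :* (n :* t) :+ con (+ 3) :* (n :* m)) refl (N w) (N z) ⟨ z , β ⟩)
      (+-cong (+-cong refl (*-cong refl (inv-⟨⟩ β zw≋1)))
        (trans (*-cong refl (inv-N zw≋1)) (solve 0 (con (+ 3) :* con (+ 1) := con (+ 3)) refl))))
    (nonNeg-* (nonNeg-N w) h)

  -- Subtracting β moves the centre β/3 to -2β/3.
  outside⇒avoidsY : ∀ {x w β} → N β ≈ # 3 → w ≋ x ⊕ β → Outside β w → AvoidsY β x
  outside⇒avoidsY {a , b} {w} {e , f} Nβ w≋ h = nonNeg-resp
    (modulo (# 1) Nβ (solve 4 (λ a b e f →
      con (+ 3) :* P.N ((a , b) P.⊕ (e , f)) :+ :- P.⟨ (a , b) P.⊕ (e , f) , (e , f) ⟩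
      := con (+ 3) :* P.N (a , b) :+ con (+ 2) :* P.⟨ (a , b) , (e , f) ⟩ :+ con (+ 3)
         :+ con (+ 1) :* (P.N (e , f) :+ :- con (+ 3))) refl a b e f))
    (Outside-resp {e , f} ≋-refl w≋ h)

  avoidsY⇒avoidsX : ∀ {x w β} → N β ≈ # 3 → w ≋ x ⊕ neg (conj β) → AvoidsY (conj β) w → AvoidsX β x
  avoidsY⇒avoidsX {a , b} {w} {e , f} Nβ w≋ h = nonNeg-resp
    (modulo (- # 1) Nβ (solve 4 (λ a b e f →
      let x = (a , b) ; β̄ = P.conj (e , f) ; w = x P.⊕ P.neg β̄ in
      con (+ 3) :* P.N w :+ con (+ 2) :* P.⟨ w , β̄ ⟩ :+ con (+ 3)
      := con (+ 3) :* P.N x :+ :- P.⟨ x , β̄ ⟩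
         :+ :- con (+ 1) :* (P.N (e , f) :+ :- con (+ 3))) refl a b e f))
    (AvoidsY-resp {conj (e , f)} ≋-refl w≋ h)

  ζE ζ̄E : E
  ζE = # 0 , # 1
  ζ̄E = # 1 , ι -[1+ 0 ]

  -- The half planes confine w to the triangle spanned by 0 and two adjacent vertices of the hexagon.
  triangle-N≤1 : ∀ {x w β} → N β ≈ # 3 → w ≋ x ⊕ β → HalfPlane β w →
                 HalfPlane (neg (β ⊗ ζE)) x → HalfPlane (neg (β ⊗ ζ̄E)) x → NonNegative (# 9 + - (# 9 * N w))
  triangle-N≤1 {x@(a , b)} {w} {β@(e , f)} Nβ w≋ h₀ h₁ h₂ = nonNeg-resp
    (trans (modulo (- (# 3 * N (x ⊕ β))) Nβ (solve 4 (λ a b e f →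
       let x = (a , b) ; β = (e , f) ; w = x P.⊕ β
           S = P.⟨ w , β ⟩ ; T = P.⟨ w , β P.⊗ (con (+ 0) , con (+ 1)) ⟩ in
       (con (+ 3) :+ :- S) :* (con (+ 3) :+ S) :+ T :* (S :+ :- T)
       := con (+ 9) :+ :- (con (+ 9) :* P.N w)
          :+ :- (con (+ 3) :* P.N w) :* (P.N (e , f) :+ :- con (+ 3))) refl a b e f))
     (+-cong refl (-‿cong (*-cong refl (N-cong (≋-sym w≋))))))
    (nonNeg-+ (nonNeg-* S≤3 (nonNeg-+ (nonNeg-ι {+ 3} (ℤ.+≤+ ℕ.z≤n)) 0≤S)) (nonNeg-* 0≤T T≤S))
    where
    S≤3 = nonNeg-resp (+-cong refl (-‿cong (⟨⟩-cong w≋ ≋-refl))) h₀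
    0≤T : NonNegative ⟨ x ⊕ β , β ⊗ ζE ⟩
    0≤T = nonNeg-resp (modulo (- # 1) Nβ (solve 4 (λ a b e f →
       let x = (a , b) ; β = (e , f) ; γ = β P.⊗ (con (+ 0) , con (+ 1)) in
       con (+ 3) :+ :- P.⟨ x , P.neg γ ⟩
       := P.⟨ x P.⊕ β , γ ⟩ :+ :- con (+ 1) :* (P.N (e , f) :+ :- con (+ 3))) refl a b e f)) h₁
    T≤S : NonNegative (⟨ x ⊕ β , β ⟩ + - ⟨ x ⊕ β , β ⊗ ζE ⟩)
    T≤S = nonNeg-resp (modulo (- # 1) Nβ (solve 4 (λ a b e f →
       let x = (a , b) ; β = (e , f) ; γ = β P.⊗ (con (+ 0) , con (+ 1)) in
       con (+ 3) :+ :- P.⟨ x , P.neg (β P.⊗ (con (+ 1) , con -[1+ 0 ])) ⟩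
       := P.⟨ x P.⊕ β , β ⟩ :+ :- P.⟨ x P.⊕ β , γ ⟩ :+ :- con (+ 1) :* (P.N (e , f) :+ :- con (+ 3))) refl a b e
           f)) h₂
    0≤S : NonNegative ⟨ x ⊕ β , β ⟩
    0≤S = nonNeg-resp (solve 2 (λ s t → s :+ :- t :+ t := s) refl _ _) (nonNeg-+ T≤S 0≤T)

  halfPlane-shift : ∀ {x w β β′} k → N β′ ≈ # 3 → ⟨ β , β′ ⟩ ≈ ι k → w ≋ x ⊕ (β ⊕ β′) →
                    HalfPlane β′ w → NonNegative (- (# 3 + ι k + ⟨ x , β′ ⟩))
  halfPlane-shift {x@(a , b)} {w} {β@(c , d)} {β′@(e , f)} k Nβ′ k≈ w≋ h = nonNeg-resp
    (modulo (- # 2) Nβ′ (modulo (- # 1) k≈ (solve 7 (λ a b c d e f k →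
       let x = (a , b) ; β = (c , d) ; β′ = (e , f) in
       con (+ 3) :+ :- P.⟨ x P.⊕ (β P.⊕ β′) , β′ ⟩
       := :- (con (+ 3) :+ k :+ P.⟨ x , β′ ⟩)
          :+ :- con (+ 2) :* (P.N β′ :+ :- con (+ 3))
          :+ :- con (+ 1) :* (P.⟨ β , β′ ⟩ :+ :- k)) refl a b c d e f (ι k))))
    (HalfPlane-resp {e , f} ≋-refl w≋ h)

  -- The half plane for w gives ⟨ x , β′ ⟩ ≤ -3 - suc k, as ⟨ w , β′ ⟩ contains ⟨ β′ , β′ ⟩ = 6; the
  -- half plane for x gives ⟨ x , β′ ⟩ ≥ -3.
  halfPlane-shift-excluded : ∀ {x w β β′} k → N β′ ≈ # 3 → ⟨ β , β′ ⟩ ≈ ι (+ suc k) → w ≋ x ⊕ (β ⊕ β′) →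
                             HalfPlane β′ w → ¬ HalfPlane (neg β′) x
  halfPlane-shift-excluded {x@(a , b)} {w} {β} {β′@(e , f)} k Nβ′ k≈ w≋ h h′ =
    pos-neg (pos-ι {+ suc k} (ℤ.+<+ ℕ.z<s)) (nonNeg-resp
      (solve 5 (λ a b e f k → let x = (a , b) ; β′ = (e , f) in
         :- (con (+ 3) :+ k :+ P.⟨ x , β′ ⟩) :+ (con (+ 3) :+ :- P.⟨ x , P.neg β′ ⟩) := :- k) refl a b e f (# suc k))
      (nonNeg-+ (halfPlane-shift {β = β} (+ suc k) Nβ′ k≈ w≋ h) h′))

  -- The condition on w amounts to ⟨ x , β′ ⟩ ≤ 0. The forbidden disc about -2β/3 lies beyond the
  -- line ⟨ x , β′ ⟩ = 0 and is tangent to it, because β and β′ enclose an angle of 120°.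
  halfPlane-shift⇒avoidsY : ∀ {x w β β′} → N β ≈ # 3 → N β′ ≈ # 3 → ⟨ β , β′ ⟩ ≈ ι -[1+ 2 ] →
                            w ≋ x ⊕ (β ⊕ β′) → HalfPlane β′ w → AvoidsY β x
  halfPlane-shift⇒avoidsY {x@(a , b)} {w} {β@(c , d)} {β′@(e , f)} Nβ Nβ′ k≈ w≋ h =
    -- Nine times the claim is 9 times the slack of the half plane plus 3 times N (τ + 3 , σ), which
    -- vanishes exactly at the point of tangency τ = -3, σ = 0. `nonNeg-scale 8` divides by 9.
    nonNeg-scale 8 {# 3 * N x + # 2 * ⟨ x , β ⟩ + # 3} (nonNeg-resp
      (trans (solve 2 (λ s t → con (+ 3) :* (con (+ 3) :* (:- (con (+ 3) :+ con -[1+ 2 ] :+ s)) :+ P.N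
          (t :+ con (+ 3) , s))
                       := con (+ 3) :* (s :* s :+ s :* t :+ t :* t) :+ con (+ 18) :* t :+ con (+ 27)) refl ⟨ x ,
                           β′ ⟩ ⟨ x , β ⟩)
      (trans (+-cong (+-cong gram refl) refl)
        (solve 2 (λ n t → con (+ 27) :* n :+ con (+ 18) :* t :+ con (+ 27)
           := con (+ 9) :* (con (+ 3) :* n :+ con (+ 2) :* t :+ con (+ 3))) refl (N x) ⟨ x , β ⟩)))
      (nonNeg-* nonNeg-3 (nonNeg-+
        (nonNeg-* nonNeg-3 (halfPlane-shift {β = β} -[1+ 2 ] Nβ′ k≈ w≋ h))
            (nonNeg-N (⟨ x , β ⟩ + # 3 , ⟨ x , β′ ⟩)))))
    where
    nonNeg-3 = nonNeg-ι {+ 3} (ℤ.+≤+ ℕ.z≤n)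
    σ = ⟨ x , β′ ⟩
    τ = ⟨ x , β ⟩
    -- The Gram determinant of x, β, β′ vanishes.
    gram : # 3 * (σ * σ + σ * τ + τ * τ) ≈ # 27 * N x
    gram = modulo (τ * τ) (sym Nβ′) (modulo (σ * σ) (sym Nβ) (modulo (- (σ * τ)) (sym k≈)
      (modulo (- (N x * # 4 * N β′)) (sym Nβ) (modulo (- (N x * # 12)) (sym Nβ′)
          (modulo (N x * (⟨ β , β′ ⟩ + - # 3)) (sym k≈)
      (solve 6 (λ a b c d e f →
        let x = (a , b) ; β = (c , d) ; β′ = (e , f) ; S = P.⟨ x , β′ ⟩ ; T = P.⟨ x , β ⟩ ; k = P.⟨ β , β′ ⟩ in
        con (+ 3) :* (S :* S :+ S :* T :+ T :* T)
        := con (+ 27) :* P.N x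
           :+ T :* T :* (con (+ 3) :+ :- P.N β′)
           :+ S :* S :* (con (+ 3) :+ :- P.N β)
           :+ :- (S :* T) :* (con -[1+ 2 ] :+ :- k)
           :+ :- (P.N x :* con (+ 4) :* P.N β′) :* (con (+ 3) :+ :- P.N β)
           :+ :- (P.N x :* con (+ 12)) :* (con (+ 3) :+ :- P.N β′)
           :+ P.N x :* (k :+ :- con (+ 3)) :* (con -[1+ 2 ] :+ :- k)) refl a b c d e f))))))

-- Eisenstein integers of small norm and the propagation of dangerous discs

module EisensteinIntegers where

  open ≡ using (refl; sym; trans; cong; cong₂; subst; subst₂)
  open Z
  open ℤ.+-*-Solver

  polynomialRing : ℕ → RawRing 0ℓ 0ℓ
  polynomialRing n = record
    { Carrier = Polynomial n ; _≈_ = _≡_ ; _+_ = _:+_ ; _*_ = _:*_ ; -_ = :-_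
    ; 0# = con (+ 0) ; 1# = con (+ 1) }

  module P {n} = Eisenstein (polynomialRing n)

  θᴾ : ∀ {n} → P.E {n}
  θᴾ = con -[1+ 0 ] , con (+ 2)

  infix 4 _≟_

  _≟_ : DecidableEquality E
  _≟_ = ≡-dec ℤ._≟_ ℤ._≟_

  ζᶻ ζ̄ᶻ θ : E
  ζᶻ = + 0 , + 1
  ζ̄ᶻ = + 1 , -[1+ 0 ]
  -- √-3
  θ = -[1+ 0 ] , + 2

  units : List E
  units = 𝟙 ∷ ζᶻ ∷ neg ζ̄ᶻ ∷ neg 𝟙 ∷ neg ζᶻ ∷ ζ̄ᶻ ∷ []

  square≡ : ∀ i → i ℤ.* i ≡ + (ℤ.∣ i ∣ ℕ.* ℤ.∣ i ∣)
  square≡ (+ n)    = sym (ℤ.pos-* n n)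
  square≡ -[1+ n ] = refl

  square-nonNeg : ∀ i → + 0 ℤ.≤ i ℤ.* i
  square-nonNeg i = subst (+ 0 ℤ.≤_) (sym (square≡ i)) (ℤ.+≤+ ℕ.z≤n)

  0≤⇒≤ : ∀ {i j d} → + 0 ℤ.≤ d → j ℤ.- i ≡ d → i ℤ.≤ j
  0≤⇒≤ 0≤d eq = ℤ.0≤i-j⇒j≤i (subst (+ 0 ℤ.≤_) (sym eq) 0≤d)

  modulo : ∀ {i j m n} k → m ≡ n → i ≡ j ℤ.+ (m ℤ.- n) ℤ.* k → i ≡ j
  modulo {i} {j} {m} k refl eq = trans eq (solve 3 (λ j m k → j :+ (m :- m) :* k := j) refl j m k)

  N-nonNeg : ∀ z → + 0 ℤ.≤ N z
  N-nonNeg z@(a , b) = ℤ.*-cancelˡ-≤-pos (+ 0) (N z) (+ 4) (subst (+ 0 ℤ.≤_)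
    (solve 2 (λ a b → (a :+ a :+ b) :* (a :+ a :+ b) :+ con (+ 3) :* (b :* b) := con (+ 4) :* P.N (a , b)) refl a b)
    (ℤ.+-mono-≤ (square-nonNeg (a ℤ.+ a ℤ.+ b)) (ℤ.*-monoˡ-≤-nonNeg (+ 3) (square-nonNeg b))))

  ∣i∣≤1 : ∀ i → + 3 ℤ.* (i ℤ.* i) ℤ.≤ + 8 → ℤ.∣ i ∣ ℕ.≤ 1
  ∣i∣≤1 i 3i²≤8 with ℤ.∣ i ∣ ℕ.≤? 1
  ... | yes ≤1 = ≤1
  ... | no  ≰1 = ⊥-elim (ℤ.<⇒≱ (from-yes (+ 8 ℤ.<? + 12)) (ℤ.≤-trans (ℤ.*-monoˡ-≤-nonNeg (+ 3)
    (subst (+ 4 ℤ.≤_) (sym (square≡ i))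
      (ℤ.+≤+ (ℕ.*-mono-≤ (ℕ.≰⇒> ≰1) (ℕ.≰⇒> ≰1))))) 3i²≤8))

  -- From 4 N = 3a² + (a + 2b)² and its mirror image both coordinates have absolute value at most 1;
  -- of the nine pairs left, only (1 , 1) and (-1 , -1) are too large, with norm 3.
  N≤2⇒0⊎unit : ∀ z → N z ℤ.≤ + 2 → z ≡ 𝟘 ⊎ z ∈ˡ units
  N≤2⇒0⊎unit z@(a , b) Nz≤2 = go a b (∣i∣≤1 a (bound {a} {b} refl)) (∣i∣≤1 b (bound {b} {a} (solve 2 (λ a b →
      P.N (b , a) := P.N (a , b)) refl a b))) Nz≤2
    where
    bound : ∀ {c d} → N (c , d) ≡ N z → + 3 ℤ.* (c ℤ.* c) ℤ.≤ + 8
    bound {c} {d} eq = ℤ.≤-trans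
      (0≤⇒≤ (square-nonNeg (c ℤ.+ d ℤ.+ d)) (solve 2 (λ c d →
        con (+ 4) :* P.N (c , d) :- con (+ 3) :* (c :* c) := (c :+ d :+ d) :* (c :+ d :+ d)) refl c d))
      (ℤ.*-monoˡ-≤-nonNeg (+ 4) (subst (ℤ._≤ + 2) (sym eq) Nz≤2))
    go : ∀ a b → ℤ.∣ a ∣ ℕ.≤ 1 → ℤ.∣ b ∣ ℕ.≤ 1 → N (a , b) ℤ.≤ + 2 → (a , b) ≡ 𝟘 ⊎ (a , b) ∈ˡ units
    go (+ 0)    (+ 0)    _ _ _ = inj₁ refl
    go (+ 0)    (+ 1)    _ _ _ = inj₂ (there (here refl))
    go (+ 0)    -[1+ 0 ] _ _ _ = inj₂ (there (there (there (there (here refl)))))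
    go (+ 1)    (+ 0)    _ _ _ = inj₂ (here refl)
    go (+ 1)    (+ 1)    _ _ (ℤ.+≤+ (ℕ.s≤s (ℕ.s≤s ())))
    go (+ 1)    -[1+ 0 ] _ _ _ = inj₂ (there (there (there (there (there (here refl))))))
    go -[1+ 0 ] (+ 0)    _ _ _ = inj₂ (there (there (there (here refl))))
    go -[1+ 0 ] (+ 1)    _ _ _ = inj₂ (there (there (here refl)))
    go -[1+ 0 ] -[1+ 0 ] _ _ (ℤ.+≤+ (ℕ.s≤s (ℕ.s≤s ())))
    go (+ suc (suc _))  _ (ℕ.s≤s ()) _ _
    go -[1+ suc _ ]     _ (ℕ.s≤s ()) _ _
    go _ (+ suc (suc _))  _ (ℕ.s≤s ()) _
    go _ -[1+ suc _ ]     _ (ℕ.s≤s ()) _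

  -- X u: p / q is in the unit disc about -θ u; Y u: q / p is in the unit disc about θ u.
  X Y : E → E → E → Set
  X u p q = N (θ ⊗ u ⊗ q ⊕ p) ℤ.≤ N q
  Y u p q = N (q ⊖ θ ⊗ u ⊗ p) ℤ.≤ N p

  N-parallelogram : ∀ c p q → + 3 ℤ.* N c ℤ.* N q ℤ.≤ + 2 ℤ.* (N (θ ⊗ c ⊗ q ⊕ p) ℤ.+ N p)
  N-parallelogram c@(c₁ , c₂) p@(p₁ , p₂) q@(q₁ , q₂) = 0≤⇒≤ (N-nonNeg (θ ⊗ c ⊗ q ⊕ p ⊕ p))
    (solve 6 (λ c₁ c₂ p₁ p₂ q₁ q₂ → let c = (c₁ , c₂) ; p = (p₁ , p₂) ; q = (q₁ , q₂) in
      con (+ 2) :* (P.N (θᴾ P.⊗ c P.⊗ q P.⊕ p) :+ P.N p) :- con (+ 3) :* P.N c :* P.N q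
      := P.N (θᴾ P.⊗ c P.⊗ q P.⊕ p P.⊕ p)) refl c₁ c₂ p₁ p₂ q₁ q₂)

  -- With A = θ c q + 2p the left side is |A - 2p|². As A and p will be bounded by the same |q|, the
  -- convexity weights 1/3 and 2/3 lose nothing: |A - 2p|² ≤ 3|A|² + 6|p|², with difference 2|A +
  -- p|².
  N-parallelogram′ : ∀ c p q → + 3 ℤ.* N c ℤ.* N q ℤ.≤ + 3 ℤ.* N (θ ⊗ c ⊗ q ⊕ (p ⊕ p)) ℤ.+ + 6 ℤ.* N p
  N-parallelogram′ c@(c₁ , c₂) p@(p₁ , p₂) q@(q₁ , q₂) =
    0≤⇒≤ (ℤ.*-monoˡ-≤-nonNeg (+ 2) (N-nonNeg (θ ⊗ c ⊗ q ⊕ p ⊕ p ⊕ p)))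
    (solve 6 (λ c₁ c₂ p₁ p₂ q₁ q₂ → let c = (c₁ , c₂) ; p = (p₁ , p₂) ; q = (q₁ , q₂) in
      con (+ 3) :* P.N (θᴾ P.⊗ c P.⊗ q P.⊕ (p P.⊕ p)) :+ con (+ 6) :* P.N p :- con (+ 3) :* P.N c :* P.N q
      := con (+ 2) :* P.N (θᴾ P.⊗ c P.⊗ q P.⊕ p P.⊕ p P.⊕ p)) refl c₁ c₂ p₁ p₂ q₁ q₂)

  step-contracts⇒N≤1 : ∀ c {p q} → N p ℤ.< N q → N (θ ⊗ c ⊗ q ⊕ p) ℤ.≤ N q → N c ℤ.≤ + 1
  step-contracts⇒N≤1 c {p} {q} p<q h = ℤ.≮⇒≥ λ 2≤Nc → ℤ.<-irrefl refl (begin-strict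
    + 6 ℤ.* N q                                    ≤⟨ ℤ.*-monoʳ-≤-nonNeg (N q) {{ℤ.nonNegative (N-nonNeg q)}}
        (ℤ.*-monoˡ-≤-nonNeg (+ 3) (ℤ.i<j⇒suc[i]≤j 2≤Nc)) ⟩
    + 3 ℤ.* N c ℤ.* N q                            ≤⟨ N-parallelogram c p q ⟩
    + 2 ℤ.* (N (θ ⊗ c ⊗ q ⊕ p) ℤ.+ N p)            <⟨ ℤ.*-monoˡ-<-pos (+ 2) (ℤ.+-mono-≤-< h p<q) ⟩
    + 2 ℤ.* (N q ℤ.+ N q)                          ≡⟨ solve 1 (λ n → con (+ 2) :* (n :+ n) := con (+ 4) :* n)
        refl (N q) ⟩
    + 4 ℤ.* N q                                    ≤⟨ ℤ.*-monoʳ-≤-nonNeg (N q) {{ℤ.nonNegative (N-nonNeg q)}}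
        (from-yes (+ 4 ℤ.≤? + 6)) ⟩
    + 6 ℤ.* N q                                    ∎)
    where open ℤ.≤-Reasoning

  double-step-contracts⇒N≤2 : ∀ c {p q} → N p ℤ.< N q → N (θ ⊗ c ⊗ q ⊕ (p ⊕ p)) ℤ.≤ N q → N c ℤ.≤ + 2
  double-step-contracts⇒N≤2 c {p} {q} p<q h = ℤ.≮⇒≥ λ 3≤Nc → ℤ.<-irrefl refl (begin-strict
    + 9 ℤ.* N q                                    ≤⟨ ℤ.*-monoʳ-≤-nonNeg (N q) {{ℤ.nonNegative (N-nonNeg q)}}
        (ℤ.*-monoˡ-≤-nonNeg (+ 3) (ℤ.i<j⇒suc[i]≤j 3≤Nc)) ⟩
    + 3 ℤ.* N c ℤ.* N q                            ≤⟨ N-parallelogram′ c p q ⟩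
    + 3 ℤ.* N (θ ⊗ c ⊗ q ⊕ (p ⊕ p)) ℤ.+ + 6 ℤ.* N p   <⟨ ℤ.+-mono-≤-< (ℤ.*-monoˡ-≤-nonNeg (+ 3) h)
        (ℤ.*-monoˡ-<-pos (+ 6) p<q) ⟩
    + 3 ℤ.* N q ℤ.+ + 6 ℤ.* N q                    ≡⟨ solve 1 (λ n → con (+ 3) :* n :+ con (+ 6) :* n :=
        con (+ 9) :* n) refl (N q) ⟩
    + 9 ℤ.* N q                                    ∎)
    where open ℤ.≤-Reasoning

  unit-N : ∀ {u} → u ∈ˡ units → N u ≡ + 1
  unit-N = All.lookup (from-yes (All.all? (λ u → N u ℤ.≟ + 1) units))

  next : E → E → E → E
  next c p q = θ ⊗ c ⊗ q ⊕ p

  double-units : All (λ u → All (λ c → c ≡ 𝟘 ⊎ c ≡ conj u ⊎ ¬ (N (c ⊕ c ⊖ conj u) ℤ.≤ + 2)) units) units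
  double-units = from-yes (All.all? (λ u → All.all? (λ c →
    (c ≟ 𝟘) ⊎-dec ((c ≟ conj u) ⊎-dec ¬? (N (c ⊕ c ⊖ conj u) ℤ.≤? + 2))) units) units)

  -- Inversion maps the disc of radius 1 about -θ u to the disc of radius 1/2 about θ (conj u) / 2.
  invert-disc : ∀ {r q u} → u ∈ˡ units → X u q r → N (r ⊕ r ⊖ θ ⊗ conj u ⊗ q) ℤ.≤ N q
  invert-disc {r@(r₁ , r₂)} {q@(q₁ , q₂)} {u@(u₁ , u₂)} u∈ x = 0≤⇒≤ (ℤ.*-monoˡ-≤-nonNeg (+ 2) (ℤ.i≤j⇒0≤j-i x))
    (modulo (+ 6 ℤ.* N r ℤ.- + 3 ℤ.* N q) (unit-N u∈) (solve 6 (λ r₁ r₂ q₁ q₂ u₁ u₂ →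
      let r = (r₁ , r₂) ; q = (q₁ , q₂) ; u = (u₁ , u₂) in
      P.N q :- P.N (r P.⊕ r P.⊖ θᴾ P.⊗ P.conj u P.⊗ q)
      := con (+ 2) :* (P.N r :- P.N (θᴾ P.⊗ u P.⊗ r P.⊕ q))
         :+ (P.N u :- con (+ 1)) :* (con (+ 6) :* P.N r :- con (+ 3) :* P.N q)) refl r₁ r₂ q₁ q₂ u₁ u₂))

  double-next : ∀ c p q u → next c p q ⊕ next c p q ⊖ θ ⊗ conj u ⊗ q ≡ θ ⊗ (c ⊕ c ⊖ conj u) ⊗ q ⊕ (p ⊕ p)
  double-next (c₁ , c₂) (p₁ , p₂) (q₁ , q₂) (u₁ , u₂) = cong₂ _,_
    (solve 8 (λ c₁ c₂ p₁ p₂ q₁ q₂ u₁ u₂ → proj₁ (lhs (c₁ , c₂) (p₁ , p₂) (q₁ , q₂) (u₁ , u₂)) :=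
        proj₁ (rhs (c₁ , c₂) (p₁ , p₂) (q₁ , q₂) (u₁ , u₂)))
      refl c₁ c₂ p₁ p₂ q₁ q₂ u₁ u₂)
    (solve 8 (λ c₁ c₂ p₁ p₂ q₁ q₂ u₁ u₂ → proj₂ (lhs (c₁ , c₂) (p₁ , p₂) (q₁ , q₂) (u₁ , u₂)) :=
        proj₂ (rhs (c₁ , c₂) (p₁ , p₂) (q₁ , q₂) (u₁ , u₂)))
      refl c₁ c₂ p₁ p₂ q₁ q₂ u₁ u₂)
    where
    lhs rhs : ∀ {n} (c p q u : P.E {n}) → P.E {n}
    lhs c p q u = θᴾ P.⊗ c P.⊗ q P.⊕ p P.⊕ (θᴾ P.⊗ c P.⊗ q P.⊕ p) P.⊖ θᴾ P.⊗ P.conj u P.⊗ q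
    rhs c p q u = θᴾ P.⊗ (c P.⊕ c P.⊖ P.conj u) P.⊗ q P.⊕ (p P.⊕ p)

  -- The bound 4|c|² ≤ 2 (|2c - conj u|² + |u|²) ≤ 6 leaves 0 and the units, and `double-units`
  -- settles the units.
  double-small : ∀ c {u} → u ∈ˡ units → N (c ⊕ c ⊖ conj u) ℤ.≤ + 2 → c ≡ 𝟘 ⊎ c ≡ conj u
  double-small c@(c₁ , c₂) {u@(u₁ , u₂)} u∈ h = Sum.[ inj₁ , (λ c∈ → Sum.map₂
    (λ { (inj₁ c≡ū) → c≡ū ; (inj₂ ≰2) → ⊥-elim (≰2 h) }) (All.lookup (All.lookup double-units u∈) c∈)) ]′
    (N≤2⇒0⊎unit c (ℤ.*-cancelˡ-≤-pos (N c) (+ 2) (+ 4) (begin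
      + 4 ℤ.* N c                            ≤⟨ 0≤⇒≤ (N-nonNeg (c ⊕ c ⊖ conj u ⊖ conj u)) (solve 4 (λ c₁ c₂ u₁ u₂ →
        let c = (c₁ , c₂) ; u = (u₁ , u₂) in
        con (+ 2) :* (P.N (c P.⊕ c P.⊖ P.conj u) :+ P.N u) :- con (+ 4) :* P.N c
        := P.N (c P.⊕ c P.⊖ P.conj u P.⊖ P.conj u)) refl c₁ c₂ u₁ u₂) ⟩
      + 2 ℤ.* (N (c ⊕ c ⊖ conj u) ℤ.+ N u)   ≤⟨ ℤ.*-monoˡ-≤-nonNeg (+ 2) (ℤ.+-mono-≤ h (ℤ.≤-reflexive (unit-N u∈))) ⟩
      + 6                                    ≤⟨ from-yes (+ 6 ℤ.≤? + 8) ⟩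
      + 8                                    ∎)))
    where open ℤ.≤-Reasoning

  -- A second inversion: p / q lies in the disc of radius 1/2 about -θ (conj u) / 2, whose inverse
  -- is the unit disc about θ u. The sum of three conjugates is left unsimplified to match the shape
  -- after substituting the digit.
  double-step⇒Y : ∀ {p q u} → u ∈ˡ units → N (θ ⊗ (conj u ⊕ conj u ⊖ conj u) ⊗ q ⊕ (p ⊕ p)) ℤ.≤ N q → Y u p q
  double-step⇒Y {p@(p₁ , p₂)} {q@(q₁ , q₂)} {u@(u₁ , u₂)} u∈ h =
    ℤ.*-cancelˡ-≤-pos (N (q ⊖ θ ⊗ u ⊗ p)) (N p) (+ 2) (0≤⇒≤ (ℤ.i≤j⇒0≤j-i h)
      (modulo (+ 3 ℤ.* N q ℤ.- + 6 ℤ.* N p) (unit-N u∈) (solve 6 (λ p₁ p₂ q₁ q₂ u₁ u₂ →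
        let p = (p₁ , p₂) ; q = (q₁ , q₂) ; u = (u₁ , u₂) ; ū = P.conj u in
        con (+ 2) :* P.N p :- con (+ 2) :* P.N (q P.⊖ θᴾ P.⊗ u P.⊗ p)
        := P.N q :- P.N (θᴾ P.⊗ (ū P.⊕ ū P.⊖ ū) P.⊗ q P.⊕ (p P.⊕ p))
           :+ (P.N u :- con (+ 1)) :* (con (+ 3) :* P.N q :- con (+ 6) :* P.N p)) refl p₁ p₂ q₁ q₂ u₁ u₂)))

  -- Inversion turns the disc for q / q′ into one for q′ / q = θ c + p / q, where the digit can be
  -- read off: |θ (2c - conj u) q + 2p| ≤ |q| bounds 2c - conj u. The alternative c = 0 is excluded
  -- later, by |1 / z| > 1.
  X-step : ∀ c {p q u} → N p ℤ.< N q → u ∈ˡ units → X u q (next c p q) →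
           c ≡ 𝟘 ⊎ (c ≡ conj u × Y u p q)
  X-step c {p} {q} {u} p<q u∈ x = Sum.map₂ (λ c≡ū → c≡ū , double-step⇒Y {p} {q} u∈
      (subst (λ c → N (θ ⊗ (c ⊕ c ⊖ conj u) ⊗ q ⊕ (p ⊕ p)) ℤ.≤ N q) c≡ū close))
    (double-small c u∈ (double-step-contracts⇒N≤2 (c ⊕ c ⊖ conj u) {p} {q} p<q close))
    where
    close : N (θ ⊗ (c ⊕ c ⊖ conj u) ⊗ q ⊕ (p ⊕ p)) ℤ.≤ N q
    close = subst (λ z → N z ℤ.≤ N q) (double-next c p q u) (invert-disc {next c p q} {q} u∈ x)

  -- The condition already concerns q′ / q = θ c + p / q, so absorbing θ u into the digit turns it
  -- into `X (c ⊖ u) p q`, and `step-contracts⇒N≤1` applies to c ⊖ u.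
  Y-step : ∀ c {p q u} → N p ℤ.< N q → Y u q (next c p q) → c ≡ u ⊎ (c ⊖ u ∈ˡ units × X (c ⊖ u) p q)
  Y-step c@(c₁ , c₂) {p@(p₁ , p₂)} {q@(q₁ , q₂)} {u@(u₁ , u₂)} p<q y = cases (N≤2⇒0⊎unit (c ⊖ u)
      (ℤ.≤-trans (step-contracts⇒N≤1 (c ⊖ u) p<q x) (from-yes (+ 1 ℤ.≤? + 2))))
    where
    x : X (c ⊖ u) p q
    x = subst (λ z → N z ℤ.≤ N q) (cong₂ _,_
      (solve 8 (λ c₁ c₂ p₁ p₂ q₁ q₂ u₁ u₂ → proj₁ (lhs (c₁ , c₂) (p₁ , p₂) (q₁ , q₂) (u₁ , u₂)) :=
          proj₁ (rhs (c₁ , c₂) (p₁ , p₂) (q₁ , q₂) (u₁ , u₂)))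
        refl c₁ c₂ p₁ p₂ q₁ q₂ u₁ u₂)
      (solve 8 (λ c₁ c₂ p₁ p₂ q₁ q₂ u₁ u₂ → proj₂ (lhs (c₁ , c₂) (p₁ , p₂) (q₁ , q₂) (u₁ , u₂)) :=
          proj₂ (rhs (c₁ , c₂) (p₁ , p₂) (q₁ , q₂) (u₁ , u₂)))
        refl c₁ c₂ p₁ p₂ q₁ q₂ u₁ u₂)) y
      where
      lhs rhs : ∀ {n} (c p q u : P.E {n}) → P.E {n}
      lhs c p q u = θᴾ P.⊗ c P.⊗ q P.⊕ p P.⊖ θᴾ P.⊗ u P.⊗ q
      rhs c p q u = θᴾ P.⊗ (c P.⊖ u) P.⊗ q P.⊕ p
    cases : c ⊖ u ≡ 𝟘 ⊎ c ⊖ u ∈ˡ units → c ≡ u ⊎ (c ⊖ u ∈ˡ units × X (c ⊖ u) p q)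
    cases (inj₁ eq) = inj₁ (cong₂ _,_ (ℤ.i-j≡0⇒i≡j c₁ u₁ (cong proj₁ eq)) (ℤ.i-j≡0⇒i≡j c₂ u₂ (cong proj₂ eq)))
    cases (inj₂ u∈) = inj₂ (u∈ , x)

-- The six directions, the faces of the hexagon and the exceptional digits

module Directions where

  open ≡ using (refl; sym; trans; cong; cong₂; subst; subst₂)
  open Z
  open EisensteinIntegers
  open ℤ.+-*-Solver

  D : E → E
  D u = θ ⊗ u

  -- `U` contains the open sides with outward normals D 1, D (- conj ζ) and D (- ζ). The strict
  -- directions are the opposite ones, in which a non-exceptional point of `U` stays strictly
  -- inside; that they contain one of each pair u, -u is what separates translates of `U`.
  exceptionals strictDirections : List E
  exceptionals = neg ζᶻ ∷ ζ̄ᶻ ∷ []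
  strictDirections = neg 𝟙 ∷ ζᶻ ∷ ζ̄ᶻ ∷ []

  open DecMembership _≟_ using (_∈?_)

  table : ∀ {P : E → Set} xs (P? : ∀ x → Dec (P x)) {_ : True (All.all? P? xs)} → ∀ {x} → x ∈ˡ xs → P x
  table xs P? {t} = All.lookup (toWitness t)

  D-N : ∀ {u} → u ∈ˡ units → N (D u) ≡ + 3
  D-N = table units (λ u → N (D u) ℤ.≟ + 3)

  conj-unit : ∀ {u} → u ∈ˡ units → conj u ∈ˡ units
  conj-unit = table units (λ u → conj u ∈? units)

  neg-unit : ∀ {u} → u ∈ˡ units → neg u ∈ˡ units
  neg-unit = table units (λ u → neg u ∈? units)

  rotate-unit : ∀ {u v} → u ∈ˡ units → v ∈ˡ units → u ⊗ v ∈ˡ units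
  rotate-unit u∈ = All.lookup (table units (λ u → All.all? (λ v → u ⊗ v ∈? units) units) u∈)

  D-angles : ∀ {u v} → u ∈ˡ units → v ∈ˡ units →
             u ⊕ v ≡ 𝟘 ⊎ ⟨ D u , D v ⟩ ≡ -[1+ 2 ] ⊎ ⟨ D u , D v ⟩ ≡ + 3 ⊎ ⟨ D u , D v ⟩ ≡ + 6
  D-angles u∈ v∈ = All.lookup (table units (λ u → All.all? (λ v →
    (u ⊕ v ≟ 𝟘) ⊎-dec ((⟨ D u , D v ⟩ ℤ.≟ -[1+ 2 ]) ⊎-dec
        ((⟨ D u , D v ⟩ ℤ.≟ + 3) ⊎-dec (⟨ D u , D v ⟩ ℤ.≟ + 6)))) units) u∈) v∈

  D-neg-conj : ∀ u → neg (conj (D u)) ≡ D (conj u)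
  D-neg-conj (a , b) = cong₂ _,_
    (solve 2 (λ a b → proj₁ (P.neg (P.conj (θᴾ P.⊗ (a , b)))) := proj₁ (θᴾ P.⊗ P.conj (a , b))) refl a b)
    (solve 2 (λ a b → proj₂ (P.neg (P.conj (θᴾ P.⊗ (a , b)))) := proj₂ (θᴾ P.⊗ P.conj (a , b))) refl a b)

  D-neg-rotate : ∀ u v → D (neg (u ⊗ v)) ≡ neg (D u ⊗ v)
  D-neg-rotate (a , b) (c , d) = cong₂ _,_
    (solve 4 (λ a b c d → proj₁ (θᴾ P.⊗ P.neg ((a , b) P.⊗ (c , d))) :=
        proj₁ (P.neg (θᴾ P.⊗ (a , b) P.⊗ (c , d)))) refl a b c d)
    (solve 4 (λ a b c d → proj₂ (θᴾ P.⊗ P.neg ((a , b) P.⊗ (c , d))) :=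
        proj₂ (P.neg (θᴾ P.⊗ (a , b) P.⊗ (c , d)))) refl a b c d)

  D-⊕ : ∀ u v → D (u ⊕ v) ≡ D u ⊕ D v
  D-⊕ (a , b) (c , d) = cong₂ _,_
    (solve 4 (λ a b c d → proj₁ (θᴾ P.⊗ ((a , b) P.⊕ (c , d))) := proj₁ (θᴾ P.⊗ (a , b) P.⊕ θᴾ P.⊗ (c , d)))
        refl a b c d)
    (solve 4 (λ a b c d → proj₂ (θᴾ P.⊗ ((a , b) P.⊕ (c , d))) := proj₂ (θᴾ P.⊗ (a , b) P.⊕ θᴾ P.⊗ (c , d)))
        refl a b c d)

  D-⊖ : ∀ u v → D (u ⊖ v) ≡ D u ⊖ D v
  D-⊖ (a , b) (c , d) = cong₂ _,_
    (solve 4 (λ a b c d → proj₁ (θᴾ P.⊗ ((a , b) P.⊖ (c , d))) := proj₁ (θᴾ P.⊗ (a , b) P.⊖ θᴾ P.⊗ (c , d)))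
        refl a b c d)
    (solve 4 (λ a b c d → proj₂ (θᴾ P.⊗ ((a , b) P.⊖ (c , d))) := proj₂ (θᴾ P.⊗ (a , b) P.⊖ θᴾ P.⊗ (c , d)))
        refl a b c d)

  ⊕-⊖ : ∀ u v → u ⊕ (v ⊖ u) ≡ v
  ⊕-⊖ (a , b) (c , d) = cong₂ _,_
    (solve 2 (λ a c → a :+ (c :- a) := c) refl a c) (solve 2 (λ a c → a :+ (c :- a) := c) refl b d)

  conj-D-neg-conj : ∀ u → conj (D (neg (conj u))) ≡ D u
  conj-D-neg-conj (a , b) = cong₂ _,_
    (solve 2 (λ a b → proj₁ (P.conj (θᴾ P.⊗ P.neg (P.conj (a , b)))) := proj₁ (θᴾ P.⊗ (a , b))) refl a b)
    (solve 2 (λ a b → proj₂ (P.conj (θᴾ P.⊗ P.neg (P.conj (a , b)))) := proj₂ (θᴾ P.⊗ (a , b))) refl a b)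

  D-neg : ∀ u → D (neg u) ≡ neg (D u)
  D-neg (a , b) = cong₂ _,_
    (solve 2 (λ a b → proj₁ (θᴾ P.⊗ P.neg (a , b)) := proj₁ (P.neg (θᴾ P.⊗ (a , b)))) refl a b)
    (solve 2 (λ a b → proj₂ (θᴾ P.⊗ P.neg (a , b)) := proj₂ (P.neg (θᴾ P.⊗ (a , b)))) refl a b)

  D-ζ̄ : ∀ v → (+ 1 , + 1) ⊗ v ≡ D (ζ̄ᶻ ⊗ v)
  D-ζ̄ (a , b) = cong₂ _,_
    (solve 2 (λ a b → proj₁ ((con (+ 1) , con (+ 1)) P.⊗ (a , b)) :=
        proj₁ (θᴾ P.⊗ ((con (+ 1) , con -[1+ 0 ]) P.⊗ (a , b)))) refl a b)
    (solve 2 (λ a b → proj₂ ((con (+ 1) , con (+ 1)) P.⊗ (a , b)) :=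
        proj₂ (θᴾ P.⊗ ((con (+ 1) , con -[1+ 0 ]) P.⊗ (a , b)))) refl a b)

  N-D : ∀ c → N (D c) ≡ + 3 ℤ.* N c
  N-D (a , b) = solve 2 (λ a b → P.N (θᴾ P.⊗ (a , b)) := con (+ 3) :* P.N (a , b)) refl a b

  exceptional-N : ∀ {e} → e ∈ˡ exceptionals → N e ≡ + 1
  exceptional-N = table exceptionals (λ e → N e ℤ.≟ + 1)

  exceptional-D𝟙 : ∀ {e} → e ∈ˡ exceptionals → N (e ⊕ D 𝟙) ≡ + 1
  exceptional-D𝟙 = table exceptionals (λ e → N (e ⊕ D 𝟙) ℤ.≟ + 1)

  -- When the orbit arrives at e, the preceding reciprocal is e + D c. For c = 1 + u the table shows
  -- that it cannot have modulus above 1 and lie in the half plane of D u as well, which removes a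
  -- possible source of `Y 𝟙`.
  exceptional-beyond : ∀ {e u} → e ∈ˡ exceptionals → u ∈ˡ units →
    N (e ⊕ D (𝟙 ⊕ u)) ℤ.≤ + 1 ⊎ + 3 ℤ.< ⟨ e ⊕ D (𝟙 ⊕ u) , D u ⟩
  exceptional-beyond e∈ = All.lookup (table exceptionals (λ e → All.all? (λ u →
    (N (e ⊕ D (𝟙 ⊕ u)) ℤ.≤? + 1) ⊎-dec (+ 3 ℤ.<? ⟨ e ⊕ D (𝟙 ⊕ u) , D u ⟩)) units) e∈)

  exceptional-isolated : ∀ {e u} → e ∈ˡ exceptionals → u ∈ˡ units → + 1 ℤ.≤ N (e ⊕ D u)
  exceptional-isolated e∈ = All.lookup (table exceptionals (λ e → All.all? (λ u → + 1 ℤ.≤? N (e ⊕ D u)) units) e∈)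

  exceptional-incongruent : ∀ {e e′ u} → e ∈ˡ exceptionals → e′ ∈ˡ exceptionals → u ∈ˡ units → e ⊕ D u ≢ e′
  exceptional-incongruent e∈ e′∈ = All.lookup (All.lookup (table exceptionals (λ e → All.all? (λ e′ →
    All.all? (λ u → ¬? (e ⊕ D u ≟ e′)) units) exceptionals) e∈) e′∈)

  exceptional-halfPlane : ∀ {e u} → e ∈ˡ exceptionals → u ∈ˡ units → ⟨ e , D u ⟩ ℤ.≤ + 3
  exceptional-halfPlane e∈ = All.lookup (table exceptionals (λ e → All.all? (λ u → ⟨ e , D u ⟩ ℤ.≤? + 3) units) e∈)

  strict-unit : ∀ {u} → u ∈ˡ strictDirections → u ∈ˡ units
  strict-unit = table strictDirections (λ u → u ∈? units)

  strictDirection⊎ : ∀ {u} → u ∈ˡ units → u ∈ˡ strictDirections ⊎ neg u ∈ˡ strictDirections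
  strictDirection⊎ = table units (λ u → (u ∈? strictDirections) ⊎-dec (neg u ∈? strictDirections))

  -- Finite conditions on vertices that make every convex combination with positive weights regular.
  -- As all weights are positive, a single vertex with strict inequality suffices in `strict`;
  -- `angle` and `distinct` force |z| < 1.
  record IsFace (vs : List E) : Set where
    field
      halfPlane : ∀ {u} → u ∈ˡ units → All (λ v → ⟨ v , D u ⟩ ℤ.≤ + 3) vs
      strict    : ∀ {u} → u ∈ˡ strictDirections → Any (λ v → ⟨ v , D u ⟩ ℤ.< + 3) vs
      angle     : ∀ {w} → w ∈ˡ vs → All (λ v → ⟨ v , w ⟩ ℤ.≤ + 2) vs
      distinct  : ∀ {w} → w ∈ˡ vs → Any (λ v → ⟨ v , w ⟩ ℤ.< + 2) vs

  isFace : ∀ vs → {_ : True (All.all? (λ u → All.all? (λ v → ⟨ v , D u ⟩ ℤ.≤? + 3) vs) units)}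
           {_ : True (All.all? (λ u → Any.any? (λ v → ⟨ v , D u ⟩ ℤ.<? + 3) vs) strictDirections)}
           {_ : True (All.all? (λ w → All.all? (λ v → ⟨ v , w ⟩ ℤ.≤? + 2) vs) vs)}
           {_ : True (All.all? (λ w → Any.any? (λ v → ⟨ v , w ⟩ ℤ.<? + 2) vs) vs)} → IsFace vs
  isFace vs {h} {s} {a} {d} = record
    { halfPlane = All.lookup (toWitness h) ; strict = All.lookup (toWitness s)
    ; angle = All.lookup (toWitness a) ; distinct = All.lookup (toWitness d) }

  hexagon-face : IsFace units
  hexagon-face = isFace units

  side₁-face : IsFace (ζᶻ ∷ neg ζ̄ᶻ ∷ [])
  side₁-face = isFace _

  side₂-face : IsFace (neg ζᶻ ∷ neg 𝟙 ∷ [])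
  side₂-face = isFace _

  side₃-face : IsFace (𝟙 ∷ ζ̄ᶻ ∷ [])
  side₃-face = isFace _

  -- The partial quotients at an exceptional point are θ times 1, 1, κ, κ̄, 1, 1, …
  exceptionalDigit : E → ℕ → E
  exceptionalDigit κ 0 = 𝟙
  exceptionalDigit κ 1 = 𝟙
  exceptionalDigit κ 2 = κ
  exceptionalDigit κ 3 = conj κ
  exceptionalDigit κ (suc (suc (suc (suc k)))) = exceptionalDigit κ k

  -- What survives of the dangerous discs just before the exceptional digit number k, counted from
  -- 0. No point z occurs in it: the digits being known, the denominators suffice. `X` at the coming
  -- digit decides growth, and `Y` is recorded only where the next phase depends on it.
  Phase : ℕ → E → E → Set
  Phase 0 p q = ¬ X 𝟙 p q × ¬ Y 𝟙 p q
  Phase 1 p q = ∀ {u} → u ∈ˡ units → ¬ X u p q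
  Phase 2 p q = ∀ {u} → u ∈ˡ units → (X u p q → u ≡ 𝟙) × (Y u p q → u ≡ 𝟙)
  Phase 3 p q = ∀ {u} → u ∈ˡ units → ¬ X u p q
  Phase (suc (suc (suc (suc k)))) p q = Phase k p q

  𝟙∈ : 𝟙 ∈ˡ units
  𝟙∈ = here refl

  conj≡𝟙 : ∀ {u} → u ∈ˡ units → 𝟙 ≡ conj u → u ≡ 𝟙
  conj≡𝟙 = table units (λ u → (𝟙 ≟ conj u) →-dec (u ≟ 𝟙))

  ζ≢ : ∀ {κ} → κ ∈ˡ (ζᶻ ∷ ζ̄ᶻ ∷ []) → κ ∈ˡ units × κ ≢ 𝟘 × κ ≢ 𝟙 × conj κ ∈ˡ units × conj κ ≢ 𝟘 × conj κ ≢ 𝟙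
  ζ≢ = table (ζᶻ ∷ ζ̄ᶻ ∷ []) (λ κ → (κ ∈? units) ×-dec ¬? (κ ≟ 𝟘) ×-dec ¬? (κ ≟ 𝟙) ×-dec
    (conj κ ∈? units) ×-dec ¬? (conj κ ≟ 𝟘) ×-dec ¬? (conj κ ≟ 𝟙))

  phase-step : ∀ {κ} → κ ∈ˡ (ζᶻ ∷ ζ̄ᶻ ∷ []) → ∀ k {p q} → N p ℤ.< N q → Phase k p q →
               let q′ = next (exceptionalDigit κ k) p q in N q ℤ.< N q′ × Phase (suc k) q q′
  phase-step κ∈ 0 {p} {q} p<q (¬x , ¬y) = ℤ.≰⇒> ¬x , λ {u} u∈ x →
    Sum.[ (λ ()) , (λ (𝟙≡ū , y) → ¬y (subst (λ u → Y u p q) (conj≡𝟙 u∈ 𝟙≡ū) y)) ]′ (X-step 𝟙 p<q u∈ x)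
  phase-step κ∈ 1 {p} {q} p<q ¬x = ℤ.≰⇒> (¬x 𝟙∈) , λ {u} u∈ →
    (λ x → Sum.[ (λ ()) , (λ (𝟙≡ū , _) → conj≡𝟙 u∈ 𝟙≡ū) ]′ (X-step 𝟙 {p} {q} {u} p<q u∈ x)) ,
    (λ y → Sum.[ sym , (λ (v∈ , x) → ⊥-elim (¬x v∈ x)) ]′ (Y-step 𝟙 {p} {q} {u} p<q y))
  -- Before κ the only possible discs are those of 𝟙. Growth could fail only in the disc of κ, which
  -- is not 𝟙, and a new `X` disc would require κ = conj 𝟙.
  phase-step κ∈ 2 {p} {q} p<q xy = let u∈ , ≢𝟘 , ≢𝟙 , _ = ζ≢ κ∈ in
    ℤ.≰⇒> (λ x → ≢𝟙 (proj₁ (xy u∈) x)) , λ {v} v∈ x →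
    Sum.[ ≢𝟘 , (λ (κ≡v̄ , y) → ≢𝟙 (trans κ≡v̄ (cong conj (proj₂ (xy v∈) y)))) ]′ (X-step _ {p} {q} {v} p<q v∈ x)
  phase-step κ∈ 3 {p} {q} p<q ¬x = let _ , _ , _ , u∈ , ≢𝟘 , ≢𝟙 = ζ≢ κ∈ in
    ℤ.≰⇒> (¬x u∈) ,
    (λ x → Sum.[ ≢𝟘 , (λ (κ̄≡𝟙 , _) → ≢𝟙 κ̄≡𝟙) ]′ (X-step _ {p} {q} {𝟙} p<q 𝟙∈ x)) ,
    (λ y → Sum.[ ≢𝟙 , (λ (v∈ , x) → ¬x v∈ x) ]′ (Y-step _ {p} {q} {𝟙} p<q y))
  phase-step κ∈ (suc (suc (suc (suc k)))) p<q ph = phase-step κ∈ k p<q ph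

  initial : ∀ {u} → u ∈ˡ units → ¬ X u 𝟘 𝟙 × ¬ Y u 𝟘 𝟙
  initial = table units (λ u → ¬? (N (D u ⊗ 𝟙 ⊕ 𝟘) ℤ.≤? + 1) ×-dec ¬? (N (𝟙 ⊖ D u ⊗ 𝟘) ℤ.≤? + 0))

-- One step of the expansion

module Dynamics (O : OrderedRing) where

  open ≡ using (refl; sym; trans; cong; cong₂; subst; subst₂)
  open OrderedRing O hiding (refl; sym; trans)
  open OrderedRing O using () renaming (sym to ≈-sym; trans to ≈-trans; refl to ≈-refl)
  open OrderedRingSolver O using (solve; _:=_; _:+_; _:*_; :-_; con)
  open Geometry O
  open EisensteinIntegers
  open Directions

  ιD : Z.E → E
  ιD u = ιE (D u)

  Hexagonal : E → Set
  Hexagonal z = ∀ {u} → u ∈ˡ units → HalfPlane (ιD u) z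

  ι-cong : ∀ {x y} → x ≡ y → ιE x ≋ ιE y
  ι-cong refl = ≋-refl

  ι-≈ : ∀ {i j} → i ≡ j → ι i ≈ ι j
  ι-≈ refl = ≈-refl

  ιD-N : ∀ {u} → u ∈ˡ units → N (ιD u) ≈ # 3
  ιD-N {u} u∈ = ≈-trans (≈-sym (ι-N (D u))) (ι-≈ (D-N u∈))

  ιD-neg-rotate : ∀ u v → ιD (Z.neg (u Z.⊗ v)) ≋ neg (ιD u ⊗ ιE v)
  ιD-neg-rotate u v = ≋-trans (ι-cong (D-neg-rotate u v)) (≋-trans (ι-negE (D u Z.⊗ v)) (neg-cong (ι-⊗ (D u) v)))

  record State (z : E) (p q : Z.E) : Set where
    field
      increasing : Z.N p ℤ.< Z.N q
      avoidsX    : ∀ {u} → u ∈ˡ units → X u p q → AvoidsX (ιD u) z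
      avoidsY    : ∀ {u} → u ∈ˡ units → Y u p q → AvoidsY (ιD u) z
  open State

  module Step {z w x c} (zw≋1 : z ⊗ w ≋ 𝟙) (z-hex : Hexagonal z) (Nz<1 : Positive (# 1 + - N z))
              (w≋ : w ≋ x ⊕ ιD c) (x-hex : Hexagonal x) (Nx≤1 : NonNegative (# 1 + - N x)) where

    1<Nw : Positive (N w + - # 1)
    -- Positivity is bootstrapped: N w (1 - N z) = N w - 1 is first seen to be nonnegative, so N w =
    -- 1 + (N w - 1) is positive, and only then is the product strictly positive.
    1<Nw = pos-resp eq (pos-* (pos-resp
        (solve 1 (λ n → con (+ 1) :+ (n :+ :- con (+ 1)) := n) ≈-refl (N w))
        (pos-+ (pos-ι {+ 1} (ℤ.+<+ ℕ.z<s)) (nonNeg-resp eq (nonNeg-* (nonNeg-N w) (pos⇒nonNeg Nz<1))))) Nz<1)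
      where
      eq : N w * (# 1 + - N z) ≈ N w + - # 1
      eq = ≈-trans (solve 2 (λ n m → n :* (con (+ 1) :+ :- m) := n :+ :- (n :* m)) ≈-refl (N w) (N z))
        (+-cong ≈-refl (-‿cong (inv-N zw≋1)))

    c≢𝟘 : c ≢ Z.𝟘
    c≢𝟘 refl = pos-neg 1<Nw (nonNeg-resp (≈-trans
      (+-cong ≈-refl (-‿cong (N-cong (≋-trans (≋-sym (x⊕0 x)) (≋-sym w≋)))))
      (solve 1 (λ n → con (+ 1) :+ :- n := :- (n :+ :- con (+ 1))) ≈-refl (N w))) Nx≤1)
      where
      x⊕0 : ∀ x → x ⊕ ιE Z.𝟘 ≋ x
      x⊕0 (a , b) = solve 1 (λ a → a :+ con (+ 0) := a) ≈-refl a , solve 1 (λ b → b :+ con (+ 0) := b) ≈-refl b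

    growth : ∀ {p q} → State z p q → Z.N q ℤ.< Z.N (next c p q)
    -- `N (next c p q) ≤ N q` is `X c p q` by definition, so a failure of growth puts p / q into the
    -- disc of the very digit c. The invariant and the two sides of the hexagon next to the
    -- direction -c then give |w| ≤ 1.
    growth {p} {q} s = ℤ.≰⇒> λ x → Sum.[ c≢𝟘 , (λ c∈ →
        pos-neg (pos-* (pos-ι {+ 9} (ℤ.+<+ ℕ.z<s)) 1<Nw) (nonNeg-resp
          (solve 1 (λ n → con (+ 9) :+ :- (con (+ 9) :* n) := :- (con (+ 9) :* (n :+ :- con (+ 1)))) ≈-refl (N w))
          (triangle-N≤1 {β = ιD c} (ιD-N c∈) w≋ (outside⇒halfPlane zw≋1 (avoidsX s c∈ x))
            (side c∈ (there (here refl))) (side c∈ (there (there (there (there (there (here refl)))))))))) ]′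
      (N≤2⇒0⊎unit c (ℤ.≤-trans (step-contracts⇒N≤1 c {p} {q} (increasing s) x) (from-yes (+ 1 ℤ.≤? + 2))))
      where
      side : ∀ {v} → c ∈ˡ units → v ∈ˡ units → HalfPlane (neg (ιD c ⊗ ιE v)) x
      side {v} c∈ v∈ = HalfPlane-resp (ιD-neg-rotate c v) ≋-refl (x-hex (neg-unit (rotate-unit c∈ v∈)))

    X-step-nonzero : ∀ {p q u} → State z p q → u ∈ˡ units → X u q (next c p q) → c ≡ Z.conj u × Y u p q
    X-step-nonzero {p} {q} {u} s u∈ x = Sum.[ (λ c≡𝟘 → ⊥-elim (c≢𝟘 c≡𝟘)) ,
        (λ cy → cy) ]′ (X-step c {p} {q} {u} (increasing s) u∈ x)

    w≋shift : ∀ u → w ≋ x ⊕ (ιD u ⊕ ιD (c Z.⊖ u))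
    w≋shift u = ≋-trans w≋ (⊕-cong ≋-refl (≋-trans
      (ι-cong (trans (cong D (sym (⊕-⊖ u c))) (D-⊕ u (c Z.⊖ u)))) (ι-⊕ (D u) (D (c Z.⊖ u)))))

    state-step : ∀ {p q} → State z p q → State x q (next c p q)
    state-step {p} {q} s .increasing = growth s
    -- The digit is forced to be conj u, and D (conj u) = - conj (D u). Hence passing from w to x
    -- moves the centre -2 conj (D u) / 3 to conj (D u) / 3.
    state-step {p} {q} s .avoidsX {u} u∈ xu = let c≡ū , y = X-step-nonzero s u∈ xu in
      avoidsY⇒avoidsX {β = ιD u} (ιD-N u∈)
        (≋-trans w≋ (⊕-cong ≋-refl (≋-trans (ι-cong (trans (cong D c≡ū) (sym (D-neg-conj u))))
          (≋-trans (ι-negE (Z.conj (D u))) (neg-cong (ι-conj (D u)))))))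
        (avoidsY-inverse {β = ιD u} zw≋1 (avoidsY s u∈ y))
    state-step {p} {q} s .avoidsY {u} u∈ yu = Sum.[ same , shifted ]′ (Y-step c {p} {q} {u} (increasing s) yu)
      where
      same : c ≡ u → AvoidsY (ιD u) x
      -- Here the constraint arises afresh, from the hexagon alone: the side of direction D (- conj
      -- u) bounds z, and inversion maps it to the circle about D u / 3.
      same c≡u = outside⇒avoidsY (ιD-N u∈) (≋-trans w≋ (⊕-cong ≋-refl (ι-cong (cong D c≡u))))
        (Outside-resp (≋-trans (≋-sym (ι-conj (D (Z.neg (Z.conj u))))) (ι-cong (conj-D-neg-conj u))) ≋-refl
          (halfPlane⇒outside {β = ιD (Z.neg (Z.conj u))} zw≋1 (z-hex (neg-unit (conj-unit u∈)))))
      shifted : c Z.⊖ u ∈ˡ units × X (c Z.⊖ u) p q → AvoidsY (ιD u) x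
      shifted (v∈ , xv) = angle (D-angles u∈ v∈)
        where
        v = c Z.⊖ u
        h : HalfPlane (ιD v) w
        h = outside⇒halfPlane zw≋1 (avoidsX s v∈ xv)
        ⟨⟩≈ : ∀ {k} → Z.⟨ D u , D v ⟩ ≡ k → ⟨ ιD u , ιD v ⟩ ≈ ι k
        ⟨⟩≈ eq = ≈-trans (≈-sym (ι-⟨⟩ (D u) (D v))) (ι-≈ eq)
        -v-side : HalfPlane (neg (ιD v)) x
        -v-side = HalfPlane-resp (≋-trans (ι-cong (D-neg v)) (ι-negE (D v))) ≋-refl (x-hex (neg-unit v∈))
        angle : u Z.⊕ v ≡ Z.𝟘 ⊎ Z.⟨ D u , D v ⟩ ≡ -[1+ 2 ] ⊎ Z.⟨ D u , D v ⟩ ≡ + 3 ⊎ Z.⟨ D u , D v ⟩ ≡ + 6 →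
            AvoidsY (ιD u) x
        -- Opposite u and v would give c = 0. At 120° the half plane for w is tangent to the disc in
        -- question; at 60° or 0° it would push x across the side of the hexagon in direction -v.
        angle (inj₁ ≡𝟘) = ⊥-elim (c≢𝟘 (trans (sym (⊕-⊖ u c)) ≡𝟘))
        angle (inj₂ (inj₁ ≡-3)) = halfPlane-shift⇒avoidsY (ιD-N u∈) (ιD-N v∈) (⟨⟩≈ ≡-3) (w≋shift u) h
        angle (inj₂ (inj₂ (inj₁ ≡3))) = ⊥-elim (halfPlane-shift-excluded {β = ιD u} 2 (ιD-N v∈) (⟨⟩≈ ≡3)
            (w≋shift u) h -v-side)
        angle (inj₂ (inj₂ (inj₂ ≡6))) = ⊥-elim (halfPlane-shift-excluded {β = ιD u} 5 (ιD-N v∈) (⟨⟩≈ ≡6)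
            (w≋shift u) h -v-side)

    -- The reciprocal w = e + D c is now an Eisenstein integer with N w > 1, so finite checks
    -- decide: e + D 𝟙 has norm 1, which excludes c = 𝟙, and `exceptional-beyond` excludes an `X`
    -- disc of c ⊖ 𝟙.
    phase-entry : ∀ {e p q} → e ∈ˡ exceptionals → x ≋ ιE e → State z p q → Phase 0 q (next c p q)
    phase-entry {e} {p} {q} e∈ x≋e s =
      (λ x𝟙 → c≢𝟙 (proj₁ (X-step-nonzero s 𝟙∈ x𝟙))) ,
      (λ y𝟙 → Sum.[ c≢𝟙 , shifted ]′ (Y-step c {p} {q} {Z.𝟙} (increasing s) y𝟙))
      where
      w≋e : w ≋ ιE (e Z.⊕ D c)
      w≋e = ≋-trans w≋ (≋-trans (⊕-cong x≋e ≋-refl) (≋-sym (ι-⊕ e (D c))))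
      1<N : + 1 ℤ.< Z.N (e Z.⊕ D c)
      1<N = ℤ.≰⇒> λ N≤1 → pos-neg 1<Nw (nonNeg-resp (≈-trans (ι-sub (+ 1) (Z.N (e Z.⊕ D c)))
        (≈-trans (+-cong ≈-refl (-‿cong (≈-trans (ι-N (e Z.⊕ D c)) (N-cong (≋-sym w≋e)))))
          (solve 1 (λ n → con (+ 1) :+ :- n := :- (n :+ :- con (+ 1))) ≈-refl (N w))))
        (nonNeg-ι (ℤ.i≤j⇒0≤j-i N≤1)))
      c≢𝟙 : c ≢ Z.𝟙
      c≢𝟙 c≡𝟙 = ℤ.<-irrefl (sym (exceptional-D𝟙 e∈)) (subst (λ c → + 1 ℤ.< Z.N (e Z.⊕ D c)) c≡𝟙 1<N)
      shifted : ¬ (c Z.⊖ Z.𝟙 ∈ˡ units × X (c Z.⊖ Z.𝟙) p q)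
      shifted (v∈ , xv) = Sum.[ ℤ.<⇒≱ 1<N′ , (λ 3< → ℤ.<⇒≱ 3< ≤3) ]′ (exceptional-beyond e∈ v∈)
        where
        v = c Z.⊖ Z.𝟙
        1<N′ : + 1 ℤ.< Z.N (e Z.⊕ D (Z.𝟙 Z.⊕ v))
        1<N′ = subst (λ c → + 1 ℤ.< Z.N (e Z.⊕ D c)) (sym (⊕-⊖ Z.𝟙 c)) 1<N
        ≤3 : Z.⟨ e Z.⊕ D (Z.𝟙 Z.⊕ v) , D v ⟩ ℤ.≤ + 3
        ≤3 = subst (λ d → Z.⟨ e Z.⊕ D d , D v ⟩ ℤ.≤ + 3) (sym (⊕-⊖ Z.𝟙 c)) (ℤ.0≤i-j⇒j≤i (nonNeg-ι⁻¹ (nonNeg-resp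
          (≈-trans (+-cong ≈-refl (-‿cong (≈-trans (⟨⟩-cong w≋e ≋-refl) (≈-sym (ι-⟨⟩ (e Z.⊕ D c) (D v))))))
              (≈-sym (ι-sub (+ 3) _)))
          (outside⇒halfPlane zw≋1 (avoidsX s v∈ xv)))))

-- Position of the points of U and uniqueness of the digit

module Location (O : OrderedRing) where

  open ≡ using (refl; sym; trans; cong; cong₂; subst; subst₂)
  open OrderedRing O hiding (refl; sym; trans)
  open OrderedRing O using () renaming (sym to ≈-sym; trans to ≈-trans; refl to ≈-refl)
  open OrderedRingSolver O using (solve; _:=_; _:+_; _:*_; :-_; con; module P)
  open Geometry O
  open EisensteinIntegers hiding (module P; modulo)
  open Directions
  open Dynamics O

  -- Inequalities shared by the open hexagon and the three open sides, so that these four kinds of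
  -- points of `U` are treated alike.
  record Regular (z : E) : Set where
    field
      hexagonal : Hexagonal z
      N<1       : Positive (# 1 + - N z)
      strict    : ∀ {u} → u ∈ˡ strictDirections → Positive (# 3 + - ⟨ z , ιD u ⟩)
  open Regular public

  IsExceptional : E → Set
  IsExceptional z = ∃[ e ] e ∈ˡ exceptionals × z ≋ ιE e

  exceptional-hexagonal : ∀ {z} → IsExceptional z → Hexagonal z
  exceptional-hexagonal (e , e∈ , z≋e) {u} u∈ = nonNeg-resp
    (≈-trans (ι-sub (+ 3) Z.⟨ e , D u ⟩) (+-cong ≈-refl
        (-‿cong (≈-trans (ι-⟨⟩ e (D u)) (⟨⟩-cong (≋-sym z≋e) ≋-refl)))))
    (nonNeg-ι (ℤ.i≤j⇒0≤j-i (exceptional-halfPlane e∈ u∈)))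

  location-hexagonal : ∀ {z} → Regular z ⊎ IsExceptional z → Hexagonal z
  location-hexagonal (inj₁ r) = hexagonal r
  location-hexagonal (inj₂ e) = exceptional-hexagonal e

  location-N≤1 : ∀ {z} → Regular z ⊎ IsExceptional z → NonNegative (# 1 + - N z)
  location-N≤1 (inj₁ r) = pos⇒nonNeg (N<1 r)
  location-N≤1 {z} (inj₂ (e , e∈ , z≋e)) = nonNeg-resp
    (≈-trans (ι-sub (+ 1) (Z.N e)) (+-cong ≈-refl (-‿cong (≈-trans (ι-N e) (N-cong (≋-sym z≋e))))))
    (nonNeg-ι (ℤ.i≤j⇒0≤j-i (ℤ.≤-reflexive (exceptional-N e∈))))

  regular-resp : ∀ {z z′} → z ≋ z′ → Regular z → Regular z′
  regular-resp z≋ r .hexagonal u∈ = HalfPlane-resp ≋-refl z≋ (hexagonal r u∈)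
  regular-resp z≋ r .N<1 = pos-resp (+-cong ≈-refl (-‿cong (N-cong z≋))) (N<1 r)
  regular-resp z≋ r .strict u∈ = pos-resp (+-cong ≈-refl (-‿cong (⟨⟩-cong z≋ ≋-refl))) (strict r u∈)

  opposite : ∀ {x y d} → y ≋ x ⊕ d → x ≋ y ⊕ neg d
  opposite {a , b} {_} {c , d} (p , q) =
    ≈-trans (solve 2 (λ a c → a := a :+ c :+ :- c) ≈-refl a c) (+-cong (≈-sym p) ≈-refl) ,
    ≈-trans (solve 2 (λ a c → a := a :+ c :+ :- c) ≈-refl b d) (+-cong (≈-sym q) ≈-refl)

  opposite-D : ∀ {x y d} → y ≋ x ⊕ ιD d → x ≋ y ⊕ ιD (Z.neg d)
  opposite-D {d = d} y≋ = ≋-trans (opposite y≋) (⊕-cong ≋-refl (≋-sym (≋-trans (ι-cong (D-neg d)) (ι-negE (D d)))))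

  -- In the closed hexagon ⟨ x , D d ⟩ ≥ -3, so ⟨ y , D d ⟩ = ⟨ x , D d ⟩ + 6 ≥ 3, against
  -- strictness at y.
  strict-separates : ∀ {x y d} → d ∈ˡ units → d ∈ˡ strictDirections → y ≋ x ⊕ ιD d → Regular y → ¬ Hexagonal x
  strict-separates {x@(a , b)} {y} {d} d∈ d∈s y≋ y-reg x-hex = pos-irrefl (pos-resp
    (≈-trans (+-cong (+-cong ≈-refl (-‿cong (⟨⟩-cong y≋ ≋-refl)))
        (+-cong ≈-refl (-‿cong (⟨⟩-cong ≋-refl (≋-trans (ι-cong (D-neg d)) (ι-negE (D d)))))))
      (modulo (- # 2) (ιD-N d∈) (≈-trans (solve 4 (λ a b c d → let x = (a , b) ; β = (c , d) in
        (con (+ 3) :+ :- P.⟨ x P.⊕ β , β ⟩) :+ (con (+ 3) :+ :- P.⟨ x , P.neg β ⟩)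
        := con (+ 0) :+ :- con (+ 2) :* (P.N β :+ :- con (+ 3))) ≈-refl a b (proj₁ (ιD d)) (proj₂ (ιD d)))
        (+-cong ι-0 ≈-refl))))
    (pos-+ (strict y-reg d∈s) (x-hex (neg-unit d∈))))

  exceptional-separates : ∀ {x y d} → d ∈ˡ units → y ≋ x ⊕ ιD d → Regular y → ¬ IsExceptional x
  exceptional-separates {x} {y} {d} d∈ y≋ y-reg (e , e∈ , x≋e) = pos-neg (N<1 y-reg) (nonNeg-resp
    (≈-trans (ι-sub (Z.N (e Z.⊕ D d)) (+ 1)) (≈-trans
      (+-cong (≈-trans (ι-N (e Z.⊕ D d)) (N-cong
          (≋-trans (ι-⊕ e (D d)) (≋-trans (⊕-cong (≋-sym x≋e) ≋-refl) (≋-sym y≋))))) ≈-refl)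
      (solve 1 (λ n → n :+ :- con (+ 1) := :- (con (+ 1) :+ :- n)) ≈-refl (N y))))
    (nonNeg-ι (ℤ.i≤j⇒0≤j-i (exceptional-isolated e∈ d∈))))

  separated : ∀ {x y d} → d ∈ˡ units → y ≋ x ⊕ ιD d → Regular x ⊎ IsExceptional x → ¬ (Regular y ⊎ IsExceptional y)
  separated {d = d} d∈ y≋ (inj₁ x-reg) (inj₁ y-reg) = Sum.[
    (λ s → strict-separates d∈ s y≋ y-reg (hexagonal x-reg)) ,
    (λ s → strict-separates (neg-unit d∈) s (opposite-D {d = d} y≋) x-reg (hexagonal y-reg)) ]′ (strictDirection⊎ d∈)
  separated {d = d} d∈ y≋ (inj₁ x-reg) (inj₂ y-exc) = exceptional-separates (neg-unit d∈)
      (opposite-D {d = d} y≋) x-reg y-exc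
  separated d∈ y≋ (inj₂ x-exc) (inj₁ y-reg) = exceptional-separates d∈ y≋ y-reg x-exc
  separated {d = d} d∈ y≋ (inj₂ (e , e∈ , x≋e)) (inj₂ (e′ , e′∈ , y≋e′)) = exceptional-incongruent e∈ e′∈ d∈
    (ιE-injective (≋-trans (ι-⊕ e (D d)) (≋-trans (⊕-cong (≋-sym x≋e) ≋-refl) (≋-trans (≋-sym y≋) y≋e′))))

  -- Digits and `T` are given by relations, so two derivations can be compared only through this.
  -- Points of modulus at most 1 are at most 2 apart, hence 3 N (c ⊖ d) ≤ 4 and only the six nearest
  -- translates have to be separated.
  unique : ∀ {x y c d} → x ⊕ ιD c ≋ y ⊕ ιD d → Regular x ⊎ IsExceptional x → Regular y ⊎ IsExceptional y → c ≡ d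
  unique {x@(x₁ , x₂)} {y@(y₁ , y₂)} {c} {d} eq lx ly = Sum.[
      (λ c-d≡𝟘 → trans (sym (⊕-⊖ d c)) (trans (cong (d Z.⊕_) c-d≡𝟘)
          (cong₂ _,_ (ℤ.+-identityʳ _) (ℤ.+-identityʳ _)))) ,
      (λ c-d∈ → ⊥-elim (separated c-d∈ y≋ lx ly)) ]′
    (N≤2⇒0⊎unit (c Z.⊖ d) (ℤ.*-cancelˡ-≤-pos (Z.N (c Z.⊖ d)) (+ 2) (+ 3) (ℤ.≤-trans 3N≤4 (from-yes (+ 4 ℤ.≤? + 6)))))
    where
    y≋ : y ≋ x ⊕ ιD (c Z.⊖ d)
    y≋ = ≋-trans (move eq) (⊕-cong ≋-refl (≋-sym (≋-trans (ι-cong (D-⊖ c d)) (ι-⊖ (D c) (D d)))))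
      where
      move : ∀ {x y c d} → x ⊕ c ≋ y ⊕ d → y ≋ x ⊕ (c ⊖ d)
      move {a , b} {a′ , b′} {c , d} {c′ , d′} (p , q) = line p , line q
        where
        line : ∀ {a a′ c c′} → a + c ≈ a′ + c′ → a′ ≈ a + (c + - c′)
        line {a} {a′} {c} {c′} p = ≈-trans (solve 2 (λ a c → a := a :+ c :+ :- c) ≈-refl a′ c′)
          (≈-trans (+-cong (≈-sym p) ≈-refl) (+-assoc a c (- c′)))
    3N≤4 : + 3 ℤ.* Z.N (c Z.⊖ d) ℤ.≤ + 4
    3N≤4 = ℤ.0≤i-j⇒j≤i (nonNeg-ι⁻¹ (nonNeg-resp
      (≈-trans (+-cong ≈-refl (-‿cong (≈-sym (≈-trans (ι-≈ (sym (N-D (c Z.⊖ d)))) (ι-N (D (c Z.⊖ d)))))))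
          (≈-sym (ι-sub (+ 4) _)))
      (parallelogram (location-N≤1 lx) (location-N≤1 ly))))
      where
      parallelogram : NonNegative (# 1 + - N x) → NonNegative (# 1 + - N y) → NonNegative (# 4 + - N (ιD (c Z.⊖ d)))
      parallelogram p q = nonNeg-resp
        (≈-trans (+-cong (+-cong (*-cong ≈-refl (+-cong ≈-refl (-‿cong (N-cong y≋)))) ≈-refl) ≈-refl)
          (solve 4 (λ a b c d → let x = (a , b) ; δ = (c , d) in
          con (+ 2) :* (con (+ 1) :+ :- P.N (x P.⊕ δ)) :+ con (+ 2) :* (con (+ 1) :+ :- P.N x) :+ P.N (x P.⊕ δ P.⊕ x)
          := con (+ 4) :+ :- P.N δ) ≈-refl x₁ x₂ (proj₁ (ιD (c Z.⊖ d))) (proj₂ (ιD (c Z.⊖ d)))))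
        (nonNeg-+ (nonNeg-+ (nonNeg-* nonNeg-2 q) (nonNeg-* nonNeg-2 p)) (nonNeg-N (x ⊕ ιD (c Z.⊖ d) ⊕ x)))
        where nonNeg-2 = nonNeg-ι {+ 2} (ℤ.+≤+ ℕ.z≤n)

  infixr 7 _·_

  _·_ : Carrier → E → E
  t · (a , b) = t * a , t * b

  weight : List (Carrier × Z.E) → Carrier
  weight []            = 0#
  weight ((t , _) ∷ l) = t + weight l

  combination : List (Carrier × Z.E) → E
  combination []            = 0# , 0#
  combination ((t , v) ∷ l) = t · ιE v ⊕ combination l

  -- `total` is the weighted sum of the slacks, rewritten in terms of the combination itself; for
  -- weights of sum 1 it is the slack at the combination.
  module Combination (i : ℤ) (β : E) where

    slack : Z.E → Carrier
    slack v = ι i + - ⟨ ιE v , β ⟩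

    total : List (Carrier × Z.E) → Carrier
    total l = ι i * weight l + - ⟨ combination l , β ⟩

    total-[] : 0# ≈ total []
    total-[] = ≈-trans (≈-sym ι-0) (≈-trans
      (solve 3 (λ k c d → con (+ 0) := k :* con (+ 0) :+ :- P.⟨ (con (+ 0) , con (+ 0)) , (c , d) ⟩) ≈-refl
          (ι i) (proj₁ β) (proj₂ β))
      (+-cong (*-cong ≈-refl ι-0) (-‿cong (⟨⟩-cong (ι-0 , ι-0) ≋-refl))))

    total-∷ : ∀ t v l → t * slack v + total l ≈ total ((t , v) ∷ l)
    total-∷ t (a , b) l = solve 9 (λ k t w a b p q c d →
      t :* (k :+ :- P.⟨ (a , b) , (c , d) ⟩) :+ (k :* w :+ :- P.⟨ (p , q) , (c , d) ⟩)
      := k :* (t :+ w) :+ :- P.⟨ (t :* a , t :* b) P.⊕ (p , q) , (c , d) ⟩) ≈-refl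
      (ι i) t (weight l) (ι a) (ι b) (proj₁ (combination l)) (proj₂ (combination l)) (proj₁ β) (proj₂ β)

    total-nonNeg : ∀ {l} → All (λ (t , _) → Positive t) l → All (λ (_ , v) → NonNegative (slack v)) l →
        NonNegative (total l)
    total-nonNeg [] [] = nonNeg-resp (≈-trans ι-0 total-[]) (nonNeg-ι ℤ.≤-refl)
    total-nonNeg {(t , v) ∷ l} (p ∷ ps) (n ∷ ns) = nonNeg-resp (total-∷ t v l)
      (nonNeg-+ (nonNeg-* (pos⇒nonNeg p) n) (total-nonNeg ps ns))

    total-pos : ∀ {l} → All (λ (t , _) → Positive t) l → All (λ (_ , v) → NonNegative (slack v)) l →
                Any (λ (_ , v) → Positive (slack v)) l → Positive (total l)
    total-pos {(t , v) ∷ l} (p ∷ ps) (_ ∷ ns) (here s) = pos-resp (total-∷ t v l)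
      (pos-+ (pos-* p s) (total-nonNeg ps ns))
    total-pos {(t , v) ∷ l} (p ∷ ps) (n ∷ ns) (there s) = pos-resp (≈-trans (+-comm _ _) (total-∷ t v l))
      (pos-+ (total-pos ps ns s) (nonNeg-* (pos⇒nonNeg p) n))

    normalise : ∀ {l} → weight l ≈ # 1 → total l ≈ ι i + - ⟨ combination l , β ⟩
    normalise w≈1 = +-cong (≈-trans (*-cong ≈-refl w≈1) (solve 1 (λ k → k :* con (+ 1) := k) ≈-refl (ι i))) ≈-refl

  slack-nonNeg : ∀ {i v w} → Z.⟨ v , w ⟩ ℤ.≤ i → NonNegative (Combination.slack i (ιE w) v)
  slack-nonNeg {i} {v} {w} h = nonNeg-resp (≈-trans (ι-sub i _) (+-cong ≈-refl (-‿cong (ι-⟨⟩ v w))))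
      (nonNeg-ι (ℤ.i≤j⇒0≤j-i h))

  slack-pos : ∀ {i v w} → Z.⟨ v , w ⟩ ℤ.< i → Positive (Combination.slack i (ιE w) v)
  slack-pos {i} {v} {w} h = pos-resp (≈-trans (ι-sub i _) (+-cong ≈-refl (-‿cong (ι-⟨⟩ v w))))
    (pos-ι (subst (ℤ._< i ℤ.- Z.⟨ v , w ⟩) (ℤ.+-inverseʳ Z.⟨ v , w ⟩) (ℤ.+-monoˡ-< (ℤ.- Z.⟨ v , w ⟩) h)))

  face-regular : ∀ l → IsFace (List.map proj₂ l) → All (λ (t , _) → Positive t) l → weight l ≈ # 1 →
      Regular (combination l)
  face-regular l face ps w≈1 = record
    { hexagonal = λ {u} u∈ → nonNeg-resp (Combination.normalise (+ 3) (ιD u) {l} w≈1)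
        (Combination.total-nonNeg (+ 3) (ιD u) ps
          (All.map⁻ (All.map (λ {v} → slack-nonNeg {+ 3} {v} {D u}) (halfPlane face u∈))))
    -- Positivity is used twice: against each vertex w it gives ⟨ z , w ⟩ < 2, and with these slacks
    -- against z itself it gives ⟨ z , z ⟩ < 2. The `Any` taken from `strict` serves to show that
    -- the list is nonempty.
    ; N<1 = pos-scale 1 (pos-resp
        (≈-trans (Combination.normalise (+ 2) z {l} w≈1)
          (solve 2 (λ a b → con (+ 2) :+ :- P.⟨ (a , b) , (a , b) ⟩ :=
              con (+ 2) :* (con (+ 1) :+ :- P.N (a , b))) ≈-refl (proj₁ z) (proj₂ z)))
        (Combination.total-pos (+ 2) z ps (All.map pos⇒nonNeg vertex-pos)
            (any (Any.map⁻ (strict-at face (here refl))) vertex-pos)))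
    ; strict = λ {u} u∈ → pos-resp (Combination.normalise (+ 3) (ιD u) {l} w≈1)
        (Combination.total-pos (+ 3) (ιD u) ps
          (All.map⁻ (All.map (λ {v} → slack-nonNeg {+ 3} {v} {D u}) (halfPlane face (strict-unit u∈))))
          (Any.map⁻ (Any.map (λ {v} → slack-pos {+ 3} {v} {D u}) (strict-at face u∈)))) }
    where
    open IsFace renaming (strict to strict-at)
    z = combination l
    ⟨⟩-comm : ∀ x y → ⟨ x , y ⟩ ≈ ⟨ y , x ⟩
    ⟨⟩-comm (a , b) (c , d) = solve 4 (λ a b c d → P.⟨ (a , b) , (c , d) ⟩ := P.⟨ (c , d) , (a , b) ⟩) ≈-refl a b c d
    vertex-pos : All (λ (_ , v) → Positive (Combination.slack (+ 2) z v)) l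
    vertex-pos = All.map⁻ (All.tabulate λ {w} w∈ → pos-resp
      (≈-trans (Combination.normalise (+ 2) (ιE w) {l} w≈1) (+-cong ≈-refl (-‿cong (⟨⟩-comm z (ιE w)))))
      (Combination.total-pos (+ 2) (ιE w) ps
        (All.map⁻ (All.map (λ {v} → slack-nonNeg {+ 2} {v} {w}) (angle face w∈)))
        (Any.map⁻ (Any.map (λ {v} → slack-pos {+ 2} {v} {w}) (distinct face w∈)))))
    any : ∀ {P Q : Carrier × Z.E → Set} {l} → Any Q l → All P l → Any P l
    any (here _)  (p ∷ _)  = here p
    any (there i) (_ ∷ ps) = there (any i ps)

-- Cauchy reals as an ordered ring with square roots

module RealOrder where

  open ≡ using (refl; sym; trans; cong; cong₂; subst; subst₂)
  open Auxiliary
  open ℚ.+-*-Solver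
  open Real using (fromℚ; bounded; divide; √)

  Eventually : (ℕ → Set) → Set
  Eventually P = ∃[ N ] ∀ n → N ℕ.≤ n → P n

  always : ∀ {P} → (∀ n → P n) → Eventually P
  always p = 0 , λ n _ → p n

  both : ∀ {P Q R : ℕ → Set} → (∀ {n} → P n → Q n → R n) → Eventually P → Eventually Q → Eventually R
  both f (M , p) (N , q) = M ℕ.⊔ N , λ n ≤n → f (p n (ℕ.m⊔n≤o⇒m≤o M N ≤n)) (q n (ℕ.m⊔n≤o⇒n≤o M N ≤n))

  eventually : ∀ {P Q : ℕ → Set} → (∀ {n} → P n → Q n) → Eventually P → Eventually Q
  eventually f (M , p) = M , λ n ≤n → f (p n ≤n)

  -- Records, so that x and y can be inferred from x ≈ y.
  infix 4 _≈_

  record _≈_ (x y : ℝ) : Set where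
    constructor close
    field close⁻¹ : x Real.≈ y

  record NonNegative (x : ℝ) : Set where
    constructor nonNeg
    field nonNeg⁻¹ : ∀ ε → 0ℚ ℚ.< ε → Eventually λ n → 0ℚ ℚ.≤ seq x n ℚ.+ ε

  record Positive (x : ℝ) : Set where
    constructor pos
    field pos⁻¹ : Real.0# Real.< x

  open _≈_ public

  pointwise : ∀ {x y} → (∀ n → seq x n ≡ seq y n) → x ≈ y
  pointwise {x} {y} eq = close λ ε 0<ε → always {λ n → ℚ.∣ seq x n ℚ.- seq y n ∣ ℚ.< ε}
    λ n → subst (λ p → ℚ.∣ p ℚ.- seq y n ∣ ℚ.< ε) (sym (eq n)) (∣p-p∣<ε (seq y n) 0<ε)

  ∣p-q∣<ε⇒p<q+ε : ∀ {p q ε} → ℚ.∣ p ℚ.- q ∣ ℚ.< ε → p ℚ.< q ℚ.+ ε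
  ∣p-q∣<ε⇒p<q+ε {p} {q} {ε} h = subst₂ ℚ._<_ (solve 2 (λ p q → q :+ (p :- q) := p) refl p q) refl
    (ℚ.+-monoʳ-< q (ℚ.≤-<-trans (p≤∣p∣ (p ℚ.- q)) h))

  ≈-refl : ∀ {x} → x ≈ x
  ≈-refl = pointwise λ _ → refl

  ≈-sym : ∀ {x y} → x ≈ y → y ≈ x
  ≈-sym {x} {y} (close x≈y) = close λ ε 0<ε → eventually (λ {n} → subst (ℚ._< ε) (swap (seq x n) (seq y n)))
      (x≈y ε 0<ε)
    where
    swap : ∀ p q → ℚ.∣ p ℚ.- q ∣ ≡ ℚ.∣ q ℚ.- p ∣
    swap p q = trans (sym (ℚ.∣-p∣≡∣p∣ (p ℚ.- q))) (cong ℚ.∣_∣ (solve 2 (λ p q → :- (p :- q) := q :- p) refl p q))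

  ≈-trans : ∀ {x y z} → x ≈ y → y ≈ z → x ≈ z
  ≈-trans {x} {y} {z} (close x≈y) (close y≈z) = close λ ε 0<ε → both
    (λ {n} p q → subst (λ p → ℚ.∣ p ∣ ℚ.< ε)
      (solve 3 (λ a b c → (a :- b) :+ (b :- c) := a :- c) refl (seq x n) (seq y n) (seq z n))
      (∣+∣<ε (seq x n ℚ.- seq y n) (seq y n ℚ.- seq z n) p q))
    (x≈y _ (½-pos 0<ε)) (y≈z _ (½-pos 0<ε))

  fromℤ-+ : ∀ i j → fromℤ (i ℤ.+ j) ≡ fromℤ i ℚ.+ fromℤ j
  fromℤ-+ i j = sym (trans (/1≡fromℤ (i ℤ.* + 1 ℤ.+ j ℤ.* + 1))
    (cong fromℤ (cong₂ ℤ._+_ (ℤ.*-identityʳ i) (ℤ.*-identityʳ j))))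

  fromℤ-neg : ∀ i → fromℤ (ℤ.- i) ≡ ℚ.- fromℤ i
  fromℤ-neg (+ zero)  = refl
  fromℤ-neg (+ suc n) = refl
  fromℤ-neg -[1+ n ]  = refl

  0≤*0≤ : ∀ {p q} → 0ℚ ℚ.≤ p → 0ℚ ℚ.≤ q → 0ℚ ℚ.≤ p ℚ.* q
  0≤*0≤ 0≤p 0≤q = *-mono-≤ ℚ.≤-refl 0≤q 0≤p 0≤q

  0≤-sub : ∀ {p q} → p ℚ.≤ q → 0ℚ ℚ.≤ q ℚ.- p
  0≤-sub {p} {q} p≤q = subst (ℚ._≤ q ℚ.- p) (ℚ.+-inverseʳ p) (ℚ.+-monoˡ-≤ (ℚ.- p) p≤q)

  0≤-neg : ∀ {p} → p ℚ.≤ 0ℚ → 0ℚ ℚ.≤ ℚ.- p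
  0≤-neg = ℚ.neg-antimono-≤

  0≤square : ∀ p → 0ℚ ℚ.≤ p ℚ.* p
  0≤square p with ℚ.≤-total 0ℚ p
  ... | inj₁ 0≤p = 0≤*0≤ 0≤p 0≤p
  ... | inj₂ p≤0 = subst (0ℚ ℚ.≤_) (solve 1 (λ p → :- p :* :- p := p :* p) refl p) (0≤*0≤ (0≤-neg p≤0) (0≤-neg p≤0))

  ∣∣≤⇒≤ : ∀ {p K} → ℚ.∣ p ∣ ℚ.≤ K → p ℚ.≤ K
  ∣∣≤⇒≤ {p} h = ℚ.≤-trans (p≤∣p∣ p) h

  -- Approximants of nonnegative reals may be slightly negative. If one factor is nonnegative, its
  -- bound times the deficit of the other controls the product; two nonpositive factors have a
  -- nonnegative product.
  product-≥ : ∀ {x y K L δ γ ε} → 0ℚ ℚ.≤ δ → 0ℚ ℚ.≤ γ → 0ℚ ℚ.≤ ε → x ℚ.≤ K → y ℚ.≤ L → L ℚ.* δ ≡ ε → K ℚ.* γ ≡ ε →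
              0ℚ ℚ.≤ x ℚ.+ δ → 0ℚ ℚ.≤ y ℚ.+ γ → 0ℚ ℚ.≤ x ℚ.* y ℚ.+ ε
  product-≥ {x} {y} {K} {L} {δ} {γ} {ε} 0≤δ 0≤γ 0≤ε x≤K y≤L Lδ≡ Kγ≡ 0≤x+δ 0≤y+γ with ℚ.≤-total 0ℚ x | ℚ.≤-total 0ℚ y
  ... | _ | inj₁ 0≤y = subst (0ℚ ℚ.≤_) (trans
      (solve 4 (λ x y L δ → (x :+ δ) :* y :+ (L :- y) :* δ := x :* y :+ L :* δ) refl x y L δ)
          (cong (x ℚ.* y ℚ.+_) Lδ≡))
    (ℚ.+-mono-≤ (0≤*0≤ 0≤x+δ 0≤y) (0≤*0≤ (0≤-sub y≤L) 0≤δ))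
  ... | inj₁ 0≤x | inj₂ _ = subst (0ℚ ℚ.≤_)
      (trans (solve 4 (λ x y L δ → x :* (y :+ δ) :+ (L :- x) :* δ := x :* y :+ L :* δ) refl x y K γ)
          (cong (x ℚ.* y ℚ.+_) Kγ≡))
    (ℚ.+-mono-≤ (0≤*0≤ 0≤x 0≤y+γ) (0≤*0≤ (0≤-sub x≤K) 0≤γ))
  ... | inj₂ x≤0 | inj₂ y≤0 = ℚ.+-mono-≤ (subst (0ℚ ℚ.≤_) (solve 2 (λ x y → :- x :* :- y := x :* y) refl x y)
      (0≤*0≤ (0≤-neg x≤0) (0≤-neg y≤0))) 0≤ε

  √-sq-close : ∀ {r k V K δ ε} → 0ℚ ℚ.≤ k → k ℚ.≤ K → 0ℚ ℚ.< V → V ℚ.< 1ℚ → V ℚ.< δ → (K ℚ.+ K ℚ.+ 1ℚ) ℚ.* δ ≡ ε →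
               0ℚ ℚ.< ε → 0ℚ ℚ.≤ r ℚ.+ ½ ℚ.* ε → k ≡ 0ℚ ⊎ k ℚ.* k ℚ.≤ r → r ℚ.< (k ℚ.+ V) ℚ.* (k ℚ.+ V) → ℚ.∣
                   k ℚ.* k ℚ.- r ∣ ℚ.< ε
  √-sq-close {r} {k} {V} {K} {δ} {ε} 0≤k k≤K 0<V V<1 V<δ Kδ≡ 0<ε 0≤r+ k²≤ r< = ∣-∣<ε (upper k²≤) (begin-strict
    r                                          <⟨ r< ⟩
    (k ℚ.+ V) ℚ.* (k ℚ.+ V)                    ≡⟨ solve 2 (λ k V → (k :+ V) :* (k :+ V) :=
        k :* k :+ (k :+ k :+ V) :* V) refl k V ⟩
    k ℚ.* k ℚ.+ (k ℚ.+ k ℚ.+ V) ℚ.* V          ≤⟨ ℚ.+-monoʳ-≤ (k ℚ.* k)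
        (*-mono-≤ (ℚ.+-mono-≤ (ℚ.+-mono-≤ 0≤k 0≤k) (ℚ.<⇒≤ 0<V))
                                                   (ℚ.<⇒≤ (ℚ.<-trans 0<V V<δ)) (ℚ.+-mono-≤ (ℚ.+-mono-≤ k≤K k≤K)
                                                       (ℚ.<⇒≤ V<1)) (ℚ.<⇒≤ V<δ)) ⟩
    k ℚ.* k ℚ.+ (K ℚ.+ K ℚ.+ 1ℚ) ℚ.* δ         ≡⟨ cong (k ℚ.* k ℚ.+_) Kδ≡ ⟩
    k ℚ.* k ℚ.+ ε                              ∎)
    where
    open ℚ.≤-Reasoning
    upper : k ≡ 0ℚ ⊎ k ℚ.* k ℚ.≤ r → k ℚ.* k ℚ.< r ℚ.+ ε
    -- The approximate root is 0 when r is negative; r ≥ -ε/2 keeps 0 close enough to r.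
    upper (inj₁ refl) = begin-strict
      0ℚ ℚ.* 0ℚ                     ≡⟨ ℚ.*-zeroˡ 0ℚ ⟩
      0ℚ                            ≤⟨ 0≤r+ ⟩
      r ℚ.+ ½ ℚ.* ε                 ≡⟨ ℚ.+-identityʳ _ ⟨
      r ℚ.+ ½ ℚ.* ε ℚ.+ 0ℚ          <⟨ ℚ.+-monoʳ-< (r ℚ.+ ½ ℚ.* ε) (½-pos 0<ε) ⟩
      r ℚ.+ ½ ℚ.* ε ℚ.+ ½ ℚ.* ε     ≡⟨ trans (ℚ.+-assoc r _ _) (cong (r ℚ.+_) (½+½ ε)) ⟩
      r ℚ.+ ε                       ∎
    upper (inj₂ k²≤r) = ℚ.≤-<-trans k²≤r (subst (ℚ._< r ℚ.+ ε) (ℚ.+-identityʳ r) (ℚ.+-monoʳ-< r 0<ε))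

  -- If x < γ, then x y ≤ ε/2: through γ K for y ≥ 0, and through L δ for -δ ≤ y ≤ 0. This is the
  -- modulus for cancelling a nonnegative factor from a positive product.
  factor-≥ : ∀ {x y K L δ γ ε} → 0ℚ ℚ.≤ δ → ℚ.∣ x ∣ ℚ.≤ L → ℚ.∣ y ∣ ℚ.≤ K → K ℚ.* γ ≡ ½ ℚ.* ε →
      L ℚ.* δ ≡ ½ ℚ.* ε → 0ℚ ℚ.< ε →
             0ℚ ℚ.< γ → ε ℚ.≤ x ℚ.* y → 0ℚ ℚ.≤ y ℚ.+ δ → γ ℚ.≤ x
  factor-≥ {x} {y} {K} {L} {δ} {γ} {ε} 0≤δ x≤L y≤K Kγ≡ Lδ≡ 0<ε 0<γ ε≤xy 0≤y+δ = ℚ.≮⇒≥ λ x<γ → ℚ.<-irrefl refl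
      (begin-strict
    ε                    ≤⟨ ε≤xy ⟩
    x ℚ.* y              ≤⟨ xy≤ x<γ (ℚ.≤-total 0ℚ y) ⟩
    ½ ℚ.* ε              ≡⟨ ℚ.+-identityʳ _ ⟨
    ½ ℚ.* ε ℚ.+ 0ℚ       <⟨ ℚ.+-monoʳ-< (½ ℚ.* ε) (½-pos 0<ε) ⟩
    ½ ℚ.* ε ℚ.+ ½ ℚ.* ε  ≡⟨ ½+½ ε ⟩
    ε                    ∎)
    where
    open ℚ.≤-Reasoning
    xy≤ : x ℚ.< γ → 0ℚ ℚ.≤ y ⊎ y ℚ.≤ 0ℚ → x ℚ.* y ℚ.≤ ½ ℚ.* ε
    xy≤ x<γ (inj₁ 0≤y) = begin
      x ℚ.* y   ≤⟨ ℚ.*-monoʳ-≤-nonNeg y {{ℚ.nonNegative 0≤y}} (ℚ.<⇒≤ x<γ) ⟩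
      γ ℚ.* y   ≤⟨ ℚ.*-monoˡ-≤-nonNeg γ {{ℚ.nonNegative (ℚ.<⇒≤ 0<γ)}} (∣∣≤⇒≤ {y} y≤K) ⟩
      γ ℚ.* K   ≡⟨ trans (ℚ.*-comm γ K) Kγ≡ ⟩
      ½ ℚ.* ε   ∎
    xy≤ x<γ (inj₂ y≤0) = begin
      x ℚ.* y                  ≡⟨ solve 2 (λ x y → x :* y := :- x :* :- y) refl x y ⟩
      (ℚ.- x) ℚ.* (ℚ.- y)      ≤⟨ ℚ.*-monoʳ-≤-nonNeg (ℚ.- y) {{ℚ.nonNegative (0≤-neg y≤0)}}
          (∣∣≤⇒≤ {ℚ.- x} (subst (ℚ._≤ L) (sym (ℚ.∣-p∣≡∣p∣ x)) x≤L)) ⟩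
      L ℚ.* (ℚ.- y)            ≤⟨ ℚ.*-monoˡ-≤-nonNeg L {{ℚ.nonNegative (ℚ.≤-trans (ℚ.0≤∣p∣ x) x≤L)}}
                                    (subst₂ ℚ._≤_ (solve 1 (λ y → con 0ℚ :- y := :- y) refl y)
                                        (solve 2 (λ y δ → y :+ δ :- y := δ) refl y δ) (ℚ.+-monoˡ-≤ (ℚ.- y) 0≤y+δ)) ⟩
      L ℚ.* δ                  ≡⟨ Lδ≡ ⟩
      ½ ℚ.* ε                  ∎

  infixl 6 _+_
  infixl 7 _*_
  infix  8 -_

  -- Opaque, lest conversion checking compare the Cauchy proofs of unfolded reals.
  opaque

    _+_ _*_ : ℝ → ℝ → ℝ
    _+_ = Real._+_
    _*_ = Real._*_

    -_ : ℝ → ℝ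
    -_ = Real.-_

    rational : ℚ → ℝ
    rational = fromℚ

  0# 1# : ℝ
  0# = rational 0ℚ
  1# = rational 1ℚ

  rational-cong : ∀ {p q} → p ≡ q → rational p ≈ rational q
  rational-cong refl = ≈-refl

  opaque
    unfolding _+_ _*_ -_ rational

    +-≈ : ∀ x y → x + y ≈ x Real.+ y
    +-≈ x y = pointwise λ _ → refl

    neg-≈ : ∀ x → - x ≈ Real.- x
    neg-≈ x = pointwise λ _ → refl

    rational-≈ : ∀ p → rational p ≈ fromℚ p
    rational-≈ p = pointwise λ _ → refl

    *-+-≈ : ∀ a b c d → a * b + c * d ≈ a Real.* b Real.+ c Real.* d
    *-+-≈ a b c d = pointwise λ _ → refl

    *-+-neg-≈ : ∀ a b c d → a * b + - (c * d) ≈ a Real.* b Real.+ Real.- (c Real.* d)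
    *-+-neg-≈ a b c d = pointwise λ _ → refl

    rational-* : ∀ {p q r} → p ℚ.* q ≡ r → rational p * rational q ≈ rational r
    rational-* eq = pointwise λ _ → eq

    ι-+ : ∀ i j → rational (fromℤ (i ℤ.+ j)) ≈ rational (fromℤ i) + rational (fromℤ j)
    ι-+ i j = pointwise λ _ → fromℤ-+ i j

    ι-* : ∀ i j → rational (fromℤ (i ℤ.* j)) ≈ rational (fromℤ i) * rational (fromℤ j)
    ι-* i j = pointwise λ _ → fromℤ-* i j

    ι-neg : ∀ i → rational (fromℤ (ℤ.- i)) ≈ - rational (fromℤ i)
    ι-neg i = pointwise λ _ → fromℤ-neg i

    +-cong : Congruent₂ _≈_ _+_
    +-cong {x} {x′} {y} {y′} (close p) (close q) = close λ ε 0<ε → both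
      (λ {n} p q → subst (λ p → ℚ.∣ p ∣ ℚ.< ε)
        (solve 4 (λ a b c d → (a :- b) :+ (c :- d) := (a :+ c) :- (b :+ d)) refl (seq x n) (seq x′ n) (seq y n)
            (seq y′ n))
        (∣+∣<ε (seq x n ℚ.- seq x′ n) (seq y n ℚ.- seq y′ n) p q))
      (p _ (½-pos 0<ε)) (q _ (½-pos 0<ε))

    -‿cong : Congruent₁ _≈_ -_
    -‿cong {x} {y} (close p) = close λ ε 0<ε → eventually
      (λ {n} → subst (ℚ._< ε) (trans (sym (ℚ.∣-p∣≡∣p∣ (seq x n ℚ.- seq y n)))
        (cong ℚ.∣_∣ (solve 2 (λ a b → :- (a :- b) := :- a :- :- b) refl (seq x n) (seq y n))))) (p ε 0<ε)

    *-cong : Congruent₂ _≈_ _*_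
    *-cong {x} {x′} {y} {y′} (close p) (close q) = close λ ε 0<ε →
      let K , 0<K , x≤K = bounded x
          L , 0<L , y′≤L = bounded y′
          δ , 0<δ , Kδ≡ = divide K 0<K (½-pos 0<ε)
          γ , 0<γ , Lγ≡ = divide L 0<L (½-pos 0<ε)
      in both
        (λ {n} h k → subst (λ p → ℚ.∣ p ∣ ℚ.< ε)
          (solve 4 (λ a b c d → a :* (c :- d) :+ d :* (a :- b) := a :* c :- b :* d) refl (seq x n) (seq x′ n)
              (seq y n) (seq y′ n))
          (∣+∣<ε (seq x n ℚ.* (seq y n ℚ.- seq y′ n)) (seq y′ n ℚ.* (seq x n ℚ.- seq x′ n)) h k))
        (both (λ {n} b h → subst (_ ℚ.<_) Kδ≡ (∣*∣<ε (seq x n) (seq y n ℚ.- seq y′ n) 0<K b h)) x≤K (q δ 0<δ))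
        (both (λ {n} b h → subst (_ ℚ.<_) Lγ≡ (∣*∣<ε (seq y′ n) (seq x n ℚ.- seq x′ n) 0<L b h)) y′≤L (p γ 0<γ))

    +-assoc : ∀ x y z → (x + y) + z ≈ x + (y + z)
    +-assoc x y z = pointwise λ n → ℚ.+-assoc (seq x n) (seq y n) (seq z n)

    +-comm : ∀ x y → x + y ≈ y + x
    +-comm x y = pointwise λ n → ℚ.+-comm (seq x n) (seq y n)

    +-identityˡ : ∀ x → 0# + x ≈ x
    +-identityˡ x = pointwise λ n → ℚ.+-identityˡ (seq x n)

    +-identityʳ : ∀ x → x + 0# ≈ x
    +-identityʳ x = pointwise λ n → ℚ.+-identityʳ (seq x n)

    +-inverseˡ : ∀ x → - x + x ≈ 0#
    +-inverseˡ x = pointwise λ n → ℚ.+-inverseˡ (seq x n)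

    +-inverseʳ : ∀ x → x + - x ≈ 0#
    +-inverseʳ x = pointwise λ n → ℚ.+-inverseʳ (seq x n)

    *-assoc : ∀ x y z → (x * y) * z ≈ x * (y * z)
    *-assoc x y z = pointwise λ n → ℚ.*-assoc (seq x n) (seq y n) (seq z n)

    *-comm : ∀ x y → x * y ≈ y * x
    *-comm x y = pointwise λ n → ℚ.*-comm (seq x n) (seq y n)

    *-identityˡ : ∀ x → 1# * x ≈ x
    *-identityˡ x = pointwise λ n → ℚ.*-identityˡ (seq x n)

    *-identityʳ : ∀ x → x * 1# ≈ x
    *-identityʳ x = pointwise λ n → ℚ.*-identityʳ (seq x n)

    *-distribˡ-+ : ∀ x y z → x * (y + z) ≈ x * y + x * z
    *-distribˡ-+ x y z = pointwise λ n → ℚ.*-distribˡ-+ (seq x n) (seq y n) (seq z n)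

    *-distribʳ-+ : ∀ x y z → (y + z) * x ≈ y * x + z * x
    *-distribʳ-+ x y z = pointwise λ n → ℚ.*-distribʳ-+ (seq x n) (seq y n) (seq z n)

    nonNeg-resp : ∀ {x y} → x ≈ y → NonNegative x → NonNegative y
    nonNeg-resp {x} {y} (close x≈y) (nonNeg p) = nonNeg λ ε 0<ε → both
      (λ {n} 0≤ x< → ℚ.≤-trans 0≤ (ℚ.≤-trans (ℚ.+-monoˡ-≤ (½ ℚ.* ε) (ℚ.<⇒≤ (∣p-q∣<ε⇒p<q+ε {seq x n} x<)))
        (ℚ.≤-reflexive (trans (ℚ.+-assoc (seq y n) _ _) (cong (seq y n ℚ.+_) (½+½ ε))))))
      (p _ (½-pos 0<ε)) (x≈y _ (½-pos 0<ε))

    nonNeg-+ : ∀ {x y} → NonNegative x → NonNegative y → NonNegative (x + y)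
    nonNeg-+ {x} {y} (nonNeg p) (nonNeg q) = nonNeg λ ε 0<ε → both
      (λ {n} 0≤x 0≤y → ℚ.≤-trans (ℚ.+-mono-≤ 0≤x 0≤y) (ℚ.≤-reflexive (trans
        (solve 3 (λ a b h → (a :+ h) :+ (b :+ h) := (a :+ b) :+ (h :+ h)) refl (seq x n) (seq y n) (½ ℚ.* ε))
        (cong (seq x n ℚ.+ seq y n ℚ.+_) (½+½ ε)))))
      (p _ (½-pos 0<ε)) (q _ (½-pos 0<ε))

    nonNeg-* : ∀ {x y} → NonNegative x → NonNegative y → NonNegative (x * y)
    nonNeg-* {x} {y} (nonNeg p) (nonNeg q) = nonNeg λ ε 0<ε →
      let K , 0<K , x≤K = bounded x
          L , 0<L , y≤L = bounded y
          δ , 0<δ , Lδ≡ = divide L 0<L 0<ε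
          γ , 0<γ , Kγ≡ = divide K 0<K 0<ε
      in both (λ {n} (x≤K , 0≤x+δ) (y≤L , 0≤y+γ) → product-≥ {seq x n} {seq y n} {K} {L}
                (ℚ.<⇒≤ 0<δ) (ℚ.<⇒≤ 0<γ) (ℚ.<⇒≤ 0<ε) (∣∣≤⇒≤ {seq x n} x≤K) (∣∣≤⇒≤ {seq y n} y≤L) Lδ≡ Kγ≡ 0≤x+δ 0≤y+γ)
        (both _,_ x≤K (p δ 0<δ)) (both _,_ y≤L (q γ 0<γ))

    nonNeg-sq : ∀ x → NonNegative (x * x)
    nonNeg-sq x = nonNeg λ ε 0<ε → always {λ n → 0ℚ ℚ.≤ seq x n ℚ.* seq x n ℚ.+ ε} λ n → ℚ.+-mono-≤
        (0≤square (seq x n)) (ℚ.<⇒≤ 0<ε)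

    nonNeg-rational : ∀ {p} → 0ℚ ℚ.≤ p → NonNegative (rational p)
    nonNeg-rational {p} 0≤p = nonNeg λ ε 0<ε → always {λ _ → 0ℚ ℚ.≤ p ℚ.+ ε} λ _ → ℚ.+-mono-≤ 0≤p (ℚ.<⇒≤ 0<ε)

    pos-rational : ∀ {p} → 0ℚ ℚ.< p → Positive (rational p)
    pos-rational {p} 0<p = pos (p , 0<p , always {λ _ → 0ℚ ℚ.+ p ℚ.≤ p} λ _ → ℚ.≤-reflexive (ℚ.+-identityˡ p))

    pos-resp : ∀ {x y} → x ≈ y → Positive x → Positive y
    pos-resp {x} {y} (close x≈y) (pos (ε , 0<ε , p)) = pos (½ ℚ.* ε , ½-pos 0<ε , both
      (λ {n} ε≤ x< → ℚ.≤-trans (ℚ.≤-reflexive (trans (ℚ.+-identityˡ _) (trans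
          (solve 1 (λ h → h := (h :+ h) :- h) refl (½ ℚ.* ε)) (cong (ℚ._- (½ ℚ.* ε)) (½+½ ε)))))
        (ℚ.≤-trans (ℚ.+-monoˡ-≤ (ℚ.- (½ ℚ.* ε)) (ℚ.≤-trans (ℚ.≤-reflexive (sym (ℚ.+-identityˡ ε)))
          (ℚ.≤-trans ε≤ (ℚ.<⇒≤ (∣p-q∣<ε⇒p<q+ε {seq x n} x<)))))
        (ℚ.≤-reflexive (solve 2 (λ y h → y :+ h :- h := y) refl (seq y n) (½ ℚ.* ε)))))
      p (x≈y _ (½-pos 0<ε)))

    pos-+ : ∀ {x y} → Positive x → NonNegative y → Positive (x + y)
    pos-+ {x} {y} (pos (ε , 0<ε , p)) (nonNeg q) = pos (½ ℚ.* ε , ½-pos 0<ε , both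
      (λ {n} ε≤ 0≤ → ℚ.≤-trans (ℚ.≤-reflexive (trans (ℚ.+-identityˡ _) (trans
          (solve 1 (λ h → h := (h :+ h) :- h) refl (½ ℚ.* ε)) (trans (cong (ℚ._- (½ ℚ.* ε)) (½+½ ε))
            (solve 2 (λ ε h → ε :- h := (con 0ℚ :+ ε) :+ con 0ℚ :- h) refl ε (½ ℚ.* ε))))))
        (ℚ.≤-trans (ℚ.+-monoˡ-≤ (ℚ.- (½ ℚ.* ε)) (ℚ.+-mono-≤ ε≤ 0≤))
        (ℚ.≤-reflexive (solve 3 (λ x y h → x :+ (y :+ h) :- h := x :+ y) refl (seq x n) (seq y n) (½ ℚ.* ε)))))
      p (q _ (½-pos 0<ε)))

    pos-* : ∀ {x y} → Positive x → Positive y → Positive (x * y)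
    pos-* {x} {y} (pos (ε , 0<ε , p)) (pos (δ , 0<δ , q)) = pos (ε ℚ.* δ , 0<εδ , both
      (λ {n} ε≤ δ≤ → let ε≤′ = subst (ℚ._≤ seq x n) (ℚ.+-identityˡ ε) ε≤ ; δ≤′ = subst (ℚ._≤ seq y n) (ℚ.+-identityˡ δ) δ≤ in
        ℚ.≤-trans (ℚ.≤-reflexive (ℚ.+-identityˡ _))
          (*-mono-≤ (ℚ.<⇒≤ 0<ε) (ℚ.≤-trans (ℚ.<⇒≤ 0<δ) δ≤′) ε≤′ δ≤′)) p q)
      where
      0<εδ : 0ℚ ℚ.< ε ℚ.* δ
      0<εδ = subst (ℚ._< ε ℚ.* δ) (ℚ.*-zeroʳ ε) (ℚ.*-monoʳ-<-pos ε {{ℚ.positive 0<ε}} 0<δ)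

    pos⇒nonNeg : ∀ {x} → Positive x → NonNegative x
    pos⇒nonNeg {x} (pos (δ , 0<δ , p)) = nonNeg λ ε 0<ε → eventually
      (λ {n} δ≤ → ℚ.+-mono-≤ (ℚ.≤-trans (ℚ.<⇒≤ 0<δ) (subst (ℚ._≤ seq x n) (ℚ.+-identityˡ δ) δ≤)) (ℚ.<⇒≤ 0<ε)) p

    pos-irrefl : ¬ Positive 0#
    pos-irrefl (pos (ε , 0<ε , N , p)) = ℚ.<-irrefl refl
        (ℚ.<-≤-trans 0<ε (subst (ℚ._≤ 0ℚ) (ℚ.+-identityˡ ε) (p N ℕ.≤-refl)))

    1/suc-cancel : ∀ k x → rational (1/suc k) * (rational (fromℤ (+ suc k)) * x) ≈ x
    1/suc-cancel k x = pointwise λ n →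
      trans (solve 3 (λ a b x → a :* (b :* x) := b :* a :* x) refl (1/suc k) (fromℤ (+ suc k)) (seq x n))
        (trans (cong (ℚ._* seq x n) (1/suc-inverse k)) (ℚ.*-identityˡ (seq x n)))

    √-nonNeg : ∀ x → NonNegative (√ x)
    √-nonNeg x = nonNeg λ ε 0<ε → always {λ n → 0ℚ ℚ.≤ seq (√ x) n ℚ.+ ε} λ n → ℚ.+-mono-≤ (0≤√≈ (seq x n) n)
        (ℚ.<⇒≤ 0<ε)

    √-sq : ∀ {x} → NonNegative x → √ x * √ x ≈ x
    √-sq {x} (nonNeg 0≤x) = close λ ε 0<ε →
      let K , 0<K , k≤K = bounded (√ x)
          δ , 0<δ , Kδ≡ = divide (K ℚ.+ K ℚ.+ 1ℚ) (ℚ.+-mono-< (ℚ.+-mono-< 0<K 0<K) (ℚ.positive⁻¹ 1ℚ)) 0<ε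
      in both (λ {n} (k≤K , V<δ) (0≤r+ , V<1) → √-sq-close (0≤√≈ (seq x n) n) (∣∣≤⇒≤ {seq (√ x) n} k≤K)
          (0<1/suc n) V<1 V<δ Kδ≡ 0<ε 0≤r+
                 (√≈²≤ (seq x n) n) (<√≈² (seq x n) n))
        (both _,_ k≤K (archimedean δ 0<δ)) (both _,_ (0≤x _ (½-pos 0<ε)) (archimedean 1ℚ (ℚ.positive⁻¹ 1ℚ)))

    pos-cancel : ∀ {x y} → Positive (x * y) → NonNegative y → Positive x
    pos-cancel {x} {y} (pos (ε , 0<ε , p)) (nonNeg 0≤y) =
      let K , 0<K , y≤K = bounded y
          L , 0<L , x≤L = bounded x
          γ , 0<γ , Kγ≡ = divide K 0<K (½-pos 0<ε)
          δ , 0<δ , Lδ≡ = divide L 0<L (½-pos 0<ε)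
      in pos (γ , 0<γ , both (λ {n} (x≤L , y≤K) (ε≤ , 0≤y+δ) → subst (ℚ._≤ seq x n) (sym (ℚ.+-identityˡ γ))
           (factor-≥ {seq x n} {seq y n} {K} {L} (ℚ.<⇒≤ 0<δ) x≤L y≤K Kγ≡ Lδ≡ 0<ε 0<γ
               (subst (ℚ._≤ seq x n ℚ.* seq y n) (ℚ.+-identityˡ ε) ε≤) 0≤y+δ))
           (both _,_ x≤L y≤K) (both _,_ p (0≤y δ 0<δ)))

    positive-difference⇒< : ∀ {x y} → Positive (y + - x) → x Real.< y
    positive-difference⇒< {x} {y} (pos (ε , 0<ε , p)) = ε , 0<ε , eventually (λ {n} h → subst₂ ℚ._≤_
      (trans (cong (ℚ._+ seq x n) (ℚ.+-identityˡ ε)) (ℚ.+-comm ε (seq x n)))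
      (solve 2 (λ x y → y :- x :+ x := y) refl (seq x n) (seq y n))
      (ℚ.+-monoˡ-≤ (seq x n) h)) p

    <⇒positive-difference : ∀ {x y} → x Real.< y → Positive (y + - x)
    <⇒positive-difference {x} {y} (ε , 0<ε , p) = pos (ε , 0<ε , eventually (λ {n} h →
      subst (ℚ._≤ seq y n ℚ.- seq x n) (solve 2 (λ x ε → x :+ ε :- x := con 0ℚ :+ ε) refl (seq x n) ε)
          (ℚ.+-monoˡ-≤ (ℚ.- seq x n) h)) p)

  +-isAbelianGroup : IsAbelianGroup _≈_ _+_ 0# -_
  +-isAbelianGroup = record
    { isGroup = record
      { isMonoid = record
        { isSemigroup = record
          { isMagma = record
            { isEquivalence = record
              { refl = λ {x} → ≈-refl {x} ; sym = λ {x} {y} → ≈-sym {x} {y} ; trans = λ {x} {y} {z} → ≈-trans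
                  {x} {y} {z} }
            ; ∙-cong = +-cong }
          ; assoc = +-assoc }
        ; identity = +-identityˡ , +-identityʳ }
      ; inverse = +-inverseˡ , +-inverseʳ
      ; ⁻¹-cong = -‿cong }
    ; comm = +-comm }

  isRing : IsRing _≈_ _+_ _*_ -_ 0# 1#
  isRing = record
    { +-isAbelianGroup = +-isAbelianGroup ; *-cong = *-cong ; *-assoc = *-assoc
    ; *-identity = *-identityˡ , *-identityʳ ; distrib = *-distribˡ-+ , *-distribʳ-+ }

  isCommutativeRing : IsCommutativeRing _≈_ _+_ _*_ -_ 0# 1#
  isCommutativeRing = record { isRing = isRing ; *-comm = *-comm }

  commutativeRing : CommutativeRing 0ℓ 0ℓ
  commutativeRing = record
    { Carrier = ℝ ; _≈_ = _≈_ ; _+_ = _+_ ; _*_ = _*_ ; -_ = -_ ; 0# = 0# ; 1# = 1#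
    ; isCommutativeRing = isCommutativeRing }

  orderedRing : OrderedRing
  orderedRing = record
    { commutativeRing = commutativeRing
    ; ι = λ i → rational (fromℤ i)
    ; ι-+ = ι-+
    ; ι-* = ι-*
    ; ι-neg = ι-neg
    ; ι-0 = ≈-refl
    ; ι-1 = ≈-refl
    ; NonNegative = NonNegative
    ; Positive = Positive
    ; nonNeg-resp = λ {x} {y} → nonNeg-resp {x} {y}
    ; nonNeg-+ = λ {x} {y} → nonNeg-+ {x} {y}
    ; nonNeg-* = λ {x} {y} → nonNeg-* {x} {y}
    ; nonNeg-sq = nonNeg-sq
    ; nonNeg-ι = λ 0≤i → nonNeg-rational (fromℤ-mono-≤ 0≤i)
    ; nonNeg-scale = λ k {x} p → nonNeg-resp {rational (1/suc k) * (rational (fromℤ (+ suc k)) * x)} {x}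
        (1/suc-cancel k x)
        (nonNeg-* {rational (1/suc k)} {rational (fromℤ (+ suc k)) * x} (nonNeg-rational (ℚ.<⇒≤ (0<1/suc k))) p)
    ; pos-resp = λ {x} {y} → pos-resp {x} {y}
    ; pos-+ = λ {x} {y} → pos-+ {x} {y}
    ; pos-* = λ {x} {y} → pos-* {x} {y}
    ; pos-ι = λ {i} 0<i → pos-rational (ℚ.*<* (ℤ.*-monoʳ-<-pos (+ 1) 0<i))
    ; pos-scale = λ k {x} p → pos-resp {rational (1/suc k) * (rational (fromℤ (+ suc k)) * x)} {x} (1/suc-cancel k x)
        (pos-* {rational (1/suc k)} {rational (fromℤ (+ suc k)) * x} (pos-rational (0<1/suc k)) p)
    ; pos⇒nonNeg = λ {x} → pos⇒nonNeg {x}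
    ; pos-irrefl = pos-irrefl
    }

  -- The factor √ y - √ x is cancelled out of (√ y - √ x) (√ y + √ x) = y - x, where the other
  -- factor is known only to be nonnegative.
  √-mono-< : ∀ {x y} → NonNegative x → NonNegative y → Positive (y + - x) → √ x Real.< √ y
  √-mono-< {x} {y} 0≤x 0≤y h = positive-difference⇒< {√ x} {√ y} (pos-cancel {√ y + - (√ x)} {√ y + √ x}
    (Geometry.difference-of-squares orderedRing {x} {y} {√ x} {√ y} (√-sq 0≤x) (√-sq 0≤y) h)
    (nonNeg-+ {√ y} {√ x} (√-nonNeg y) (√-nonNeg x)))

-- The plane in the basis 1, ζ

module SquareRootOfThree (O : OrderedRing) where

  open OrderedRing O
  open OrderedRingSolver O
  open Geometry O

  √3-inverse : ∀ {s t} → s * s ≈ # 3 → # 3 * t ≈ # 1 → s * (s * t) ≈ # 1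
  √3-inverse {s} {t} s²≈3 3t≈1 = modulo t s²≈3 (modulo (# 1) 3t≈1 (solve 2 (λ s t →
    s :* (s :* t) := con (+ 1) :+ t :* (s :* s :+ :- con (+ 3)) :+ con (+ 1) :*
        (con (+ 3) :* t :+ :- con (+ 1))) refl s t))

  √3-inverse-sq : ∀ {s t} → s * s ≈ # 3 → # 3 * t ≈ # 1 → # 3 * ((s * t) * (s * t)) ≈ # 1
  √3-inverse-sq {s} {t} s²≈3 3t≈1 = trans
    (solve 2 (λ s t → con (+ 3) :* ((s :* t) :* (s :* t)) := (con (+ 3) :* t) :* (s :* (s :* t))) refl s t)
    (trans (*-cong 3t≈1 (√3-inverse s²≈3 3t≈1)) (solve 0 (con (+ 1) :* con (+ 1) := con (+ 1)) refl))

-- Here s, σ and h stand for √3, 1/√3 and 1/2.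
module Coordinates (O : OrderedRing) (s σ h : OrderedRing.Carrier O)
  (3σ²≈1 : OrderedRing._≈_ O (OrderedRing._*_ O (OrderedRing.ι O (+ 3)) (OrderedRing._*_ O σ σ))
      (OrderedRing.ι O (+ 1)))
  (sσ≈1 : OrderedRing._≈_ O (OrderedRing._*_ O s σ) (OrderedRing.ι O (+ 1)))
  (2h≈1 : OrderedRing._≈_ O (OrderedRing._*_ O (OrderedRing.ι O (+ 2)) h) (OrderedRing.ι O (+ 1))) where

  open OrderedRing O
  open OrderedRingSolver O
  open Geometry O

  -- Solving x + i y = a + b ζ with ζ = (1 + i √3) / 2 gives b = 2 y σ and a = x - y σ.
  toE : Carrier → Carrier → E
  toE x y = x + - (y * σ) , y * σ + y * σ

  toE-cong : ∀ {x x′ y y′} → x ≈ x′ → y ≈ y′ → toE x y ≋ toE x′ y′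
  toE-cong p q = +-cong p (-‿cong (*-cong q refl)) , +-cong (*-cong q refl) (*-cong q refl)

  toE-+ : ∀ x y x′ y′ → toE (x + x′) (y + y′) ≋ toE x y ⊕ toE x′ y′
  toE-+ x y x′ y′ =
    solve 5 (λ x y x′ y′ σ → (x :+ x′) :+ :- ((y :+ y′) :* σ) := (x :+ :- (y :* σ)) :+ (x′ :+ :- (y′ :* σ)))
        refl x y x′ y′ σ ,
    solve 3 (λ y y′ σ → (y :+ y′) :* σ :+ (y :+ y′) :* σ := (y :* σ :+ y :* σ) :+ (y′ :* σ :+ y′ :* σ)) refl y y′ σ

  toE-neg : ∀ x y → toE (- x) (- y) ≋ neg (toE x y)
  toE-neg x y =
    solve 3 (λ x y σ → :- x :+ :- (:- y :* σ) := :- (x :+ :- (y :* σ))) refl x y σ ,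
    solve 2 (λ y σ → :- y :* σ :+ :- y :* σ := :- (y :* σ :+ y :* σ)) refl y σ

  toE-conj : ∀ x y → toE x (- y) ≋ conj (toE x y)
  toE-conj x y =
    solve 3 (λ x y σ → x :+ :- (:- y :* σ) := (x :+ :- (y :* σ)) :+ (y :* σ :+ y :* σ)) refl x y σ ,
    solve 2 (λ y σ → :- y :* σ :+ :- y :* σ := :- (y :* σ :+ y :* σ)) refl y σ

  toE-* : ∀ x y x′ y′ → toE (x * x′ + - (y * y′)) (x * y′ + y * x′) ≋ toE x y ⊗ toE x′ y′
  toE-* x y x′ y′ =
    modulo (y * y′) 3σ²≈1 (solve 5 (λ x y x′ y′ σ → let z = (x :+ :- (y :* σ) , y :* σ :+ y :* σ) ; z′ = (x′ :+ :- (y′ :* σ) , y′ :* σ :+ y′ :* σ) in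
      (x :* x′ :+ :- (y :* y′)) :+ :- ((x :* y′ :+ y :* x′) :* σ)
      := proj₁ (z P.⊗ z′) :+ y :* y′ :* (con (+ 3) :* (σ :* σ) :+ :- con (+ 1))) refl x y x′ y′ σ) ,
    solve 5 (λ x y x′ y′ σ → let z = (x :+ :- (y :* σ) , y :* σ :+ y :* σ) ; z′ = (x′ :+ :- (y′ :* σ) , y′ :* σ :+ y′ :* σ) in
      (x :* y′ :+ y :* x′) :* σ :+ (x :* y′ :+ y :* x′) :* σ := proj₂ (z P.⊗ z′)) refl x y x′ y′ σ

  toE-N : ∀ x y → N (toE x y) ≈ x * x + y * y
  toE-N x y = modulo (y * y) 3σ²≈1 (solve 3 (λ x y σ →
    P.N (x :+ :- (y :* σ) , y :* σ :+ y :* σ) := x :* x :+ y :* y :+ y :* y :*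
        (con (+ 3) :* (σ :* σ) :+ :- con (+ 1))) refl x y σ)

  toE-real : ∀ x → toE x 0# ≋ (x , 0#)
  toE-real x = ≋-trans (toE-cong refl (sym ι-0)) (≋-trans
    (solve 2 (λ x σ → x :+ :- (con (+ 0) :* σ) := x) refl x σ ,
        solve 1 (λ σ → con (+ 0) :* σ :+ con (+ 0) :* σ := con (+ 0)) refl σ)
    (refl , ι-0))

  real-⊗ : ∀ t z → (t , 0#) ⊗ z ≋ (t * proj₁ z , t * proj₂ z)
  real-⊗ t z@(a , b) = ≋-trans (⊗-cong {x′ = t , ι (+ 0)} {y = z} (refl , sym ι-0) ≋-refl)
    (solve 3 (λ t a b → t :* a :+ :- (con (+ 0) :* b) := t :* a) refl t a b ,
     solve 3 (λ t a b → t :* b :+ con (+ 0) :* a :+ con (+ 0) :* b := t :* b) refl t a b)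

  toE-√-3 : toE 0# s ≋ ιE EisensteinIntegers.θ
  toE-√-3 = ≋-trans (toE-cong (sym ι-0) refl)
    (modulo (- # 1) sσ≈1 (solve 2 (λ s σ → con (+ 0) :+ :- (s :* σ) := con -[1+ 0 ] :+ :- con (+ 1) :*
        (s :* σ :+ :- con (+ 1))) refl s σ) ,
     modulo (# 2) sσ≈1 (solve 2 (λ s σ → s :* σ :+ s :* σ := con (+ 2) :+ con (+ 2) :* (s :* σ :+ :- con (+ 1)))
         refl s σ))

  halve : ∀ {z} j k → z ≋ ιE (+ 2 ℤ.* j , + 2 ℤ.* k) → (h , 0#) ⊗ z ≋ ιE (j , k)
  halve {z} j k (p , q) = ≋-trans (real-⊗ h z) (half j p , half k q)
    where
    half : ∀ {x} j → x ≈ ι (+ 2 ℤ.* j) → h * x ≈ ι j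
    half j p = trans (*-cong refl (trans p (ι-* (+ 2) j)))
      (modulo (ι j) 2h≈1 (solve 2 (λ h j → h :* (con (+ 2) :* j) := j :+ j :* (con (+ 2) :* h :+ :- con (+ 1)))
          refl h (ι j)))

  inverse-unique : ∀ {z u v} → z ⊗ u ≋ 𝟙 → z ⊗ v ≋ 𝟙 → u ≋ v
  inverse-unique {z@(a , b)} {u@(c , d)} {v@(e , f)} zu≋1 zv≋1 = ≋-trans (≋-sym (one-⊗ u)) (≋-trans
    (⊗-cong (≋-sym zv≋1) ≋-refl) (≋-trans swap (≋-trans (⊗-cong zu≋1 ≋-refl) (one-⊗ v))))
    where
    one-⊗ : ∀ z → 𝟙 ⊗ z ≋ z
    one-⊗ (a , b) = ≋-trans (real-⊗ 1# (a , b)) (*-identityˡ a , *-identityˡ b)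
    swap : (z ⊗ v) ⊗ u ≋ (z ⊗ u) ⊗ v
    swap = solve 6 (λ a b c d e f → proj₁ (((a , b) P.⊗ (e , f)) P.⊗ (c , d)) :=
        proj₁ (((a , b) P.⊗ (c , d)) P.⊗ (e , f))) refl a b c d e f ,
           solve 6 (λ a b c d e f → proj₂ (((a , b) P.⊗ (e , f)) P.⊗ (c , d)) :=
               proj₂ (((a , b) P.⊗ (c , d)) P.⊗ (e , f))) refl a b c d e f

  zero-not-invertible : ∀ {z u} → z ≋ (0# , 0#) → ¬ z ⊗ u ≋ 𝟙
  zero-not-invertible {z} {u} z≋0 zu≋1 = pos-irrefl (pos-resp (trans (sym (inv-N zu≋1))
    (trans (*-cong refl (trans (N-cong (≋-trans z≋0 (sym ι-0 , sym ι-0)))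
        (solve 0 (P.N (con (+ 0) , con (+ 0)) := con (+ 0)) refl)))
    (trans (*-cong refl ι-0) (zeroʳ (N u))))) (pos-ι {+ 1} (ℤ.+<+ ℕ.z<s)))

-- Transfer of complex numbers to Eisenstein coordinates

module ComplexCoordinates where

  open Auxiliary using (1/suc; 1/suc-inverse; /1≡fromℤ)
  open RealOrder
  open OrderedRing orderedRing using (ι)
  open Geometry orderedRing
  module I = EisensteinIntegers

  √3 ⅓ : ℝ
  √3 = Real.√ (Real.fromℚ (+ 3 ℚ./ 1))
  ⅓  = rational (1/suc 2)

  √3² : √3 * √3 ≈ ι (+ 3)
  √3² = ≈-trans (√-sq (nonNeg-resp (rational-≈ (+ 3 ℚ./ 1)) (nonNeg-rational (ℚ.nonNegative⁻¹ (+ 3 ℚ./ 1)))))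
    (≈-sym (rational-≈ (+ 3 ℚ./ 1)))

  3⅓≈1 : ι (+ 3) * ⅓ ≈ ι (+ 1)
  3⅓≈1 = rational-* (1/suc-inverse 2)

  2½≈1 : ι (+ 2) * rational ½ ≈ ι (+ 1)
  2½≈1 = rational-* (1/suc-inverse 1)

  open SquareRootOfThree orderedRing
  open Coordinates orderedRing √3 (√3 * ⅓) (rational ½) (√3-inverse-sq √3² 3⅓≈1) (√3-inverse √3² 3⅓≈1) 2½≈1

  opaque

    ψ : ℂ → E
    ψ z = toE (re z) (im z)

    ψ-cong : ∀ {z w} → z Complex.≈ w → ψ z ≋ ψ w
    ψ-cong (p , q) = toE-cong (close p) (close q)

    ψ-+ : ∀ z w → ψ (z Complex.+ w) ≋ ψ z ⊕ ψ w
    ψ-+ z w = ≋-trans (toE-cong (≈-sym (+-≈ (re z) (re w))) (≈-sym (+-≈ (im z) (im w))))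
        (toE-+ (re z) (im z) (re w) (im w))

    ψ-neg : ∀ z → ψ (Complex.- z) ≋ neg (ψ z)
    ψ-neg z = ≋-trans (toE-cong (≈-sym (neg-≈ (re z))) (≈-sym (neg-≈ (im z)))) (toE-neg (re z) (im z))

    ψ-conj : ∀ z → ψ (Complex.conj z) ≋ conj (ψ z)
    ψ-conj z = ≋-trans (toE-cong ≈-refl (≈-sym (neg-≈ (im z)))) (toE-conj (re z) (im z))

    ψ-* : ∀ z w → ψ (z Complex.* w) ≋ ψ z ⊗ ψ w
    ψ-* z w = ≋-trans (toE-cong (≈-sym (*-+-neg-≈ (re z) (re w) (im z) (im w)))
        (≈-sym (*-+-≈ (re z) (im w) (im z) (re w))))
      (toE-* (re z) (im z) (re w) (im w))

    ψ-fromℝ : ∀ x → ψ (Complex.fromℝ x) ≋ (x , 0#)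
    ψ-fromℝ x = ≋-trans (toE-cong ≈-refl (≈-sym (rational-≈ 0ℚ))) (toE-real x)

    ψ-N : ∀ z → N (ψ z) ≈ re z Real.* re z Real.+ im z Real.* im z
    ψ-N z = ≈-trans (toE-N (re z) (im z)) (*-+-≈ (re z) (re z) (im z) (im z))

    ψ-√-3 : ψ √-3 ≋ ιE I.θ
    ψ-√-3 = ≋-trans (toE-cong (≈-sym (rational-≈ 0ℚ)) ≈-refl) toE-√-3

  ψ-· : ∀ t z → ψ (t Complex.· z) ≋ (t * proj₁ (ψ z) , t * proj₂ (ψ z))
  ψ-· t z = ≋-trans (ψ-* (Complex.fromℝ t) z) (≋-trans (⊗-cong (ψ-fromℝ t) ≋-refl) (real-⊗ t (ψ z)))

  ψ-fromℤ : ∀ m → ψ (Complex.fromℤ m) ≋ ιE (m , + 0)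
  ψ-fromℤ m = ≋-trans (ψ-fromℝ _) (≈-trans (≈-sym (rational-≈ _)) (rational-cong (/1≡fromℤ m)) , ≈-refl)

  ψ-0 : ψ Complex.0# ≋ (0# , 0#)
  ψ-0 = ≋-trans (ψ-fromℝ Real.0#) (≈-sym (rational-≈ 0ℚ) , ≈-refl)

  ψ-1 : ψ Complex.1# ≋ 𝟙
  ψ-1 = ≋-trans (ψ-fromℝ Real.1#) (≈-sym (rational-≈ 1ℚ) , ≈-refl)

  ψ-half : ∀ z j k → ψ z ≋ ιE (+ 2 ℤ.* j , + 2 ℤ.* k) → ψ (Real.fromℚ ½ Complex.· z) ≋ ιE (j , k)
  ψ-half z j k z≋ = ≋-trans (ψ-* (Complex.fromℝ (Real.fromℚ ½)) z) (≋-trans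
    (⊗-cong (≋-trans (ψ-fromℝ (Real.fromℚ ½)) (≈-sym (rational-≈ ½) , ≈-refl)) ≋-refl) (halve j k z≋))

  ψ-ζ : ψ ζ ≋ ιE I.ζᶻ
  ψ-ζ = ψ-half (Complex.1# Complex.+ √-3) (+ 0) (+ 1)
    (≋-trans (ψ-+ Complex.1# √-3) (≋-trans (⊕-cong ψ-1 ψ-√-3) (≋-sym (ι-⊕ Z.𝟙 I.θ))))

  ψ-η : ψ η ≋ ιE (+ 1 , + 1)
  ψ-η = ψ-half (Complex.fromℤ (+ 3) Complex.+ √-3) (+ 1) (+ 1)
    (≋-trans (ψ-+ (Complex.fromℤ (+ 3)) √-3) (≋-trans (⊕-cong (ψ-fromℤ (+ 3)) ψ-√-3) (≋-sym (ι-⊕ (+ 3 , + 0) I.θ))))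

  ψ-sub : ∀ z w → ψ (z Complex.- w) ≋ ψ z ⊖ ψ w
  ψ-sub z w = ≋-trans (ψ-+ z (Complex.- w)) (⊕-cong ≋-refl (ψ-neg w))

  ψ-next : ∀ {b q p} c {Q P} → ψ b ≋ ιE (I.θ Z.⊗ c) → ψ q ≋ ιE Q → ψ p ≋ ιE P → ψ (b Complex.* q Complex.+ p) ≋
      ιE (I.next c P Q)
  ψ-next {b} {q} {p} c {Q} {P} b≋ q≋ p≋ = ≋-trans (ψ-+ (b Complex.* q) p) (≋-trans
    (⊕-cong (≋-trans (ψ-* b q) (≋-trans (⊗-cong b≋ q≋) (≋-sym (ι-⊗ (I.θ Z.⊗ c) Q)))) p≋)
    (≋-sym (ι-⊕ (I.θ Z.⊗ c Z.⊗ Q) P)))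

-- The lattice, the prescribed digits and U in coordinates

module Points where

  open RealOrder
  open OrderedRing orderedRing using (ι)
  open Geometry orderedRing
  open Dynamics orderedRing
  open Location orderedRing
  open ComplexCoordinates
  open Directions using (IsFace; hexagon-face; side₁-face; side₂-face; side₃-face)

  -- As η = √-3 · conj ζ, the lattice is √-3 times the Eisenstein integers, and c is conj ζ times
  -- the given coefficient.
  𝒥⇒D : ∀ {a} → a ∈ 𝒥 → ∃[ c ] ψ a ≋ ιD c
  𝒥⇒D {a} (x , (m , n , x≈) , a≈) = I.ζ̄ᶻ Z.⊗ v , ≋-trans (ψ-cong {a} {η Complex.* x} a≈) (≋-trans (ψ-* η x)
    (≋-trans (⊗-cong ψ-η (≋-trans (ψ-cong {x} {Complex.fromℤ m Complex.+ Complex.fromℤ n Complex.* ζ} x≈) ψ-v))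
        (≋-trans (≋-sym (ι-⊗ (+ 1 , + 1) v)) (ι-cong (Directions.D-ζ̄ v)))))
    where
    v = (m , + 0) Z.⊕ (n , + 0) Z.⊗ I.ζᶻ
    ψ-v : ψ (Complex.fromℤ m Complex.+ Complex.fromℤ n Complex.* ζ) ≋ ιE v
    ψ-v = ≋-trans (ψ-+ (Complex.fromℤ m) (Complex.fromℤ n Complex.* ζ)) (≋-trans
      (⊕-cong (ψ-fromℤ m) (≋-trans (ψ-* (Complex.fromℤ n) ζ)
          (≋-trans (⊗-cong (ψ-fromℤ n) ψ-ζ) (≋-sym (ι-⊗ (n , + 0) I.ζᶻ)))))
      (≋-sym (ι-⊕ (m , + 0) ((n , + 0) Z.⊗ I.ζᶻ))))

  exceptionalPoint : ExceptionalPoint → Z.E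
  exceptionalPoint ⟨-ζ⟩ = Z.neg I.ζᶻ
  exceptionalPoint ⟨ζ̄⟩  = I.ζ̄ᶻ

  exceptionalPoint∈ : ∀ ξ → exceptionalPoint ξ ∈ˡ Directions.exceptionals
  exceptionalPoint∈ ⟨-ζ⟩ = here ≡.refl
  exceptionalPoint∈ ⟨ζ̄⟩  = there (here ≡.refl)

  ψ-conj-ζ : ψ (Complex.conj ζ) ≋ ιE I.ζ̄ᶻ
  ψ-conj-ζ = ≋-trans (ψ-conj ζ) (≋-trans (conj-cong ψ-ζ) (≋-sym (ι-conj I.ζᶻ)))

  ψ-neg-ι : ∀ z v → ψ z ≋ ιE v → ψ (Complex.- z) ≋ ιE (Z.neg v)
  ψ-neg-ι z v z≋ = ≋-trans (ψ-neg z) (≋-trans (neg-cong z≋) (≋-sym (ι-negE v)))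

  ψ-point : ∀ ξ → ψ (point ξ) ≋ ιE (exceptionalPoint ξ)
  ψ-point ⟨-ζ⟩ = ψ-neg-ι ζ I.ζᶻ ψ-ζ
  ψ-point ⟨ζ̄⟩  = ψ-conj-ζ

  isExceptional : ∀ {z} → Exceptional z → IsExceptional (ψ z)
  isExceptional {z} (ξ , z≈) = exceptionalPoint ξ , exceptionalPoint∈ ξ , ≋-trans (ψ-cong {z} {point ξ} z≈)
      (ψ-point ξ)

  exceptionalGenerator : ExceptionalPoint → Z.E
  exceptionalGenerator ⟨-ζ⟩ = I.ζᶻ
  exceptionalGenerator ⟨ζ̄⟩  = I.ζ̄ᶻ

  ψ-neg-conj-η : ψ (Complex.- Complex.conj η) ≋ ιE (Z.neg (Z.conj (+ 1 , + 1)))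
  ψ-neg-conj-η = ψ-neg-ι (Complex.conj η) (Z.conj (+ 1 , + 1))
      (≋-trans (ψ-conj η) (≋-trans (conj-cong ψ-η) (≋-sym (ι-conj (+ 1 , + 1)))))

  ψ-exceptionalQuotient : ∀ ξ k → ψ (exceptionalQuotient ξ k) ≋ ιD
      (Directions.exceptionalDigit (exceptionalGenerator ξ) k)
  ψ-exceptionalQuotient ⟨-ζ⟩ 0 = ψ-√-3
  ψ-exceptionalQuotient ⟨ζ̄⟩  0 = ψ-√-3
  ψ-exceptionalQuotient ⟨-ζ⟩ 1 = ψ-√-3
  ψ-exceptionalQuotient ⟨ζ̄⟩  1 = ψ-√-3
  ψ-exceptionalQuotient ⟨-ζ⟩ 2 = ψ-neg-conj-η
  ψ-exceptionalQuotient ⟨ζ̄⟩  2 = ψ-η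
  ψ-exceptionalQuotient ⟨-ζ⟩ 3 = ψ-η
  ψ-exceptionalQuotient ⟨ζ̄⟩  3 = ψ-neg-conj-η
  ψ-exceptionalQuotient ⟨-ζ⟩ (suc (suc (suc (suc k)))) = ψ-exceptionalQuotient ⟨-ζ⟩ k
  ψ-exceptionalQuotient ⟨ζ̄⟩  (suc (suc (suc (suc k)))) = ψ-exceptionalQuotient ⟨ζ̄⟩ k

  power : ℕ → Z.E
  power zero    = Z.𝟙
  power (suc n) = I.ζᶻ Z.⊗ power n

  open RawMonoidDefinitions (RawSemiring.*-rawMonoid Complex.rawSemiring) using () renaming (_×_ to _×ᴹ_)

  ψ-power : ∀ n → ψ (n ×ᴹ ζ) ≋ ιE (power n)
  ψ-power zero    = ψ-1
  ψ-power (suc n) = ≋-trans (ψ-* ζ (n ×ᴹ ζ)) (≋-trans (⊗-cong ψ-ζ (ψ-power n)) (≋-sym (ι-⊗ I.ζᶻ (power n))))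

  ψ-scaled : ∀ t z v → ψ z ≋ ιE v → ψ (t Complex.· z) ≋ (t · ιE v)
  ψ-scaled t z v (p , q) = ≋-trans (ψ-· t z) (*-cong ≈-refl p , *-cong ≈-refl q)

  ψ-≡ : ∀ {z w} → z ≡ w → ψ z ≋ ψ w
  ψ-≡ ≡.refl = ≋-refl

  module _ {_∙_ : ℂ → ℂ → ℂ} {ε : ℂ} (ψ-∙ : ∀ z w → ψ (z ∙ w) ≋ ψ z ⊕ ψ w) (ψ-ε : ψ ε ≋ (0# , 0#)) where

    ψ-foldr : ∀ {n} (z : Vector ℂ n) (t : Vector ℝ n) (v : Vector Z.E n) → (∀ k → ψ (z k) ≋ (t k · ιE (v k))) →
              ψ (Vector.foldr _∙_ ε z) ≋ combination (List.tabulate (λ k → t k , v k))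
    ψ-foldr {zero}  z t v z≋ = ψ-ε
    ψ-foldr {suc n} z t v z≋ = ≋-trans (ψ-∙ (Vector.head z) (Vector.foldr _∙_ ε (Vector.tail z)))
      (⊕-cong (z≋ zero) (ψ-foldr (Vector.tail z) (Vector.tail t) (Vector.tail v) (λ k → z≋ (suc k))))

  module _ {_∙_ : ℝ → ℝ → ℝ} {ε : ℝ} (∙-≈ : ∀ x y → x + y ≈ x ∙ y) (ε-≈ : 0# ≈ ε) where

    weight-foldr : ∀ {n} (t : Vector ℝ n) (v : Vector Z.E n) →
                   weight (List.tabulate (λ k → t k , v k)) ≈ Vector.foldr _∙_ ε t
    weight-foldr {zero}  t v = ε-≈
    weight-foldr {suc n} t v = ≈-trans (+-cong ≈-refl (weight-foldr (Vector.tail t) (Vector.tail v)))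
      (∙-≈ (Vector.head t) (Vector.foldr _∙_ ε (Vector.tail t)))

  sum≡foldr : ∀ {n} (z : Vector ℂ n) → Complex.sum z ≡ Vector.foldr Complex._+_ Complex.0# z
  sum≡foldr z = ≡.refl

  real-sum≡foldr : ∀ {n} (t : Vector ℝ n) → RawMonoidDefinitions.sum (RawRing.+-rawMonoid Real.rawRing) t ≡
      Vector.foldr Real._+_ Real.0# t
  real-sum≡foldr t = ≡.refl

  ^≡× : ∀ z n → z Complex.^ n ≡ n ×ᴹ z
  ^≡× z n = ≡.refl

  face-combination-regular : ∀ z l → IsFace (List.map proj₂ l) → All (λ (t , _) → Positive t) l → weight l ≈ ι (+ 1) →
                  ψ z ≋ combination l → Regular (ψ z)
  face-combination-regular z l face ps w≈1 z≋ = regular-resp (≋-sym z≋) (face-regular l face ps w≈1)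

  ψ-vertex : ∀ k → ψ (ζ Complex.^ k) ≋ ιE (power k)
  ψ-vertex k = ≋-trans (ψ-≡ (^≡× ζ k)) (ψ-power k)

  weight-vertices : ∀ {n} (t : Vector ℝ n) → RawMonoidDefinitions.sum (RawRing.+-rawMonoid Real.rawRing) t
      Real.≈ Real.1# →
                    weight (List.tabulate (λ k → t k , power (toℕ k))) ≈ ι (+ 1)
  weight-vertices t Σt≈1 = ≈-trans (weight-foldr +-≈ (rational-≈ 0ℚ) t (λ k → power (toℕ k)))
    (≈-trans (close (≡.subst (λ x → x Real.≈ Real.1#) (real-sum≡foldr t) Σt≈1)) (≈-sym (rational-≈ 1ℚ)))

  -- g k stands for ζ ^ k, which conversion checking would unfold.
  module _ (g : ℕ → ℂ) (ψ-g : ∀ k → ψ (g k) ≋ ιE (power k)) where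

    ψ-vertices : ∀ {n} (t : Vector ℝ n) → ψ (Complex.sum (λ k → t k Complex.· g (toℕ k))) ≋
                 combination (List.tabulate (λ k → t k , power (toℕ k)))
    ψ-vertices t = ≋-trans (ψ-≡ (sum≡foldr (λ k → t k Complex.· g (toℕ k))))
      (ψ-foldr ψ-+ ψ-0 (λ k → t k Complex.· g (toℕ k)) t (λ k → power (toℕ k)) (λ k →
        ψ-scaled (t k) (g (toℕ k)) (power (toℕ k)) (ψ-g (toℕ k))))

    vertices-regular : ∀ z (t : Vector ℝ 6) → (∀ k → Real.0# Real.< t k) →
                       RawMonoidDefinitions.sum (RawRing.+-rawMonoid Real.rawRing) t Real.≈ Real.1# →
                       z Complex.≈ Complex.sum (λ k → t k Complex.· g (toℕ k)) → Regular (ψ z)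
    vertices-regular z t 0<t Σt≈1 z≈ = face-combination-regular z (List.tabulate (λ k → t k , power (toℕ k)))
      -- The powers of ζ with exponents 0 to 5 compute to the list `units`.
      hexagon-face
      (pos (0<t zero) ∷ pos (0<t (suc zero)) ∷ pos (0<t (suc (suc zero))) ∷ pos (0<t (suc (suc (suc zero)))) ∷
       pos (0<t (suc (suc (suc (suc zero))))) ∷ pos (0<t (suc (suc (suc (suc (suc zero)))))) ∷ [])
      (weight-vertices t Σt≈1)
      (≋-trans {ψ z} {ψ (Complex.sum (λ k → t k Complex.· g (toℕ k)))}
          (ψ-cong {z} {Complex.sum (λ k → t k Complex.· g (toℕ k))} z≈) (ψ-vertices t))

  hexagon-regular : ∀ z → z ∈ OpenHexagon → Regular (ψ z)
  hexagon-regular z (t , 0<t , Σt≈1 , z≈) = vertices-regular (ζ Complex.^_) ψ-vertex z t 0<t Σt≈1 z≈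

  segment-regular : ∀ a b u v → ψ a ≋ ιE u → ψ b ≋ ιE v → IsFace (u ∷ v ∷ []) → ∀ z → z ∈ OpenSegment a b →
      Regular (ψ z)
  segment-regular a b u v a≋ b≋ face z (t , 0<t , t<1 , z≈) = face-combination-regular z
      ((t , u) ∷ (t′ , v) ∷ []) face
    (pos 0<t ∷ pos-resp t′≈ (<⇒positive-difference {t} {Real.1#} t<1) ∷ [])
    (weight≈1 t t′ t′≈)
    (≋-trans (ψ-cong {z} {t Complex.· a Complex.+ t′ Complex.· b} z≈) (≋-trans (ψ-+ (t Complex.· a) (t′ Complex.· b))
      (⊕-cong (ψ-scaled t a u a≋) (≋-trans (ψ-scaled t′ b v b≋) (⊕-zero (t′ · ιE v))))))
    where
    t′ : ℝ
    t′ = Real.1# Real.+ Real.- t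
    t′≈ : Real.1# + - t ≈ t′
    t′≈ = ≈-trans (+-cong ≈-refl (neg-≈ t)) (+-≈ Real.1# (Real.- t))
    ⊕-zero : ∀ z → z ≋ z ⊕ (0# , 0#)
    ⊕-zero (a , b) = ≈-sym (+-identityʳ a) , ≈-sym (+-identityʳ b)
    weight≈1 : ∀ t t′ → Real.1# + - t ≈ t′ → t + (t′ + 0#) ≈ ι (+ 1)
    weight≈1 t t′ eq = ≈-trans (+-cong ≈-refl (≈-trans (+-identityʳ t′) (≈-sym eq))) (≈-trans
      (≈-sym (+-assoc t Real.1# (- t))) (≈-trans (+-cong (+-comm t Real.1#) ≈-refl) (≈-trans (+-assoc Real.1# t (- t))
        (≈-trans (+-cong ≈-refl (+-inverseʳ t)) (≈-trans (+-identityʳ Real.1#) (≈-sym (rational-≈ 1ℚ)))))))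

  regular⊎exceptional : ∀ {z} → z ∈ U → Regular (ψ z) ⊎ Exceptional z
  regular⊎exceptional {z} (interior z∈) = inj₁ (hexagon-regular z z∈)
  regular⊎exceptional {z} (side₁ z∈) = inj₁ (segment-regular ζ (Complex.- Complex.conj ζ) I.ζᶻ (Z.neg I.ζ̄ᶻ)
    ψ-ζ (ψ-neg-ι (Complex.conj ζ) I.ζ̄ᶻ ψ-conj-ζ) side₁-face z z∈)
  regular⊎exceptional {z} (side₂ z∈) = inj₁ (segment-regular (Complex.- ζ) (Complex.- Complex.1#) (Z.neg I.ζᶻ)
      (Z.neg Z.𝟙)
    (ψ-neg-ι ζ I.ζᶻ ψ-ζ) (ψ-neg-ι Complex.1# Z.𝟙 ψ-1) side₂-face z z∈)
  regular⊎exceptional {z} (side₃ z∈) = inj₁ (segment-regular Complex.1# (Complex.conj ζ) Z.𝟙 I.ζ̄ᶻ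
    ψ-1 ψ-conj-ζ side₃-face z z∈)
  regular⊎exceptional (vertex₁ z≈) = inj₂ (⟨-ζ⟩ , z≈)
  regular⊎exceptional (vertex₂ z≈) = inj₂ (⟨ζ̄⟩ , z≈)

  location : ∀ {z} → z ∈ U → Regular (ψ z) ⊎ IsExceptional (ψ z)
  location z∈ = Sum.map₂ isExceptional (regular⊎exceptional z∈)

-- Induction along the expansion

module Expansion where

  open RealOrder
  open OrderedRing orderedRing using (ι)
  open Geometry orderedRing
  open Dynamics orderedRing
  open Location orderedRing
  open ComplexCoordinates
  open Points
  open Coordinates orderedRing √3 (√3 * ⅓) (rational ½) (SquareRootOfThree.√3-inverse-sq orderedRing √3² 3⅓≈1)
    (SquareRootOfThree.√3-inverse orderedRing √3² 3⅓≈1) 2½≈1 using (inverse-unique; zero-not-invertible)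
  open Directions using (Phase; phase-step; exceptionalDigit)

  ℂ-refl : ∀ z → z Complex.≈ z
  ℂ-refl z = close⁻¹ {re z} {re z} ≈-refl , close⁻¹ {im z} {im z} ≈-refl

  ψ-reciprocal : ∀ {z u} → z Reciprocal u → ψ z ⊗ ψ u ≋ 𝟙
  ψ-reciprocal {z} {u} zu≈1 = ≋-trans (≋-sym (ψ-* z u)) (≋-trans (ψ-cong {z Complex.* u} {Complex.1#} zu≈1) ψ-1)

  ψ-quotient : ∀ {u a} → a ∈ 𝒥 → ∃[ c ] ψ a ≋ ιD c × ψ u ≋ ψ (u Complex.- a) ⊕ ιD c
  ψ-quotient {u} {a} a∈ = let c , a≋ = 𝒥⇒D a∈ in c , a≋ , ≋-trans (restore (ψ u) (ψ a)) (⊕-cong (≋-sym (ψ-sub u a)) a≋)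
    where
    restore : ∀ x y → x ≋ x ⊖ y ⊕ y
    restore (a , b) (c , d) = line a c , line b d
      where
      line : ∀ a c → a ≈ a + - c + c
      line a c = ≈-sym (≈-trans (+-assoc a (- c) c) (≈-trans (+-cong ≈-refl (+-inverseˡ c)) (+-identityʳ a)))

  ⊕-cancel : ∀ {x y d} → x ≋ y ⊕ d → y ≋ x ⊖ d
  ⊕-cancel {x₁ , x₂} {y₁ , y₂} {d₁ , d₂} (p , q) = line p , line q
    where
    line : ∀ {x y d} → x ≈ y + d → y ≈ x + - d
    line {x} {y} {d} p = ≈-sym (≈-trans (+-cong p ≈-refl)
        (≈-trans (+-assoc y d (- d)) (≈-trans (+-cong ≈-refl (+-inverseʳ d)) (+-identityʳ y))))

  -- The mixed cases vanish because zero has no reciprocal; otherwise the reciprocals agree and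
  -- `unique` identifies the subtracted lattice points. Allowing different starting points with
  -- equal coordinates lets it iterate.
  T-unique : ∀ {z z′ v v′} → ψ z ≋ ψ z′ → T z v → T z′ v′ → ψ v ≋ ψ v′
  T-unique {v = v} {v′} _ (T-zero _ v≈0) (T-zero _ v′≈0) = ≋-trans (ψ-cong {v} {Complex.0#} v≈0)
      (≋-sym (ψ-cong {v′} {Complex.0#} v′≈0))
  T-unique {z} {z′} z≋ (T-zero z≈0 _) (T-nonzero {u = u} r _ _) = ⊥-elim (zero-not-invertible {ψ z′} {ψ u}
    (≋-trans (≋-sym z≋) (≋-trans (ψ-cong {z} {Complex.0#} z≈0) ψ-0)) (ψ-reciprocal {z′} {u} r))
  T-unique {z} {z′} z≋ (T-nonzero {u = u} r _ _) (T-zero z′≈0 _) = ⊥-elim (zero-not-invertible {ψ z} {ψ u}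
    (≋-trans z≋ (≋-trans (ψ-cong {z′} {Complex.0#} z′≈0) ψ-0)) (ψ-reciprocal {z} {u} r))
  T-unique {z} {z′} {v} {v′} z≋ (T-nonzero {u = u} {a} r (a∈ , u-a∈) v≈)
      (T-nonzero {u = u′} {a′} r′ (a′∈ , u′-a′∈) v′≈) =
    let c , _ , u≋ = ψ-quotient {u} {a} a∈
        c′ , _ , u′≋ = ψ-quotient {u′} {a′} a′∈
        ψu≋ψu′ : ψ u ≋ ψ u′
        ψu≋ψu′ = inverse-unique {ψ z} (ψ-reciprocal {z} {u} r)
            (≋-trans (⊗-cong z≋ ≋-refl) (ψ-reciprocal {z′} {u′} r′))
        c≡c′ : c ≡ c′
        c≡c′ = unique {ψ (u Complex.- a)} {ψ (u′ Complex.- a′)} {c} {c′}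
            (≋-trans (≋-sym u≋) (≋-trans ψu≋ψu′ u′≋)) (location u-a∈) (location u′-a′∈)
    in ≋-trans (ψ-cong {v} {u Complex.- a} v≈) (≋-trans (⊕-cancel u≋) (≋-trans
         (⊖-cong ψu≋ψu′ (ι-cong (≡.cong Directions.D c≡c′)))
             (≋-trans (≋-sym (⊕-cancel u′≋)) (≋-sym (ψ-cong {v′} {u′ Complex.- a′} v′≈)))))

  T^-unique : ∀ {n z v v′} → T^ n z v → T^ n z v′ → ψ v ≋ ψ v′
  T^-unique {z = z} {v} {v′} (T^-zero v≈z) (T^-zero v′≈z) = ≋-trans (ψ-cong {v} {z} v≈z)
      (≋-sym (ψ-cong {v′} {z} v′≈z))
  T^-unique (T^-suc p t) (T^-suc p′ t′) = T-unique (T^-unique p p′) t t′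

  -- `regular` includes the moment at which the orbit has just reached an exceptional point, since
  -- the prescribed digits start one index later; its last field then supplies their initial phase.
  -- Whether this has happened is read off from the next `PartialQuotient`.
  data Status (z : ℂ) (n : ℕ) (p q : Z.E) : Set where
    regular     : ∀ {v} → NoExceptionalBefore n z → T^ n z v → v ∈ U → State (ψ v) p q →
                  (IsExceptional (ψ v) → Phase 0 p q) → Status z n p q
    exceptional : ∀ {m w} ξ k → n ≡ m ℕ.+ suc k → NoExceptionalBefore m z → T^ m z w → w Complex.≈ point ξ →
                  Z.N p ℤ.< Z.N q → Phase (suc k) p q → Status z n p q

  increasing : ∀ {z n p q} → Status z n p q → Z.N p ℤ.< Z.N q
  increasing (regular _ _ _ s _)            = State.increasing s
  increasing (exceptional _ _ _ _ _ _ p<q _) = p<q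

  initial-status : ∀ {z} → z ∈ U → Status z 0 Z.𝟘 Z.𝟙
  initial-status {z} z∈ = regular (λ _ _ ()) (T^-zero (ℂ-refl z)) z∈
    (record { increasing = ℤ.+<+ ℕ.z<s
            ; avoidsX = λ u∈ x → ⊥-elim (proj₁ (Directions.initial u∈) x)
            ; avoidsY = λ u∈ y → ⊥-elim (proj₂ (Directions.initial u∈) y) })
    (λ _ → Directions.initial Directions.𝟙∈)

  generator∈ : ∀ ξ → exceptionalGenerator ξ ∈ˡ (I.ζᶻ ∷ I.ζ̄ᶻ ∷ [])
  generator∈ ⟨-ζ⟩ = here ≡.refl
  generator∈ ⟨ζ̄⟩  = there (here ≡.refl)

  Next : ℂ → ℂ → ℕ → Z.E → Z.E → Set
  Next z b n p q = ∃[ c ] ψ b ≋ ιD c × Status z n q (I.next c p q)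

  exceptional-step : ∀ {z b n m w p q} ξ k → n ≡ m ℕ.+ suc k → NoExceptionalBefore m z → T^ m z w →
      w Complex.≈ point ξ →
                     b Complex.≈ exceptionalQuotient ξ k → Z.N p ℤ.< Z.N q → Phase k p q → Next z b n p q
  exceptional-step {b = b} {p = p} {q} ξ k n≡ ¬exc Tᵐ w≈ b≈ p<q phase =
    let q<q′ , phase′ = phase-step (generator∈ ξ) k {p} {q} p<q phase in
    exceptionalDigit (exceptionalGenerator ξ) k ,
    ≋-trans (ψ-cong {b} {exceptionalQuotient ξ k} b≈) (ψ-exceptionalQuotient ξ k) ,
    exceptional ξ k n≡ ¬exc Tᵐ w≈ q<q′ phase′

  first-exceptional-unique : ∀ {z m m′ w w′ ξ ξ′} → NoExceptionalBefore m z → T^ m z w → w Complex.≈ point ξ →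
                             NoExceptionalBefore m′ z → T^ m′ z w′ → w′ Complex.≈ point ξ′ → m ≡ m′
  first-exceptional-unique {m = m} {m′} {w} {w′} {ξ} {ξ′} ¬exc Tᵐ w≈ ¬exc′ Tᵐ′ w′≈ = ℕ.≤-antisym
    (ℕ.≮⇒≥ λ m′<m → ¬exc m′ w′ m′<m Tᵐ′ (ξ′ , w′≈)) (ℕ.≮⇒≥ λ m<m′ → ¬exc′ m w m<m′ Tᵐ (ξ , w≈))

  -- The index m + suc k of an exceptional quotient does not unify with suc n, hence l and the
  -- equation. Quotient and status may come from different constructors; `NoExceptionalBefore`
  -- refutes the inconsistent pairs.
  status-step : ∀ {z b l n p q} → PartialQuotient z l b → l ≡ suc n → Status z n p q → Next z b (suc n) p q
  status-step {n = n} {p} {q} (regular {w = w} {u} {b} ¬exc Tⁿ r (b∈ , u-b∈)) ≡.refl (regular {v} _ Tⁿ′ v∈ state _) =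
    continue (ψ-quotient {u} {b} b∈) (regular⊎exceptional v∈)
    where
    continue : (∃[ c ] ψ b ≋ ιD c × ψ u ≋ ψ (u Complex.- b) ⊕ ιD c) → Regular (ψ v) ⊎ Exceptional v →
        Next _ b (suc n) p q
    -- `NoExceptionalBefore (suc n)` covers the index n itself, so the current point is not
    -- exceptional.
    continue _ (inj₂ v-exc) = ⊥-elim (¬exc n v (ℕ.n<1+n n) Tⁿ′ v-exc)
    continue (c , b≋ , u≋) (inj₁ v-reg) = c , b≋ ,
      regular ¬exc (T^-suc Tⁿ (T-nonzero {w} {u} {b} {u Complex.- b} r (b∈ , u-b∈) (ℂ-refl (u Complex.- b))))
        u-b∈ (state-step state) (λ (e , e∈ , x≋e) → phase-entry e∈ x≋e state)
      where
      open Step {ψ v} {ψ u} {ψ (u Complex.- b)} {c}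
        (≋-trans (⊗-cong (T^-unique Tⁿ′ Tⁿ) ≋-refl) (ψ-reciprocal {w} {u} r))
        (hexagonal v-reg) (N<1 v-reg) u≋ (location-hexagonal (location u-b∈)) (location-N≤1 (location u-b∈))
  status-step (regular ¬exc _ _ _) ≡.refl (exceptional {m} {w} ξ k n≡ _ Tᵐ w≈ _ _) =
    ⊥-elim (¬exc m w (ℕ.≤-trans (ℕ.s≤s (ℕ.m≤m+n m (suc k))) (ℕ.≤-reflexive (≡.cong suc (≡.sym n≡)))) Tᵐ (ξ , w≈))
  status-step (exceptional {m} {w} ξ zero ¬exc Tᵐ w≈ b≈) l≡ (regular {v} _ Tⁿ v∈ state entry) =
    exceptional-step ξ zero (≡.sym l≡) ¬exc Tᵐ w≈ b≈ (State.increasing state)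
      (entry (exceptionalPoint ξ , exceptionalPoint∈ ξ ,
        ≋-trans (T^-unique Tⁿ (≡.subst (λ m → T^ m _ w) m≡n Tᵐ)) (≋-trans (ψ-cong {w} {point ξ} w≈) (ψ-point ξ))))
    where
    m≡n = ℕ.suc-injective (≡.trans (≡.sym (ℕ.+-comm m 1)) l≡)
  status-step {n = n} (exceptional {m} {w} ξ (suc k) _ Tᵐ w≈ _) l≡ (regular ¬exc _ _ _ _) =
    ⊥-elim (¬exc m w (≡.subst (m ℕ.<_) (ℕ.suc-injective (≡.trans (≡.sym (ℕ.+-suc m (suc k))) l≡))
        (ℕ.m<m+n m ℕ.z<s)) Tᵐ (ξ , w≈))
  status-step {p = p} {q} (exceptional {m} {w} ξ k ¬exc Tᵐ w≈ b≈) l≡ (exceptional {m′} {w′} ξ′ k′ n≡ ¬exc′ Tᵐ′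
      w′≈ p<q phase)
    with first-exceptional-unique {ξ = ξ} {ξ′} ¬exc Tᵐ w≈ ¬exc′ Tᵐ′ w′≈
  ... | ≡.refl = exceptional-step ξ k (≡.sym l≡) ¬exc Tᵐ w≈ b≈ p<q (≡.subst (λ k → Phase k p q) (≡.sym k≡) phase)
    where
    k≡ : k ≡ suc k′
    k≡ = ℕ.suc-injective (ℕ.+-cancelˡ-≡ m (suc k) (suc (suc k′))
        (≡.trans l≡ (≡.trans (≡.cong suc n≡) (≡.sym (ℕ.+-suc m (suc k′))))))

  denominators-status : ∀ {z n p q} → z ∈ U → Denominators z n p q → ∃[ P ] ∃[ Q ] ψ p ≋ ιE P × ψ q ≋ ιE Q ×
      Status z n P Q
  denominators-status z∈ start = Z.𝟘 , Z.𝟙 , ψ-0 , ψ-1 , initial-status z∈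
  denominators-status z∈ (step {q = q} {b} d pq) =
    let P , Q , p≋ , q≋ , status = denominators-status z∈ d
        c , b≋ , status′ = status-step pq ≡.refl status
    in Q , I.next c P Q , q≋ , ψ-next c b≋ q≋ p≋ , status′

  norm-< : ∀ z w → Positive (N (ψ w) + - N (ψ z)) → Complex.∣ z ∣ Real.< Complex.∣ w ∣
  norm-< z w h = √-mono-< {sq z} {sq w} (sq-nonNeg z) (sq-nonNeg w) (pos-resp (+-cong (ψ-N w) (-‿cong (ψ-N z))) h)
    where
    sq : ℂ → ℝ
    sq z = re z Real.* re z Real.+ im z Real.* im z
    sq-nonNeg : ∀ z → NonNegative (sq z)
    sq-nonNeg z = nonNeg-resp (ψ-N z) (nonNeg-N (ψ z))

theorem4 : ∀ (z : ℂ) → z ∈ U → ∀ (n : ℕ) → 1 ℕ.≤ n →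
    ∀ (w : ℂ) → T^ n z w → ¬ (w Complex.≈ Complex.0#) →
    ∀ (qₙ qₙ₊₁ : ℂ) → Denominators z (suc n) qₙ qₙ₊₁ →
    Complex.∣ qₙ ∣ Real.< Complex.∣ qₙ₊₁ ∣
theorem4 z z∈ n 1≤n w Tⁿ w≉0 p q d =
  let P , Q , p≋ , q≋ , status = denominators-status z∈ d in norm-< p q (pos-resp
    (≈-trans (ι-sub (Z.N Q) (Z.N P)) (+-cong (≈-trans (ι-N Q) (N-cong (≋-sym q≋)))
        (-‿cong (≈-trans (ι-N P) (N-cong (≋-sym p≋))))))
    (OrderedRing.pos-ι orderedRing (difference (increasing status))))
  where
  open Expansion
  open RealOrder
  open Geometry orderedRing
  open ComplexCoordinates
  difference : ∀ {i j} → i ℤ.< j → + 0 ℤ.< j ℤ.- i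
  difference {i} {j} i<j = ≡.subst (ℤ._< j ℤ.- i) (ℤ.+-inverseʳ i) (ℤ.+-monoˡ-< (ℤ.- i) i<j)
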